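{- Let $G=(V,E,\Sigma,\lambda)$ be a labeled directed graph with $n=|V|$ and $m=|E|$, and let $\mathcal{G}=(N,\Sigma,P,S)$ be a linear context-free grammar in terminal-anchored linear normal form (TALNF) over the same alphabet. If $m=O(n)$, then the distance index LinDistIndex for $(G,\mathcal{G})$ (defined in the context) can be built in $O(|P|\cdot n^2)$ time and $O(|N|\cdot n^2)$ space, and it returns a shortest accepted path witness in time linear in the length of the witness.
   Context: A labeled directed graph is $G=(V,E,\Sigma,\lambda)$ with $V$ a finite set of vertices, $E\subseteq V\times V$ the directed edges, $\Sigma$ a finite alphabet, and $\lambda:E\to\Sigma$ a labeling of the edges. A path $\pi$ from $v_0$ to $v_k$ is a (possibly empty) sequence of edges $(v_0,v_1)\cdots(v_{k-1},v_k)$, of length $|\pi|=k$; the empty path at $u$ goes from $u$ to $u$. The trace is $\operatorname{tr}(\pi)=\lambda(v_0,v_1)\cdots\lambda(v_{k-1},v_k)\in\Sigma^*$. A context-free grammar is $\mathcal{G}=(N,\Sigma,P,S)$ with finite nonterminal set $N$, terminals $\Sigma$, productions $P$, start symbol $S\in N$; $|N|$ is the number of nonterminals and $|P|$ the number of productions; $\mathcal{L}_{\mathcal{G}}(A)$ is the language generated from $A\in N$. It is in TALNF if each production is one of $A\to a$, $A\to aB$, $A\to Ba$, or $S\to\varepsilon$, with $a\in\Sigma$ and $A,B\in N$. Shortest accepted path problem: for $s,t\in V$, the value is $\min\{|\pi| : \pi\text{ is a path from }s\text{ to }t,\ \operatorname{tr}(\pi)\in\mathcal{L}_{\mathcal{G}}(S)\}$,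 and $\infty$ if no such path exists; a shortest accepted path witness is a path attaining this minimum. LinDistIndex stores, for each nonterminal $A\in N$ and each pair $(u,v)\in V\times V$, the minimum path length $D_A[u,v]\in\mathbb{N}\cup\{\infty\}$ such that $A\Rightarrow^{*}\operatorname{tr}(\pi)$ for some path $\pi$ from $u$ to $v$ of length $D_A[u,v]$ (with $D_A[u,v]=\infty$ if there is no such path). -}

module Defs where

open import Data.Nat using (ℕ; zero; suc; _+_; _*_; _∸_; _^_; _≤_; _<_; _⊔_; _≟_)
open import Data.Fin using (Fin; toℕ)
open import Data.List using (List; []; _∷_; [_]; _++_; map; length; concat; tabulate)
open import Data.Maybe using (Maybe; just; nothing)
open import Data.Product using (Σ; ∃; _×_; _,_; proj₁; proj₂; Σ-syntax; ∃-syntax)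
open import Data.Sum using (_⊎_)
open import Data.Unit using (⊤)
open import Function.Definitions using (Injective)
open import Relation.Binary.PropositionalEquality using (_≡_; _≢_)
open import Relation.Binary.Construct.Closure.ReflexiveTransitive using (Star)
open import Relation.Nullary using (¬_; yes; no)

------------------------------------------------------------------------
-- Labeled directed graphs over the alphabet Fin σ

-- E ⊆ V × V is given by an enumeration without repetitions, in an arbitrary
-- order; m = |E|, and an edge is named by its position in the enumeration.
record LabeledDigraph (σ : ℕ) : Set where
  field
    n m            : ℕ
    edge           : Fin m → Fin n × Fin n
    edge-injective : Injective _≡_ _≡_ edge
    label          : Fin m → Fin σ

  V : Set
  V = Fin n

  src tgt : Fin m → V
  src e = proj₁ (edge e)
  tgt e = proj₂ (edge e)

open LabeledDigraph public using () renaming (n to ∣V∣; m to ∣E∣)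

module _ {σ : ℕ} (G : LabeledDigraph σ) where
  open LabeledDigraph G

  data Path : V → V → Set where
    []  : ∀ {u} → Path u u
    _∷_ : ∀ {v} (e : Fin m) → Path (tgt e) v → Path (src e) v

module _ {σ : ℕ} {G : LabeledDigraph σ} where
  open LabeledDigraph G

  ∣_∣ₚ : ∀ {u v} → Path G u v → ℕ
  ∣ [] ∣ₚ    = 0
  ∣ e ∷ π ∣ₚ = suc ∣ π ∣ₚ

  tr : ∀ {u v} → Path G u v → List (Fin σ)
  tr []      = []
  tr (e ∷ π) = label e ∷ tr π

  -- v₀ , v₁ , … , v_k
  nodes : ∀ {u v} → Path G u v → List V
  nodes {u} []      = [ u ]
  nodes {u} (e ∷ π) = u ∷ nodes π

------------------------------------------------------------------------
-- Context-free grammars with nonterminals Fin ν and terminals Fin σ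

data Symbol (ν σ : ℕ) : Set where
  nt : Fin ν → Symbol ν σ
  tm : Fin σ → Symbol ν σ

Production : ℕ → ℕ → Set
Production ν σ = Fin ν × List (Symbol ν σ)

-- The production set is enumerated without repetitions: ν = |N|, p = |P|.
record CFG (σ : ℕ) : Set where
  field
    ν p            : ℕ
    prod           : Fin p → Production ν σ
    prod-injective : Injective _≡_ _≡_ prod
    start          : Fin ν

  N : Set
  N = Fin ν

  Form : Set
  Form = List (Symbol ν σ)

open CFG public using () renaming (ν to ∣N∣; p to ∣P∣)

module _ {σ : ℕ} (𝒢 : CFG σ) where
  open CFG 𝒢

  record Step (x y : Form) : Set where
    constructor step
    field
      i    : Fin p
      α β  : Form
      from : x ≡ α ++ nt (proj₁ (prod i)) ∷ β
      to   : y ≡ α ++ proj₂ (prod i) ++ β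

  Derives : N → List (Fin σ) → Set
  Derives A w = Star Step [ nt A ] (map tm w)

  Linear : Set
  Linear = ∀ i →
    (∃[ x ] proj₂ (prod i) ≡ map tm x) ⊎
    (∃[ x ] ∃[ B ] ∃[ y ] proj₂ (prod i) ≡ map tm x ++ nt B ∷ map tm y)

data TALNFProduction {ν σ : ℕ} (S : Fin ν) : Production ν σ → Set where
  A→a  : ∀ A a   → TALNFProduction S (A , tm a ∷ [])
  A→aB : ∀ A a B → TALNFProduction S (A , tm a ∷ nt B ∷ [])
  A→Ba : ∀ A B a → TALNFProduction S (A , nt B ∷ tm a ∷ [])
  S→ε  : TALNFProduction S (S , [])

TALNF : ∀ {σ} → CFG σ → Set
TALNF 𝒢 = ∀ i → TALNFProduction (CFG.start 𝒢) (CFG.prod 𝒢 i)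

------------------------------------------------------------------------
-- Distances and shortest accepted paths

module _ {σ : ℕ} (G : LabeledDigraph σ) (𝒢 : CFG σ) where
  open LabeledDigraph G
  open CFG 𝒢

  -- IsDist A u v d : d = D_A[u,v], with nothing standing for ∞.
  IsDist : N → V → V → Maybe ℕ → Set
  IsDist A u v (just d) =
    (Σ[ π ∈ Path G u v ] Derives 𝒢 A (tr π) × ∣ π ∣ₚ ≡ d) ×
    (∀ (π : Path G u v) → Derives 𝒢 A (tr π) → d ≤ ∣ π ∣ₚ)
  IsDist A u v nothing = ∀ (π : Path G u v) → ¬ Derives 𝒢 A (tr π)

  Accepted : ∀ {s t} → Path G s t → Set
  Accepted π = Derives 𝒢 start (tr π)

  IsShortestAccepted : ∀ {s t} → Path G s t → Set
  IsShortestAccepted {s} {t} π =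
    Accepted π × (∀ (π′ : Path G s t) → Accepted π′ → ∣ π ∣ₚ ≤ ∣ π′ ∣ₚ)

------------------------------------------------------------------------
-- A word RAM, programmed in a small imperative language.
--
-- A program is a fixed finite piece of syntax, hence uses a constant number
-- of registers; the only unbounded storage is the memory.  Every node of an
-- expression that is evaluated and every command that is executed costs one
-- unit of time.

data Expr : Set where
  lit         : ℕ → Expr
  reg         : ℕ → Expr
  load        : Expr → Expr
  _⊞_ _⊟_ _⊠_ : Expr → Expr → Expr

data Cmd : Set where
  skip          : Cmd
  _≔_           : ℕ → Expr → Cmd
  store_at_     : Expr → Expr → Cmd
  _﹔_          : Cmd → Cmd → Cmd
  if_then_else_ : Expr → Cmd → Cmd → Cmd
  while_loop_   : Expr → Cmd → Cmd

infixr 4 _﹔_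
infix  5 _≔_ store_at_ if_then_else_ while_loop_
infixl 6 _⊞_ _⊟_
infixl 7 _⊠_

record State : Set where
  constructor ⟪_,_⟫
  field
    regs : ℕ → ℕ
    mem  : ℕ → ℕ
open State public

_[_↦_] : (ℕ → ℕ) → ℕ → ℕ → ℕ → ℕ
(f [ i ↦ x ]) j with j ≟ i
... | yes _ = x
... | no  _ = f j

setReg setMem : ℕ → ℕ → State → State
setReg i x s = ⟪ regs s [ i ↦ x ] , mem s ⟫
setMem i x s = ⟪ regs s , mem s [ i ↦ x ] ⟫

eval : Expr → State → ℕ
eval (lit x)  s = x
eval (reg i)  s = regs s i
eval (load e) s = mem s (eval e s)
eval (e ⊞ f)  s = eval e s + eval f s
eval (e ⊟ f)  s = eval e s ∸ eval f s
eval (e ⊠ f)  s = eval e s * eval f s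

cost : Expr → ℕ
cost (lit x)  = 1
cost (reg i)  = 1
cost (load e) = suc (cost e)
cost (e ⊞ f)  = suc (cost e + cost f)
cost (e ⊟ f)  = suc (cost e + cost f)
cost (e ⊠ f)  = suc (cost e + cost f)

-- A machine with M memory cells whose words hold numbers below W.  A run has
-- no derivation if it computes a value ≥ W or accesses an address ≥ M.
module Machine (M W : ℕ) where

  mutual
    Ok : Expr → State → Set
    Ok e s = Ok′ e s × eval e s < W

    Ok′ : Expr → State → Set
    Ok′ (lit x)  s = ⊤
    Ok′ (reg i)  s = ⊤
    Ok′ (load e) s = Ok e s × eval e s < M
    Ok′ (e ⊞ f)  s = Ok e s × Ok f s
    Ok′ (e ⊟ f)  s = Ok e s × Ok f s
    Ok′ (e ⊠ f)  s = Ok e s × Ok f s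

  -- ⟨ c , s ⟩⇓⟨ s′ , t ⟩ : started in s, c halts in s′ after time t.
  data ⟨_,_⟩⇓⟨_,_⟩ : Cmd → State → State → ℕ → Set where
    skip       : ∀ {s} → ⟨ skip , s ⟩⇓⟨ s , 1 ⟩
    assign     : ∀ {s i e} → Ok e s →
                 ⟨ i ≔ e , s ⟩⇓⟨ setReg i (eval e s) s , suc (cost e) ⟩
    store      : ∀ {s e a} → Ok e s → Ok a s → eval a s < M →
                 ⟨ store e at a , s ⟩⇓⟨ setMem (eval a s) (eval e s) s
                                      , suc (cost e + cost a) ⟩
    seq        : ∀ {c d s s′ s″ t t′} →
                 ⟨ c , s ⟩⇓⟨ s′ , t ⟩ → ⟨ d , s′ ⟩⇓⟨ s″ , t′ ⟩ →
                 ⟨ c ﹔ d , s ⟩⇓⟨ s″ , suc (t + t′) ⟩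
    if-true    : ∀ {e c d s s′ t} → Ok e s → eval e s ≢ 0 →
                 ⟨ c , s ⟩⇓⟨ s′ , t ⟩ →
                 ⟨ if e then c else d , s ⟩⇓⟨ s′ , suc (cost e + t) ⟩
    if-false   : ∀ {e c d s s′ t} → Ok e s → eval e s ≡ 0 →
                 ⟨ d , s ⟩⇓⟨ s′ , t ⟩ →
                 ⟨ if e then c else d , s ⟩⇓⟨ s′ , suc (cost e + t) ⟩
    while-stop : ∀ {e c s} → Ok e s → eval e s ≡ 0 →
                 ⟨ while e loop c , s ⟩⇓⟨ s , suc (cost e) ⟩
    while-step : ∀ {e c s s′ s″ t t′} → Ok e s → eval e s ≢ 0 →
                 ⟨ c , s ⟩⇓⟨ s′ , t ⟩ → ⟨ while e loop c , s′ ⟩⇓⟨ s″ , t′ ⟩ →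
                 ⟨ while e loop c , s ⟩⇓⟨ s″ , suc (cost e + t) + t′ ⟩

open Machine public using () renaming (⟨_,_⟩⇓⟨_,_⟩ to Runs)

-- C · f, read as C where f vanishes (a program takes at least one step even
-- when, say, there are no productions or the witness is the empty path).
O[_] : ℕ → ℕ → ℕ
O[ C ] f = C * (1 ⊔ f)

------------------------------------------------------------------------
-- Memory layout of input and output

encodeProduction : ∀ {ν σ} {S : Fin ν} {r : Production ν σ} →
                   TALNFProduction S r → List ℕ
encodeProduction         (A→a A a)    = 0 ∷ toℕ A ∷ toℕ a ∷ 0 ∷ []
encodeProduction         (A→aB A a B) = 1 ∷ toℕ A ∷ toℕ a ∷ toℕ B ∷ []
encodeProduction         (A→Ba A B a) = 2 ∷ toℕ A ∷ toℕ a ∷ toℕ B ∷ []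
encodeProduction {S = S} S→ε          = 3 ∷ toℕ S ∷ 0 ∷ 0 ∷ []

module _ {σ : ℕ} (G : LabeledDigraph σ) (𝒢 : CFG σ) where
  open LabeledDigraph G
  open CFG 𝒢

  -- A header followed by the plain lists of edges and of productions, in the
  -- order of their enumerations (no adjacency lists or other indexing).
  encode : TALNF 𝒢 → List ℕ
  encode talnf =
    n ∷ m ∷ σ ∷ ν ∷ p ∷ toℕ start ∷
    concat (tabulate λ e → toℕ (src e) ∷ toℕ (tgt e) ∷ toℕ (label e) ∷ []) ++
    concat (tabulate λ i → encodeProduction (talnf i))

  -- The input together with C · f further cells.
  memoryBound : TALNF 𝒢 → ℕ → ℕ → ℕ
  memoryBound talnf C f = length (encode talnf) + O[ C ] f

  -- Words have O(log (n + m + |Σ| + |N| + |P|)) bits.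
  wordBound : ℕ → ℕ
  wordBound k = (2 + (n + m + σ + ν + p)) ^ k

contents : List ℕ → ℕ → ℕ
contents []       i       = 0
contents (x ∷ xs) zero    = x
contents (x ∷ xs) (suc i) = contents xs i

-- Registers and all memory cells outside the input are initially zero.
initial : List ℕ → State
initial input = ⟪ (λ _ → 0) , contents input ⟫

Holds : (ℕ → ℕ) → ℕ → List ℕ → Set
Holds f a []       = ⊤
Holds f a (x ∷ xs) = f a ≡ x × Holds f (suc a) xs

-- The list xs occupies the cells a, a+1, … of a memory with M cells.
StoredAt : ℕ → State → ℕ → List ℕ → Set
StoredAt M s a xs = a + length xs ≤ M × Holds (mem s) a xs

-- ∞ is represented by 0 and d by d+1.
code : Maybe ℕ → ℕ
code nothing  = 0
code (just d) = suc d

tableReg sourceReg targetReg distReg pathReg : ℕ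
tableReg  = 0
sourceReg = 1
targetReg = 2
distReg   = 3
pathReg   = 4

module _ {σ : ℕ} (G : LabeledDigraph σ) (𝒢 : CFG σ) where
  open LabeledDigraph G
  open CFG 𝒢

  -- The table D lies inside the M memory cells, in row-major order, starting
  -- at the address in tableReg.
  StoresDistances : ℕ → State → Set
  StoresDistances M s =
    regs s tableReg + ν * (n * n) ≤ M ×
    (∀ A u v → ∃[ d ] IsDist G 𝒢 A u v d ×
      mem s (regs s tableReg + ((toℕ A * n + toℕ u) * n + toℕ v)) ≡ code d)

  ask : V → V → State → State
  ask s t x = setReg sourceReg (toℕ s) (setReg targetReg (toℕ t) x)

  -- State x is a correct answer, given in time at most b ℓ for a witness of
  -- length ℓ: either distReg holds its length and pathReg the address of its
  -- vertex sequence, or distReg reports that there is no accepted path.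
  Answers : ℕ → (ℕ → ℕ) → V → V → State → ℕ → Set
  Answers M b s t x time =
    (Σ[ π ∈ Path G s t ] IsShortestAccepted G 𝒢 π ×
      regs x distReg ≡ code (just ∣ π ∣ₚ) ×
      StoredAt M x (regs x pathReg) (map toℕ (nodes π)) ×
      time ≤ b ∣ π ∣ₚ)
    ⊎
    ((∀ (π : Path G s t) → ¬ Accepted G 𝒢 π) ×
      regs x distReg ≡ code nothing ×
      time ≤ b 0)

  -- Index is the set of memory states holding a LinDistIndex.  It is closed
  -- under queries, so that any number of them can be asked in succession.
  IsLinDistIndex : (M W : ℕ) → (ℕ → ℕ) → Cmd → (State → Set) → Set
  IsLinDistIndex M W b query Index =
    ∀ x → Index x →
      StoresDistances M x ×
      (∀ s t → ∃[ x′ ] ∃[ time ]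
        Runs M W query (ask s t x) x′ time × Index x′ × Answers M b s t x′ time)

{-# OPTIONS --safe #-}
module Submission where

-- The index is computed by breadth-first search on the triples (A , u , v): a
-- production A → a B and an edge from u to u′ with label a lead from (B , u′ , v)
-- to (A , u , v) at the cost of one edge, and productions A → B a extend paths at
-- their other end.  With a further nonterminal E → ε, a production A → a becomes
-- A → a E, so that the search starts at distance 0 from the triples (E , v , v)
-- and, if S → ε, from the triples (S , v , v).  A production and an edge are
-- combined for at most n triples, which gives O(|P| m n) = O(|P| n²) steps once
-- the productions with B on the right-hand side and the edges at a vertex are
-- linked into lists; the links of the productions overwrite the input, because
-- there is no room for |P| further cells.  Every discovered triple records the
-- vertex split off and the remaining triple, so that a query unwinds a shortest
-- path from both of its ends.
--
-- The programs are verified as programs on disjoint arrays, whose states are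
-- explicit vectors; the word RAM simulates them at equal cost.  As D[A,u,v] = ∞ is
-- represented by 0, the initial memory already holds the empty table.

-- The time bound rests on a double count. A popped triple (B , u , v) is charged, for every
-- production with B on the right-hand side, with the edges into u and the edges out of v. No triple
-- is queued twice, so the total is at most the sum of this charge over all triples, and that sum
-- factors: the lists of productions have at most |P| elements together, and the degrees at one
-- vertex sum to at most m for each of the n choices of the other vertex. This gives |P| (n (n + m)
-- + n m), a multiple of |P| n² as m = O(n).
--
-- Minimality of the distances is not read off the order of the search. When the queue is exhausted,
-- all extensions of a queued triple have entries at most one larger than its own, and induction on
-- walks bounds an entry by the length of any walk. The order serves this closure: a triple found
-- earlier keeps its entry, which therefore must not exceed that of a later candidate.

open import Defs
open import Data.Bool using (Bool; true; false; T; _∧_)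
open import Data.Bool.Properties using (T-∧)
open import Data.Fin using (Fin; zero; suc; toℕ; fromℕ<; #_; _↑ˡ_; _↑ʳ_)
open import Data.Fin.Properties using (toℕ<n; toℕ-injective; toℕ-fromℕ<; injective⇒≤) renaming (_≟_ to _≟F_)
open import Data.List using (List; []; _∷_; [_]; _++_; length; map; concat; tabulate)
open import Data.List.Membership.Propositional using (_∈_)
open import Data.List.Properties using (length-++; length-map; ++-assoc; ++-identityʳ; map-++; ∷-injective)
open import Data.List.Relation.Unary.All using (All; []; _∷_)
open import Data.List.Relation.Unary.All.Properties using (++⁺; concat⁺; tabulate⁺)
open import Data.List.Relation.Unary.Any using (here; there)
open import Data.Maybe using (just; nothing)
open import Data.Nat
open import Data.Nat.DivMod
open import Data.Nat.Divisibility using (n∣m*n)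
open import Data.Nat.Properties
open import Data.Nat.Solver using (module +-*-Solver)
open import Data.Product using (Σ; _×_; _,_; proj₁; proj₂; Σ-syntax; ∃-syntax)
open import Data.Sum using (_⊎_; inj₁; inj₂)
open import Data.Unit using (⊤; tt)
open import Data.Vec as Vec using (Vec; []; _∷_; lookup; _[_]≔_)
open import Data.Vec.Properties using (lookup∘update; lookup∘update′; lookup∘tabulate; lookup-map; lookup-++ˡ; lookup-++ʳ)
open import Data.Vec.Relation.Unary.All as VecAll using ([]; _∷_)
open import Data.Vec.Relation.Unary.All.Properties using (lookup⁺)
open import Function using (_∘_; Equivalence)
open import Relation.Binary.Construct.Closure.ReflexiveTransitive using (Star; ε; _◅_; gmap)
open import Relation.Binary.Definitions using (tri<; tri≈; tri>)
open import Relation.Binary.PropositionalEquality hiding ([_])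
open import Relation.Nullary using (¬_; Dec; yes; no; contradiction)

-- Arithmetic of the resource bounds

-- Here count is the length of the queue and S the number of steps from its
-- elements along productions and edges.
build-time-bound : ∀ c {n m p S count} → 1 ≤ n → 1 ≤ p → m ≤ c * n →
  S ≤ p * (n * (n + m) + n * m) → count ≤ S + (p * n + n) →
  1 + (1 + m) + (1 + n * 2) + (1 + p * (suc n * 2)) + (1 + (count + S) * 2) ≤ (20 + 9 * c) * (p * (n * n))
build-time-bound c {n} {m} {p} {S} {count} 1≤n 1≤p m≤ S≤ count≤ = begin
  1 + (1 + m) + (1 + n * 2) + (1 + p * (suc n * 2)) + (1 + (count + S) * 2)
    ≤⟨ +-mono-≤ (+-mono-≤ (+-mono-≤ (+-mono-≤ 1≤N (+-mono-≤ 1≤N m≤N)) (+-mono-≤ 1≤N (*-monoˡ-≤ 2 n≤N))) (+-mono-≤ 1≤N p-part))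
         (+-mono-≤ 1≤N (*-monoˡ-≤ 2 (+-mono-≤ (≤-trans count≤ (+-mono-≤ S≤N (+-mono-≤ pn≤N n≤N))) S≤N))) ⟩
  N + (N + c * N) + (N + N * 2) + (N + (N * 2 + N * 2)) + (N + ((N + c * N * 2) + (N + N) + (N + c * N * 2)) * 2)
    ≡⟨ solve 2 (λ N c → N :+ (N :+ c :* N) :+ (N :+ N :* con 2) :+ (N :+ (N :* con 2 :+ N :* con 2)) :+
                        (N :+ ((N :+ c :* N :* con 2) :+ (N :+ N) :+ (N :+ c :* N :* con 2)) :* con 2)
                      := (con 19 :+ con 9 :* c) :* N) refl N c ⟩
  (19 + 9 * c) * N
    ≤⟨ *-monoˡ-≤ N (n≤1+n (19 + 9 * c)) ⟩
  (20 + 9 * c) * N ∎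
  where
  open ≤-Reasoning
  open +-*-Solver
  N : ℕ
  N = p * (n * n)
  instance
    nz : NonZero n
    nz = >-nonZero 1≤n
    pz : NonZero p
    pz = >-nonZero 1≤p
  n≤nn : n ≤ n * n
  n≤nn = m≤m*n n n
  nn≤N : n * n ≤ N
  nn≤N = m≤n*m (n * n) p
  n≤N : n ≤ N
  n≤N = ≤-trans n≤nn nn≤N
  1≤N : 1 ≤ N
  1≤N = ≤-trans 1≤n n≤N
  pn≤N : p * n ≤ N
  pn≤N = *-monoʳ-≤ p n≤nn
  p≤N : p ≤ N
  p≤N = ≤-trans (m≤m*n p n) pn≤N
  m≤N : m ≤ c * N
  m≤N = ≤-trans m≤ (*-monoʳ-≤ c n≤N)
  p-part : p * (suc n * 2) ≤ N * 2 + N * 2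
  p-part = ≤-trans (≤-reflexive (solve 2 (λ p n → p :* ((con 1 :+ n) :* con 2) := p :* con 2 :+ p :* n :* con 2) refl p n))
                   (+-mono-≤ (*-monoˡ-≤ 2 p≤N) (*-monoˡ-≤ 2 pn≤N))
  S≤N : S ≤ N + c * N * 2
  S≤N = ≤-trans S≤ (≤-trans (*-monoʳ-≤ p (+-mono-≤ (*-monoʳ-≤ n (+-monoʳ-≤ n m≤)) (*-monoʳ-≤ n m≤)))
    (≤-reflexive (solve 3 (λ p n c → p :* (n :* (n :+ c :* n) :+ n :* (c :* n))
                                   := p :* (n :* n) :+ c :* (p :* (n :* n)) :* con 2) refl p n c)))

+-middle : ∀ a x b → a + (x + b) ≤ (a + b) + x
+-middle a x b = ≤-reflexive (trans (cong (a +_) (+-comm x b)) (sym (+-assoc a b x)))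

+-rotate : ∀ a b c → a + (b + c) ≡ b + a + c
+-rotate a b c = trans (sym (+-assoc a b c)) (cong (_+ c) (+-comm a b))

-- One round of a loop costs `a` units of size `x` and the remaining rounds `b` units; the additive
-- `y` is paid once, for the final test.
amortise : ∀ a b x {y t t′} → t ≤ a * x → t′ ≤ y + b * x → t + t′ ≤ y + (a + b) * x
amortise a b x {y} {t} {t′} t≤ t′≤ = begin
  t + t′                ≤⟨ +-mono-≤ t≤ t′≤ ⟩
  a * x + (y + b * x)   ≡⟨ trans (+-rotate (a * x) y (b * x)) (+-assoc y (a * x) (b * x)) ⟩
  y + (a * x + b * x)   ≡⟨ cong (y +_) (*-distribʳ-+ x a b) ⟨
  y + (a + b) * x       ∎
  where open ≤-Reasoning

iterate-bound : ∀ {t t′ y} k x → t ≤ x → t′ ≤ y + k * x → t + t′ ≤ y + suc k * x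
iterate-bound k x t≤ = amortise 1 k x (≤-trans t≤ (≤-reflexive (sym (*-identityˡ x))))

shuffle-times : ∀ a b c d e f →
  suc (a + suc (e + suc (b + suc (f + suc (c + d))))) ≡ (5 + e + f) + a + b + c + d
shuffle-times = solve 6 (λ a b c d e f →
  con 1 :+ (a :+ (con 1 :+ (e :+ (con 1 :+ (b :+ (con 1 :+ (f :+ (con 1 :+ (c :+ d)))))))))
    := (con 5 :+ e :+ f) :+ a :+ b :+ c :+ d) refl
  where open +-*-Solver

collect-times : ∀ a b c d e x → a * x + b * x + c * x + d * x + e * x ≡ (a + b + c + d + e) * x
collect-times = solve 6 (λ a b c d e x →
  a :* x :+ b :* x :+ c :* x :+ d :* x :+ e :* x := (a :+ b :+ c :+ d :+ e) :* x) refl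
  where open +-*-Solver

abstract
  -- The exponent is 9 · 8. Numbers kept in registers and arrays stay below `valueBound S`, and the
  -- value of an expression of weight at most 8 stays below its eighth power. Of the nine factors
  -- `S`, three bound the size of a table and six absorb constant factors, since `2 ≤ S` gives
  -- `64 ≤ S ^ 6`. Being abstract, these powers are never unfolded.
  wordExponent : ℕ
  wordExponent = 72

  valueBound : ℕ → ℕ
  valueBound S = S ^ 9

  valueBound^8≤ : ∀ S → valueBound S ^ 8 ≤ S ^ wordExponent
  valueBound^8≤ S = ≤-reflexive (^-*-assoc S 9 8)

  64*S³≤valueBound : ∀ {S} → 2 ≤ S → 64 * (S * S * S) ≤ valueBound S
  64*S³≤valueBound {S} 2≤S = begin
    64 * (S * S * S)  ≤⟨ *-monoˡ-≤ (S * S * S) (^-monoˡ-≤ 6 2≤S) ⟩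
    S ^ 6 * (S * S * S) ≡⟨ cong (S ^ 6 *_) (trans (*-assoc S S S) (cong (λ x → S * (S * x)) (sym (*-identityʳ S)))) ⟩
    S ^ 6 * S ^ 3     ≡⟨ ^-distribˡ-+-* S 6 3 ⟨
    S ^ 9             ∎
    where open ≤-Reasoning

module Sizes (n m σ ν p : ℕ) where

  S Q : ℕ
  S = 2 + (n + m + σ + ν + p)
  Q = S * S * S

  2≤S : 2 ≤ S
  2≤S = m≤m+n 2 _

  n≤S : 2 + n ≤ S
  n≤S = +-monoʳ-≤ 2 (≤-trans (m≤m+n n m) (≤-trans (m≤m+n (n + m) σ) (≤-trans (m≤m+n (n + m + σ) ν) (m≤m+n _ p))))

  m≤S : 2 + m ≤ S
  m≤S = +-monoʳ-≤ 2 (≤-trans (m≤n+m m n) (≤-trans (m≤m+n (n + m) σ) (≤-trans (m≤m+n (n + m + σ) ν) (m≤m+n _ p))))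

  σ≤S : 2 + σ ≤ S
  σ≤S = +-monoʳ-≤ 2 (≤-trans (m≤n+m σ (n + m)) (≤-trans (m≤m+n (n + m + σ) ν) (m≤m+n _ p)))

  ν≤S : 2 + ν ≤ S
  ν≤S = +-monoʳ-≤ 2 (≤-trans (m≤n+m ν (n + m + σ)) (m≤m+n _ p))

  p≤S : 2 + p ≤ S
  p≤S = +-monoʳ-≤ 2 (m≤n+m p (n + m + σ + ν))

  S≤Q : S ≤ Q
  S≤Q = ≤-trans (m≤m*n S S) (m≤m*n (S * S) S)

  1≤Q : 1 ≤ Q
  1≤Q = ≤-trans (≤-trans (s≤s z≤n) 2≤S) S≤Q

  64*Q≤B : 64 * Q ≤ valueBound S
  64*Q≤B = 64*S³≤valueBound 2≤S

  ≤B : ∀ {x} k → x ≤ k * Q → k ≤ 64 → x ≤ valueBound S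
  ≤B k x≤ k≤ = ≤-trans x≤ (≤-trans (*-monoˡ-≤ Q k≤) 64*Q≤B)

  <B : ∀ {x} → 2 + x ≤ S → x < valueBound S
  <B {x} x≤ = ≤B 1 (≤-trans (≤-trans (n≤1+n (suc x)) x≤) (≤-trans S≤Q (≤-reflexive (sym (*-identityˡ Q))))) (s≤s z≤n)

  sν<B : suc ν < valueBound S
  sν<B = ≤B 1 (≤-trans ν≤S (≤-trans S≤Q (≤-reflexive (sym (*-identityˡ Q))))) (s≤s z≤n)

  16≤B : 16 ≤ valueBound S
  16≤B = ≤B 16 (*-monoʳ-≤ 16 1≤Q) (m≤m+n 16 48)

  size≤Q : suc ν * n * n ≤ Q
  size≤Q = *-mono-≤ (*-mono-≤ (≤-trans (n≤1+n (suc ν)) ν≤S) n≤S′) n≤S′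
    where n≤S′ = ≤-trans (m≤n+m n 2) n≤S

  4+size≤B : 4 + suc ν * n * n ≤ valueBound S
  4+size≤B = ≤B 5 (≤-trans (+-mono-≤ (*-monoʳ-≤ 4 1≤Q) (≤-trans size≤Q (≤-reflexive (sym (*-identityˡ Q)))))
                      (≤-reflexive (sym (*-distribʳ-+ Q 4 1)))) (m≤m+n 5 59)

  -- Apart from the successor, the left-hand side is the end of the memory in use: header, edges,
  -- productions, distance table, output, and eleven interleaved arrays of length `t + (m + n)`.
  top<B : ∀ {t} → t ≡ suc ν * n * n →
          suc (6 + m * 3 + p * 4 + t + t + (t + (m + n)) * 11) ≤ valueBound S
  top<B {t} refl = ≤B 49 (begin
    suc (6 + m * 3 + p * 4 + t + t + (t + (m + n)) * 11)
      ≤⟨ +-mono-≤ (+-mono-≤ (+-mono-≤ (+-mono-≤ (+-mono-≤ (*-monoʳ-≤ 7 1≤Q) (*-monoˡ-≤ 3 m≤Q)) (*-monoˡ-≤ 4 p≤Q)) size≤Q) size≤Q)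
           (*-monoˡ-≤ 11 (+-mono-≤ size≤Q (+-mono-≤ m≤Q n≤Q))) ⟩
    7 * Q + Q * 3 + Q * 4 + Q + Q + (Q + (Q + Q)) * 11
      ≡⟨ solve 1 (λ q → con 7 :* q :+ q :* con 3 :+ q :* con 4 :+ q :+ q :+ (q :+ (q :+ q)) :* con 11 := con 49 :* q) refl Q ⟩
    49 * Q ∎) (m≤m+n 49 15)
    where
    open ≤-Reasoning
    open +-*-Solver
    m≤Q = ≤-trans (m≤n+m m 2) (≤-trans m≤S S≤Q)
    n≤Q = ≤-trans (m≤n+m n 2) (≤-trans n≤S S≤Q)
    p≤Q = ≤-trans (m≤n+m p 2) (≤-trans p≤S S≤Q)

  -- The space beyond the input. The extra nonterminal is paid for by `1 ≤ ν`, which gives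
  -- `t ≤ 2 * (ν * (n * n))`; the constant is 2 + 2 + 11 · (2 + c + 1).
  memory-bound : ∀ c → 1 ≤ ν → m ≤ c * n →
    let t = suc ν * n * n in t + (t + (t + (m + n)) * 11) ≤ (37 + 11 * c) * (ν * (n * n))
  memory-bound c 1≤ν m≤ = begin
    t + (t + (t + (m + n)) * 11)
      ≤⟨ +-mono-≤ t≤ (+-mono-≤ t≤ (*-monoˡ-≤ 11 (+-mono-≤ t≤ (+-mono-≤ (≤-trans m≤ (*-monoʳ-≤ c n≤R)) n≤R)))) ⟩
    2 * R + (2 * R + (2 * R + (c * R + R)) * 11)
      ≡⟨ solve 2 (λ r c → con 2 :* r :+ (con 2 :* r :+ (con 2 :* r :+ (c :* r :+ r)) :* con 11)
                        := (con 37 :+ con 11 :* c) :* r) refl R c ⟩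
    (37 + 11 * c) * R ∎
    where
    open ≤-Reasoning
    open +-*-Solver
    t R : ℕ
    t = suc ν * n * n
    R = ν * (n * n)
    n≤n*n : ∀ k → k ≤ k * k
    n≤n*n zero    = z≤n
    n≤n*n (suc k) = m≤m*n (suc k) (suc k)
    nn≤R : n * n ≤ R
    nn≤R = m≤n*m (n * n) ν ⦃ >-nonZero 1≤ν ⦄
    n≤R : n ≤ R
    n≤R = ≤-trans (n≤n*n n) nn≤R
    t≤ : t ≤ 2 * R
    t≤ = ≤-trans (≤-reflexive (*-assoc (suc ν) n n))
           (+-mono-≤ nn≤R (≤-reflexive (sym (+-identityʳ R))))

-- A language of arrays and its simulation on the word RAM

↦-same : ∀ (f : ℕ → ℕ) i x → (f [ i ↦ x ]) i ≡ x
↦-same f i x with i ≟ i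
... | yes _  = refl
... | no i≢i = contradiction refl i≢i

↦-other : ∀ (f : ℕ → ℕ) {i j} x → j ≢ i → (f [ i ↦ x ]) j ≡ f j
↦-other f {i} {j} x j≢i with j ≟ i
... | yes j≡i = contradiction j≡i j≢i
... | no _    = refl

pair-injective : ∀ {k} q q′ {r r′} → r < k → r′ < k →
                 q * k + r ≡ q′ * k + r′ → q ≡ q′ × r ≡ r′
pair-injective zero zero r<k r′<k eq = refl , eq
pair-injective {k} zero (suc q′) {r} {r′} r<k r′<k eq =
  contradiction r<k (≤⇒≯ (subst (k ≤_) (sym (trans eq (+-assoc k (q′ * k) r′))) (m≤m+n k _)))
pair-injective {k} (suc q) zero {r} {r′} r<k r′<k eq =
  contradiction r′<k (≤⇒≯ (subst (k ≤_) (trans (sym (+-assoc k (q * k) r)) eq) (m≤m+n k _)))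
pair-injective {k} (suc q) (suc q′) {r} {r′} r<k r′<k eq =
  let q≡ , r≡ = pair-injective q q′ r<k r′<k (+-cancelˡ-≡ k _ _
                  (trans (sym (+-assoc k (q * k) r)) (trans eq (+-assoc k (q′ * k) r′))))
  in cong suc q≡ , r≡

pair-bound : ∀ {N k q r} → q < N → r < k → q * k + r < N * k
pair-bound {N} {k} {q} {r} q<N r<k =
  <-≤-trans (+-monoʳ-< (q * k) r<k) (subst (_≤ N * k) (+-comm k (q * k)) (*-monoˡ-≤ k q<N))

#regs #arrays : ℕ
#regs   = 30
#arrays = 18

-- The four `prods` arrays and the eleven `cell` arrays are interleaved. For `prods` this is the
-- layout of the productions in the input, four words each, so that these arrays are a view of the
-- input itself; for `cell` it lets a single base address serve all eleven.
data Arr : Set where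
  input dist out : Arr
  prods          : Fin 4 → Arr
  cell           : Fin 11 → Arr

pos : Arr → Fin #arrays
pos input      = zero
pos dist       = suc zero
pos out        = suc (suc zero)
pos (prods f)  = suc (suc (suc (f ↑ˡ 11)))
pos (cell f)   = suc (suc (suc (4 ↑ʳ f)))

arrs : Vec Arr #arrays
arrs = input ∷ dist ∷ out ∷ Vec.tabulate prods Vec.++ Vec.tabulate cell

lookup-pos : ∀ r → lookup arrs (pos r) ≡ r
lookup-pos input     = refl
lookup-pos dist      = refl
lookup-pos out       = refl
lookup-pos (prods f) = trans (lookup-++ˡ (Vec.tabulate prods) (Vec.tabulate cell) f) (lookup∘tabulate prods f)
lookup-pos (cell f)  = trans (lookup-++ʳ (Vec.tabulate prods) (Vec.tabulate cell) f) (lookup∘tabulate cell f)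

pos-injective : ∀ r r′ → pos r ≡ pos r′ → r ≡ r′
pos-injective r r′ eq = trans (sym (lookup-pos r)) (trans (cong (lookup arrs) eq) (lookup-pos r′))

data Term : Set where
  con         : ℕ → Term
  var         : Fin #regs → Term
  get         : Arr → Term → Term
  _⊕_ _⊖_ _⊗_ : Term → Term → Term

infixl 7 _⊕_ _⊖_
infixl 8 _⊗_

data Instr : Set where
  _:=_     : Fin #regs → Term → Instr
  put      : Arr → Term → Term → Instr

infix 6 _:=_

data Prog : Set where
  blk  : List Instr → Prog
  _⨾_  : Prog → Prog → Prog
  ite  : Term → Prog → Prog → Prog
  loop : Term → Prog → Prog

infixr 4 _⨾_

St : Set
St = Vec ℕ #regs × Vec (ℕ → ℕ) #arrays

val : Term → St → ℕ
val (con x)   s = x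
val (var i)   s = lookup (proj₁ s) i
val (get r e) s = lookup (proj₂ s) (pos r) (val e s)
val (e ⊕ f)   s = val e s + val f s
val (e ⊖ f)   s = val e s ∸ val f s
val (e ⊗ f)   s = val e s * val f s

execute : Instr → St → St
execute (i := e)    s = proj₁ s [ i ]≔ val e s , proj₂ s
execute (put r e a) s =
  proj₁ s , proj₂ s [ pos r ]≔ (lookup (proj₂ s) (pos r) [ val a s ↦ val e s ])

executes : List Instr → St → St
executes []       s = s
executes (i ∷ is) s = executes is (execute i s)

-- The registers whose values fix the position of the arrays in memory.
tbR ibR pbR obR : Fin #regs
tbR = # 0
ibR = # 10
pbR = # 11
obR = # 12

base : Arr → Expr → Expr
base input     e = e
base dist      e = reg 0 ⊞ e
base out       e = reg 12 ⊞ e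
base (prods f) e = reg 11 ⊞ (e ⊠ lit 4 ⊞ lit (toℕ f))
base (cell f)  e = reg 10 ⊞ (e ⊠ lit 11 ⊞ lit (toℕ f))

⌊_⌋ₜ : Term → Expr
⌊ con x ⌋ₜ   = lit x
⌊ var i ⌋ₜ   = reg (toℕ i)
⌊ get r e ⌋ₜ = load (base r ⌊ e ⌋ₜ)
⌊ e ⊕ f ⌋ₜ   = ⌊ e ⌋ₜ ⊞ ⌊ f ⌋ₜ
⌊ e ⊖ f ⌋ₜ   = ⌊ e ⌋ₜ ⊟ ⌊ f ⌋ₜ
⌊ e ⊗ f ⌋ₜ   = ⌊ e ⌋ₜ ⊠ ⌊ f ⌋ₜ

⌊_⌋ᵢ : Instr → Cmd
⌊ i := e ⌋ᵢ    = toℕ i ≔ ⌊ e ⌋ₜ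
⌊ put r e a ⌋ᵢ = store ⌊ e ⌋ₜ at base r ⌊ a ⌋ₜ

⌊_⌋ₗ : List Instr → Cmd
⌊ [] ⌋ₗ     = skip
⌊ i ∷ is ⌋ₗ = ⌊ i ⌋ᵢ ﹔ ⌊ is ⌋ₗ

⌊_⌋ : Prog → Cmd
⌊ blk is ⌋    = ⌊ is ⌋ₗ
⌊ c ⨾ d ⌋     = ⌊ c ⌋ ﹔ ⌊ d ⌋
⌊ ite e c d ⌋ = if ⌊ e ⌋ₜ then ⌊ c ⌋ else ⌊ d ⌋
⌊ loop e c ⌋  = while ⌊ e ⌋ₜ loop ⌊ c ⌋

costᵢ : Instr → ℕ
costᵢ (i := e)    = suc (cost ⌊ e ⌋ₜ)
costᵢ (put r e a) = suc (cost ⌊ e ⌋ₜ + cost (base r ⌊ a ⌋ₜ))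

costₗ : List Instr → ℕ
costₗ []       = 1
costₗ (i ∷ is) = suc (costᵢ i + costₗ is)

-- weight e is such that the value of e is below B ^ weight e whenever B bounds
-- the literals, the registers and the memory.
weight : Term → ℕ
weight (con x)   = 1
weight (var i)   = 1
weight (get r e) = 1
weight (e ⊕ f)   = weight e + weight f
weight (e ⊖ f)   = weight e + weight f
weight (e ⊗ f)   = weight e + weight f

small : Term → Bool
small (con x)   = x <ᵇ 16
small (var i)   = true
small (get r e) = small e
small (e ⊕ f)   = (weight e + weight f ≤ᵇ 8) ∧ (small e ∧ small f)
small (e ⊖ f)   = (weight e + weight f ≤ᵇ 8) ∧ (small e ∧ small f)
small (e ⊗ f)   = (weight e + weight f ≤ᵇ 8) ∧ (small e ∧ small f)

-- Excluded are the registers 0, 10, 11 and 12 with the base addresses: the translated array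
-- accesses are correct only while these stay constant.
assignable : Fin #regs → Bool
assignable zero = false
assignable (suc (suc (suc (suc (suc (suc (suc (suc (suc (suc i)))))))))) with toℕ i
... | 0 = false
... | 1 = false
... | 2 = false
... | _ = true
assignable _ = true

wfᵢ : Instr → Bool
wfᵢ (i := e)    = assignable i ∧ small e
wfᵢ (put r e a) = small e ∧ small a

wfₗ : List Instr → Bool
wfₗ []       = true
wfₗ (i ∷ is) = wfᵢ i ∧ wfₗ is

wf : Prog → Bool
wf (blk is)    = wfₗ is
wf (c ⨾ d)     = wf c ∧ wf d
wf (ite e c d) = small e ∧ (wf c ∧ wf d)
wf (loop e c)  = small e ∧ wf c

T∧ : ∀ {a b} → T (a ∧ b) → T a × T b
T∧ = Equivalence.to T-∧

module Semantics (len : Arr → ℕ) (B : ℕ) where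

  -- The conditions are collected in continuation-passing style, so that those
  -- of a concrete program unfold to a plain conjunction.
  Legal : Term → St → Set → Set
  Legal (con x)   s K = K
  Legal (var i)   s K = K
  Legal (get r e) s K = Legal e s ((val e s < len r) × K)
  Legal (e ⊕ f)   s K = Legal e s (Legal f s K)
  Legal (e ⊖ f)   s K = Legal e s (Legal f s K)
  Legal (e ⊗ f)   s K = Legal e s (Legal f s K)

  -- A stored value has to be below `B` again, and not just below a power of `B`, lest the bounds
  -- grow with every instruction. Small constants, registers and array elements are below `B`
  -- anyway.
  Storable : Term → St → Set → Set
  Storable (con x)   s K = K
  Storable (var i)   s K = K
  Storable (get r e) s K = K
  Storable e@(_ ⊕ _) s K = (val e s < B) × K
  Storable e@(_ ⊖ _) s K = (val e s < B) × K
  Storable e@(_ ⊗ _) s K = (val e s < B) × K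

  Safe : List Instr → St → Set
  Safe []                s = ⊤
  Safe (i := e ∷ is)     s = Legal e s (Storable e s (Safe is (execute (i := e) s)))
  Safe (put r e a ∷ is)  s =
    Legal e s (Storable e s (Legal a s ((val a s < len r) × Safe is (execute (put r e a) s))))

  infixr 5 _then_
  data Exec : Prog → St → ℕ → St → Set where
    block     : ∀ {is s} → Safe is s → Exec (blk is) s (costₗ is) (executes is s)
    _then_    : ∀ {c d s s′ s″ t t′} → Exec c s t s′ → Exec d s′ t′ s″ →
                Exec (c ⨾ d) s (suc (t + t′)) s″
    ite-true  : ∀ {e c d s s′ t} → Legal e s ⊤ → val e s ≢ 0 → Exec c s t s′ →
                Exec (ite e c d) s (suc (cost ⌊ e ⌋ₜ + t)) s′
    ite-false : ∀ {e c d s s′ t} → Legal e s ⊤ → val e s ≡ 0 → Exec d s t s′ →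
                Exec (ite e c d) s (suc (cost ⌊ e ⌋ₜ + t)) s′
    stop      : ∀ {e c s} → Legal e s ⊤ → val e s ≡ 0 →
                Exec (loop e c) s (suc (cost ⌊ e ⌋ₜ)) s
    again     : ∀ {e c s s′ s″ t t′} → Legal e s ⊤ → val e s ≢ 0 →
                Exec c s t s′ → Exec (loop e c) s′ t′ s″ →
                Exec (loop e c) s (suc (cost ⌊ e ⌋ₜ + t) + t′) s″

-- Placement of the arrays in memory and simulation of array programs

module Layout (tb ib pb ob : ℕ) (lenI lenP DL L : ℕ) where

  len : Arr → ℕ
  len input     = lenI
  len dist      = DL
  len out       = DL
  len (prods _) = lenP
  len (cell _)  = L

  address : Arr → ℕ → ℕ
  address input     i = i
  address dist      i = tb + i
  address out       i = ob + i
  address (prods f) i = pb + (i * 4 + toℕ f)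
  address (cell f)  i = ib + (i * 11 + toℕ f)

  -- The rank of an array in the order of addresses, with interleaved arrays sharing a rank.
  -- Disjointness is then settled by comparing ranks instead of all pairs of arrays.
  zone : Arr → ℕ
  zone input     = 0
  zone (prods _) = 1
  zone dist      = 2
  zone out       = 3
  zone (cell _)  = 4

  end : ℕ → ℕ
  end 0 = pb
  end 1 = tb
  end 2 = ob
  end 3 = ib
  end _ = ib + L * 11

  module Disjoint (input≤ : lenI ≤ pb) (prods≤ : pb + lenP * 4 ≤ tb)
                  (dist≤ : tb + DL ≤ ob) (out≤ : ob + DL ≤ ib) where

    address<end : ∀ r i → i < len r → address r i < end (zone r)
    address<end input     i i< = <-≤-trans i< input≤
    address<end dist      i i< = <-≤-trans (+-monoʳ-< tb i<) dist≤
    address<end out       i i< = <-≤-trans (+-monoʳ-< ob i<) out≤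
    address<end (prods f) i i< = <-≤-trans (+-monoʳ-< pb (pair-bound i< (toℕ<n f))) prods≤
    address<end (cell f)  i i< = +-monoʳ-< ib (pair-bound i< (toℕ<n f))

    end-mono : ∀ z → end z ≤ end (suc z)
    end-mono 0 = ≤-trans (m≤m+n pb _) prods≤
    end-mono 1 = ≤-trans (m≤m+n tb _) dist≤
    end-mono 2 = ≤-trans (m≤m+n ob _) out≤
    end-mono 3 = m≤m+n ib _
    end-mono (suc (suc (suc (suc z)))) = ≤-refl

    end-mono′ : ∀ k z → end z ≤ end (k + z)
    end-mono′ zero    z = ≤-refl
    end-mono′ (suc k) z = ≤-trans (end-mono′ k z) (end-mono (k + z))

    end-monotone : ∀ {z z′} → z ≤ z′ → end z ≤ end z′
    end-monotone {z} {z′} z≤ = subst (λ w → end z ≤ end w) (m∸n+n≡m z≤) (end-mono′ (z′ ∸ z) z)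

    end≤address : ∀ r i {z} → zone r ≡ suc z → end z ≤ address r i
    end≤address dist i refl      = m≤m+n tb i
    end≤address out i refl       = m≤m+n ob i
    end≤address (prods f) i refl = m≤m+n pb _
    end≤address (cell f) i refl  = m≤m+n ib _

    address<top : ∀ r i → i < len r → address r i < end 4
    address<top r i i< = <-≤-trans (address<end r i i<) (end-monotone (zone≤4 r))
      where
      zone≤4 : ∀ r → zone r ≤ 4
      zone≤4 input     = z≤n
      zone≤4 (prods _) = s≤s z≤n
      zone≤4 dist      = s≤s (s≤s z≤n)
      zone≤4 out       = s≤s (s≤s (s≤s z≤n))
      zone≤4 (cell _)  = ≤-refl

    separated : ∀ {r r′ i i′} → zone r < zone r′ → i < len r → address r i ≢ address r′ i′
    separated {r} {r′} {i} {i′} z< i< eq with zone r′ in ez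
    ... | suc z = <⇒≢ (<-≤-trans (address<end r i i<)
                        (≤-trans (end-monotone (s≤s⁻¹ z<)) (end≤address r′ i′ ez))) eq

    address-injective : ∀ r r′ i i′ → i < len r → i′ < len r′ →
                        address r i ≡ address r′ i′ → r ≡ r′ × i ≡ i′
    address-injective r r′ i i′ i< i′< eq with <-cmp (zone r) (zone r′)
    ... | tri< z< _ _ = contradiction eq (separated {r} {r′} z< i<)
    ... | tri> _ _ z> = contradiction (sym eq) (separated {r′} {r} z> i′<)
    ... | tri≈ _ z≡ _ = same r r′ z≡ eq
      where
      same : ∀ r r′ → zone r ≡ zone r′ → address r i ≡ address r′ i′ → r ≡ r′ × i ≡ i′
      same input input _ eq = refl , eq
      same dist dist _ eq = refl , +-cancelˡ-≡ tb _ _ eq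
      same out out _ eq = refl , +-cancelˡ-≡ ob _ _ eq
      same (prods f) (prods f′) _ eq =
        let i≡ , f≡ = pair-injective i i′ (toℕ<n f) (toℕ<n f′) (+-cancelˡ-≡ pb _ _ eq)
        in cong prods (toℕ-injective f≡) , i≡
      same (cell f) (cell f′) _ eq =
        let i≡ , f≡ = pair-injective i i′ (toℕ<n f) (toℕ<n f′) (+-cancelˡ-≡ ib _ _ eq)
        in cong cell (toℕ-injective f≡) , i≡

    module Simulation (M W B : ℕ) (top≤M : end 4 ≤ M) (top≤B : end 4 ≤ B)
                      (16≤B : 16 ≤ B) (B⁸≤W : B ^ 8 ≤ W) where

      open Semantics len B
      open Machine M W using (Ok; Ok′)

      -- The contents of an array are a total function, which has to agree with the memory only
      -- below the length of the array.
      record Rep (σ : State) (s : St) : Set where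
        field
          regs≡  : ∀ i → regs σ (toℕ i) ≡ lookup (proj₁ s) i
          regs<  : ∀ i → lookup (proj₁ s) i < B
          mem≡   : ∀ r i → i < len r → mem σ (address r i) ≡ lookup (proj₂ s) (pos r) i
          mem<   : ∀ r i → i < len r → lookup (proj₂ s) (pos r) i < B
          tb≡    : lookup (proj₁ s) tbR ≡ tb
          ib≡    : lookup (proj₁ s) ibR ≡ ib
          pb≡    : lookup (proj₁ s) pbR ≡ pb
          ob≡    : lookup (proj₁ s) obR ≡ ob
      open Rep

      2≤B : 2 ≤ B
      2≤B = ≤-trans (s≤s (s≤s z≤n)) 16≤B

      instance
        B-nonZero : NonZero B
        B-nonZero = >-nonZero (≤-trans (s≤s z≤n) 2≤B)

      B^≤W : ∀ {k} → k ≤ 8 → B ^ k ≤ W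
      B^≤W k≤8 = ≤-trans (^-monoʳ-≤ B k≤8) B⁸≤W

      B≤W : B ≤ W
      B≤W = subst (_≤ W) (^-identityʳ B) (B^≤W {1} (s≤s z≤n))

      2≤B^ : ∀ {k} → 1 ≤ k → 2 ≤ B ^ k
      2≤B^ {k} 1≤k = ≤-trans 2≤B (subst (_≤ B ^ k) (^-identityʳ B) (^-monoʳ-≤ B 1≤k))

      1≤weight : ∀ e → 1 ≤ weight e
      1≤weight (con x)   = ≤-refl
      1≤weight (var i)   = ≤-refl
      1≤weight (get r e) = ≤-refl
      1≤weight (e ⊕ f)   = ≤-trans (1≤weight e) (m≤m+n _ _)
      1≤weight (e ⊖ f)   = ≤-trans (1≤weight e) (m≤m+n _ _)
      1≤weight (e ⊗ f)   = ≤-trans (1≤weight e) (m≤m+n _ _)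

      -- A product of two bounds that are at least 2 dominates their sum, so that adding weights is
      -- right for sums as well as for products.
      +<* : ∀ {x y X Y} → 2 ≤ X → 2 ≤ Y → x < X → y < Y → x + y < X * Y
      +<* {x} {y} {X} {Y} 2≤X 2≤Y x< y< = <-≤-trans (+-mono-<-≤ x< (<⇒≤ y<)) (X+Y≤X*Y 2≤X 2≤Y)
        where
        X+Y≤X*Y : ∀ {X Y} → 2 ≤ X → 2 ≤ Y → X + Y ≤ X * Y
        X+Y≤X*Y {suc (suc a)} {suc (suc b)} (s≤s (s≤s _)) (s≤s (s≤s _)) =
          ≤-trans (+-monoˡ-≤ (2 + b) (≤-trans (+-monoʳ-≤ 2 (m≤m*n a 2)) (*-monoʳ-≤ (suc a) (m≤m+n 2 b))))
                  (≤-reflexive (+-comm (suc a * (2 + b)) (2 + b)))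

      combine< : ∀ e f {x} → x < B ^ weight e * B ^ weight f → x < B ^ (weight e + weight f)
      combine< e f = subst (_ <_) (sym (^-distribˡ-+-* B (weight e) (weight f)))

      *<* : ∀ {x y X Y} → x < X → y < Y → x * y < X * Y
      *<* {x} {y} {X} {Y} x< y< = ≤-<-trans (*-monoʳ-≤ x (<⇒≤ y<)) (*-monoˡ-< Y ⦃ >-nonZero (≤-<-trans z≤n y<) ⦄ x<)

      ∸<* : ∀ {x y X Y} → 2 ≤ Y → x < X → x ∸ y < X * Y
      ∸<* {x} {y} {X} {Y} 2≤Y x< =
        ≤-<-trans (m∸n≤m x y) (<-≤-trans x< (m≤m*n X Y ⦃ >-nonZero (≤-trans (s≤s z≤n) 2≤Y) ⦄))

      -- The compound intermediate results of the address computation are at most the address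
      -- itself, which lies below the end of the memory in use; hence address arithmetic contributes
      -- nothing to weights.
      base-correct : ∀ {σ s} → Rep σ s → ∀ r e {i} → Ok e σ → eval e σ ≡ i → i < len r →
                     Ok (base r e) σ × eval (base r e) σ ≡ address r i
      base-correct {σ} {s} R r e ok refl i< = go r i<
        where
        top : ∀ r → eval e σ < len r → ∀ {x} → x ≤ address r (eval e σ) → x < W
        top r i< x≤ = <-≤-trans (≤-<-trans x≤ (address<top r _ i<)) (≤-trans top≤B B≤W)
        small< : ∀ {x y} → x < y → y ≤ 16 → x < W
        small< x< y≤ = <-≤-trans x< (≤-trans y≤ (≤-trans 16≤B B≤W))
        reg< : ∀ i → regs σ (toℕ i) < W
        reg< i = <-≤-trans (subst (_< B) (sym (regs≡ R i)) (regs< R i)) B≤W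
        go : ∀ r → eval e σ < len r → Ok (base r e) σ × eval (base r e) σ ≡ address r (eval e σ)
        go input i< = ok , refl
        go dist i< = (((tt , reg< tbR) , ok) , subst (_< W) (sym eq) (top dist i< ≤-refl)) , eq
          where eq = cong (_+ eval e σ) (trans (regs≡ R tbR) (tb≡ R))
        go out i< = (((tt , reg< obR) , ok) , subst (_< W) (sym eq) (top out i< ≤-refl)) , eq
          where eq = cong (_+ eval e σ) (trans (regs≡ R obR) (ob≡ R))
        go (prods f) i< =
          (((tt , reg< pbR) ,
            ((((ok , (tt , small< {4} ≤-refl (m≤m+n 5 11))) ,
               top (prods f) i< (≤-trans (m≤m+n (eval e σ * 4) (toℕ f)) (m≤n+m _ pb))) ,
              (tt , small< (toℕ<n f) (m≤m+n 4 12))) ,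
             top (prods f) i< (m≤n+m _ pb))) ,
           subst (_< W) (sym eq) (top (prods f) i< ≤-refl)) , eq
          where eq = cong (_+ (eval e σ * 4 + toℕ f)) (trans (regs≡ R pbR) (pb≡ R))
        go (cell f) i< =
          (((tt , reg< ibR) ,
            ((((ok , (tt , small< {11} ≤-refl (m≤m+n 12 4))) ,
               top (cell f) i< (≤-trans (m≤m+n (eval e σ * 11) (toℕ f)) (m≤n+m _ ib))) ,
              (tt , small< (toℕ<n f) (m≤m+n 11 5))) ,
             top (cell f) i< (m≤n+m _ ib))) ,
           subst (_< W) (sym eq) (top (cell f) i< ≤-refl)) , eq
          where eq = cong (_+ (eval e σ * 11 + toℕ f)) (trans (regs≡ R ibR) (ib≡ R))

      record Good (e : Term) (σ : State) (s : St) : Set where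
        constructor good
        field
          ok   : Ok ⌊ e ⌋ₜ σ
          same : eval ⌊ e ⌋ₜ σ ≡ val e s
          low  : val e s < B ^ weight e
      open Good

      binary : ∀ e f {x y} → T ((weight e + weight f ≤ᵇ 8) ∧ (small e ∧ small f)) →
               y ≡ x → x < B ^ weight e * B ^ weight f →
               y < W × x < B ^ (weight e + weight f)
      binary e f {x} sm refl x< =
        <-≤-trans x<′ (B^≤W {weight e + weight f} (≤ᵇ⇒≤ _ _ (proj₁ (T∧ {weight e + weight f ≤ᵇ 8} sm)))) , x<′
        where x<′ = combine< e f {x} x<

      -- `K` stands for the conditions that follow those of `e`; they are handed back for the next
      -- expression or instruction.
      term : ∀ {σ s} → Rep σ s → ∀ e {K : Set} → T (small e) → Legal e s K → Good e σ s × K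
      term R (con x) sm k = good (tt , <-≤-trans x< B≤W) refl
                                 (subst (x <_) (sym (^-identityʳ B)) x<) , k
        where x< = <-≤-trans (<ᵇ⇒< x 16 sm) 16≤B
      term {σ} R (var i) sm k =
        good (tt , subst (_< W) (sym (regs≡ R i)) (<-≤-trans (regs< R i) B≤W)) (regs≡ R i)
             (subst (_ <_) (sym (^-identityʳ B)) (regs< R i)) , k
      term {σ} {s} R (get r e) sm l with term R e sm l
      ... | g , i< , k with base-correct R r ⌊ e ⌋ₜ (ok g) (same g) i<
      ... | bok , beq =
        good ((bok , subst (_< M) (sym beq) (<-≤-trans (address<top r _ i<) top≤M)) ,
              subst (_< W) (sym eq) (<-≤-trans (mem< R r _ i<) B≤W)) eq
             (subst (_ <_) (sym (^-identityʳ B)) (mem< R r _ i<)) , k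
        where eq : mem σ (eval (base r ⌊ e ⌋ₜ) σ) ≡ lookup (proj₂ s) (pos r) (val e s)
              eq = trans (cong (mem σ) beq) (mem≡ R r _ i<)
      term R (e ⊕ f) sm l with term R e (proj₁ (T∧ (proj₂ (T∧ {weight e + weight f ≤ᵇ 8} sm)))) l
      ... | g , l′ with term R f (proj₂ (T∧ {small e} (proj₂ (T∧ {weight e + weight f ≤ᵇ 8} sm)))) l′
      ... | h , k = let eq = cong₂ _+_ (same g) (same h)
                        a , b = binary e f sm eq (+<* (2≤B^ (1≤weight e)) (2≤B^ (1≤weight f)) (low g) (low h))
                    in good ((ok g , ok h) , a) eq b , k
      term R (e ⊖ f) sm l with term R e (proj₁ (T∧ (proj₂ (T∧ {weight e + weight f ≤ᵇ 8} sm)))) l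
      ... | g , l′ with term R f (proj₂ (T∧ {small e} (proj₂ (T∧ {weight e + weight f ≤ᵇ 8} sm)))) l′
      ... | h , k = let eq = cong₂ _∸_ (same g) (same h)
                        a , b = binary e f sm eq (∸<* {y = val f _} (2≤B^ (1≤weight f)) (low g))
                    in good ((ok g , ok h) , a) eq b , k
      term R (e ⊗ f) sm l with term R e (proj₁ (T∧ (proj₂ (T∧ {weight e + weight f ≤ᵇ 8} sm)))) l
      ... | g , l′ with term R f (proj₂ (T∧ {small e} (proj₂ (T∧ {weight e + weight f ≤ᵇ 8} sm)))) l′
      ... | h , k = let eq = cong₂ _*_ (same g) (same h)
                        a , b = binary e f sm eq (*<* (low g) (low h))
                    in good ((ok g , ok h) , a) eq b , k

      storable : ∀ {σ s} → Rep σ s → ∀ e {K : Set} → Good e σ s → Storable e s K → val e s < B × K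
      storable R (con x)   g k = subst (_ <_) (^-identityʳ B) (low g) , k
      storable R (var i)   g k = subst (_ <_) (^-identityʳ B) (low g) , k
      storable R (get r e) g k = subst (_ <_) (^-identityʳ B) (low g) , k
      storable R (e ⊕ f)   g k = k
      storable R (e ⊖ f)   g k = k
      storable R (e ⊗ f)   g k = k

      fixed : ∀ {s : St} {x} (i j : Fin #regs) → j ≢ i →
              lookup (proj₁ s [ i ]≔ x) j ≡ lookup (proj₁ s) j
      fixed {s} {x} i j j≢i = lookup∘update′ j≢i (proj₁ s) x

      setReg-regs : ∀ {σ : State} {s : St} {x} → (∀ i → regs σ (toℕ i) ≡ lookup (proj₁ s) i) → ∀ i j →
                    regs (setReg (toℕ i) x σ) (toℕ j) ≡ lookup (proj₁ s [ i ]≔ x) j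
      setReg-regs {σ} {s} {x} R i j with j ≟F i
      ... | yes refl = trans (↦-same (regs σ) (toℕ i) x) (sym (lookup∘update i (proj₁ s) x))
      ... | no j≢i   = trans (↦-other (regs σ) x (j≢i ∘ toℕ-injective))
                             (trans (R j) (sym (lookup∘update′ j≢i (proj₁ s) x)))

      Rep-assign : ∀ {σ s x y} → Rep σ s → (i : Fin #regs) → T (assignable i) → y ≡ x → x < B →
                   Rep (setReg (toℕ i) y σ) (proj₁ s [ i ]≔ x , proj₂ s)
      Rep-assign {σ} {s} {x} R i a refl x< = record
        { regs≡ = setReg-regs {σ} {s} (regs≡ R) i
        ; regs< = regs<′
        ; mem≡  = mem≡ R
        ; mem<  = mem< R
        ; tb≡   = trans (fixed {s} i tbR (λ { refl → a })) (tb≡ R)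
        ; ib≡   = trans (fixed {s} i ibR (λ { refl → a })) (ib≡ R)
        ; pb≡   = trans (fixed {s} i pbR (λ { refl → a })) (pb≡ R)
        ; ob≡   = trans (fixed {s} i obR (λ { refl → a })) (ob≡ R)
        }
        where
        regs<′ : ∀ j → lookup (proj₁ s [ i ]≔ x) j < B
        regs<′ j with j ≟F i
        ... | yes refl = subst (_< B) (sym (lookup∘update i (proj₁ s) x)) x<
        ... | no j≢i   = subst (_< B) (sym (lookup∘update′ j≢i (proj₁ s) x)) (regs< R j)

      -- All other array elements keep their values because distinct elements have distinct
      -- addresses.
      Rep-put : ∀ {σ s x y a a′} → Rep σ s → ∀ r → y ≡ x → x < B → a < len r → a′ ≡ address r a →
                Rep (setMem a′ y σ) (proj₁ s , proj₂ s [ pos r ]≔ (lookup (proj₂ s) (pos r) [ a ↦ x ]))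
      Rep-put {σ} {s} {x} {a = a} R r refl x< a< refl = record
        { regs≡ = regs≡ R
        ; regs< = regs< R
        ; mem≡  = λ r′ i i< → proj₁ (both r′ i i<)
        ; mem<  = λ r′ i i< → proj₂ (both r′ i i<)
        ; tb≡   = tb≡ R
        ; ib≡   = ib≡ R
        ; pb≡   = pb≡ R
        ; ob≡   = ob≡ R
        }
        where
        old : ℕ → ℕ
        old = lookup (proj₂ s) (pos r)
        new : ∀ r′ → ℕ → ℕ
        new r′ = lookup (proj₂ s [ pos r ]≔ (old [ a ↦ x ])) (pos r′)
        both : ∀ r′ i → i < len r′ →
               (mem σ [ address r a ↦ x ]) (address r′ i) ≡ new r′ i × new r′ i < B
        both r′ i i< with pos r′ ≟F pos r
        ... | no p≢ =
          trans (↦-other (mem σ) x (λ eq → p≢ (cong pos (proj₁ (address-injective r′ r i a i< a< eq)))))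
                (trans (mem≡ R r′ i i<) (sym eq)) ,
          subst (_< B) (sym eq) (mem< R r′ i i<)
          where eq = cong (λ f → f i) (lookup∘update′ p≢ (proj₂ s) (old [ a ↦ x ]))
        ... | yes p≡ with pos-injective r′ r p≡
        ... | refl with i ≟ a
        ... | yes refl = trans (↦-same (mem σ) (address r a) x) (sym eq) , subst (_< B) (sym eq) x<
          where eq = trans (cong (λ f → f a) (lookup∘update (pos r) (proj₂ s) (old [ a ↦ x ])))
                           (↦-same old a x)
        ... | no i≢a = trans (↦-other (mem σ) x (λ eq → i≢a (proj₂ (address-injective r r i a i< a< eq))))
                             (trans (mem≡ R r i i<) (sym eq)) ,
                       subst (_< B) (sym eq) (mem< R r i i<)
          where eq = trans (cong (λ f → f i) (lookup∘update (pos r) (proj₂ s) (old [ a ↦ x ])))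
                           (↦-other old x i≢a)

      simulateₗ : ∀ {σ s} → Rep σ s → ∀ is → T (wfₗ is) → Safe is s →
                  ∃[ σ′ ] Runs M W ⌊ is ⌋ₗ σ σ′ (costₗ is) × Rep σ′ (executes is s)
      simulateₗ R [] w safe = _ , Machine.skip , R
      simulateₗ {σ} {s} R (i := e ∷ is) w safe
        with term R e (proj₂ (T∧ {assignable i} (proj₁ (T∧ w)))) safe
      ... | g , safe′ with storable R e g safe′
      ... | v< , safe″
        with simulateₗ (Rep-assign R i (proj₁ (T∧ (proj₁ (T∧ w)))) (same g) v<)
                       is (proj₂ (T∧ {assignable i ∧ small e} w)) safe″
      ... | σ′ , run , R′ = σ′ , Machine.seq (Machine.assign (ok g)) run , R′
      simulateₗ {σ} {s} R (put r e a ∷ is) w safe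
        with term R e (proj₁ (T∧ (proj₁ (T∧ w)))) safe
      ... | g , safe₁ with storable R e g safe₁
      ... | v< , safe₂ with term R a (proj₂ (T∧ {small e} (proj₁ (T∧ w)))) safe₂
      ... | h , a< , safe₃ with base-correct R r ⌊ a ⌋ₜ (ok h) (same h) a<
      ... | bok , beq
        with simulateₗ (Rep-put R r (same g) v< a< beq) is (proj₂ (T∧ {small e ∧ small a} w)) safe₃
      ... | σ′ , run , R′ =
        σ′ , Machine.seq (Machine.store (ok g) bok
               (subst (_< M) (sym beq) (<-≤-trans (address<top r _ a<) top≤M))) run , R′

      simulate : ∀ {σ s c t s′} → Rep σ s → T (wf c) → Exec c s t s′ →
                 ∃[ σ′ ] Runs M W ⌊ c ⌋ σ σ′ t × Rep σ′ s′
      simulate R w (block {is} safe) = simulateₗ R is w safe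
      simulate R w (_then_ {c} x y) with simulate R (proj₁ (T∧ w)) x
      ... | _ , r , R′ with simulate R′ (proj₂ (T∧ {wf c} w)) y
      ... | _ , r′ , R″ = _ , Machine.seq r r′ , R″
      simulate R w (ite-true {e} {c} {d} l v≢0 x) with term R e (proj₁ (T∧ {small e} w)) l
      ... | g , _ with simulate R (proj₁ (T∧ {wf c} (proj₂ (T∧ {small e} w)))) x
      ... | _ , r , R′ = _ , Machine.if-true (ok g) (v≢0 ∘ trans (sym (same g))) r , R′
      simulate R w (ite-false {e} {c} {d} l v≡0 x) with term R e (proj₁ (T∧ {small e} w)) l
      ... | g , _ with simulate R (proj₂ (T∧ {wf c} (proj₂ (T∧ {small e} w)))) x
      ... | _ , r , R′ = _ , Machine.if-false (ok g) (trans (same g) v≡0) r , R′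
      simulate R w (stop {e} l v≡0) with term R e (proj₁ (T∧ {small e} w)) l
      ... | g , _ = _ , Machine.while-stop (ok g) (trans (same g) v≡0) , R
      simulate R w (again {e} {c} l v≢0 x y) with term R e (proj₁ (T∧ {small e} w)) l
      ... | g , _ with simulate R (proj₂ (T∧ {small e} w)) x
      ... | _ , r , R′ with simulate R′ w y
      ... | _ , r′ , R″ = _ , Machine.while-step (ok g) (v≢0 ∘ trans (sym (same g))) r r′ , R″

-- Walks and the invariants of breadth-first search

-- A choice between x (δ = 0) and y (δ = 1) that needs no branching.
sel : ℕ → ℕ → ℕ → ℕ
sel δ x y = (1 ∸ δ) * x + δ * y

sel₀ : ∀ x y → sel 0 x y ≡ x
sel₀ x y = trans (+-identityʳ (x + 0)) (+-identityʳ x)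

sel₁ : ∀ x y → sel 1 x y ≡ y
sel₁ x y = +-identityʳ y

sel-bound : ∀ {P : ℕ → Set} δ {x y} → δ ≤ 1 → P x → P y → P (sel δ x y)
sel-bound {P} 0 {x} {y} _ px py = subst P (sym (sel₀ x y)) px
sel-bound {P} 1 {x} {y} _ px py = subst P (sym (sel₁ x y)) py
sel-bound (suc (suc _)) (s≤s ()) px py

injective-bound : ∀ {k N} (f : ℕ → ℕ) → (∀ i → i < k → f i < N) →
                  (∀ i j → i < k → j < k → f i ≡ f j → i ≡ j) → k ≤ N
injective-bound {k} {N} f f< inj = injective⇒≤ {f = g} g-injective
  where
  g : Fin k → Fin N
  g i = fromℕ< (f< (toℕ i) (toℕ<n i))
  g-injective : ∀ {i j} → g i ≡ g j → i ≡ j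
  g-injective {i} {j} eq = toℕ-injective (inj _ _ (toℕ<n i) (toℕ<n j)
    (trans (sym (toℕ-fromℕ< (f< _ (toℕ<n i)))) (trans (cong toℕ eq) (toℕ-fromℕ< (f< _ (toℕ<n j))))))

-- The input as seen by the program: n vertices, m edges, p productions, and ν
-- for an additional nonterminal generating the empty word only, which turns
-- A → a into A → a ν.
record Input : Set where
  field
    n m p ν              : ℕ
    inp ty lhs ltr rhs   : ℕ → ℕ

module Instance (X : Input) where

  open Input X

  endp : ℕ → ℕ → ℕ
  endp δ j = inp (6 + j * 3 + δ)

  -- Only A → a has kind 0, and its right-hand field is 0, so its key becomes `ν`; for A → a B and A
  -- → B a the key is B. `dir` is 0 if the letter stands first and 1 for A → B a.
  key dir : ℕ → ℕ
  key i = (1 ∸ ty i) * ν + rhs i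
  dir i = ty i ∸ 1

  -- The list holds the vertices and not the edges of the path, so its length exceeds the length of
  -- the path by one.
  data Walk : ℕ → ℕ → ℕ → List ℕ → Set where
    nil   : ∀ {v} → v < n → Walk ν v v [ v ]
    eps   : ∀ {i v} → i < p → ty i ≡ 3 → v < n → Walk (lhs i) v v [ v ]
    left  : ∀ {i j v xs} → i < p → ty i ≤ 1 → j < m → endp 2 j ≡ ltr i →
            Walk (key i) (endp 1 j) v xs → Walk (lhs i) (endp 0 j) v (endp 0 j ∷ xs)
    right : ∀ {i j u xs} → i < p → ty i ≡ 2 → j < m → endp 2 j ≡ ltr i →
            Walk (key i) u (endp 0 j) xs → Walk (lhs i) u (endp 1 j) (xs ++ [ endp 1 j ])

  τ : ℕ → ℕ → ℕ → ℕ
  τ A u v = (A * n + u) * n + v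

  DL : ℕ
  DL = suc ν * n * n

  τ< : ∀ {A u v} → A ≤ ν → u < n → v < n → τ A u v < DL
  τ< A≤ u< v< = pair-bound (pair-bound (s≤s A≤) u<) v<

  τ-injective : ∀ {A u v A′ u′ v′} → u < n → v < n → u′ < n → v′ < n →
                τ A u v ≡ τ A′ u′ v′ → A ≡ A′ × u ≡ u′ × v ≡ v′
  τ-injective {A} {u} {v} {A′} {u′} u< v< u′< v′< eq
    with pair-injective (A * n + u) (A′ * n + u′) v< v′< eq
  ... | eq′ , refl with pair-injective A A′ u< u′< eq′
  ... | refl , refl = refl , refl , refl

  -- A table of distances D and, for every entry, a kind K (0 for a path
  -- without edges, 1 if its first and 2 if its last edge is split off), the
  -- entry P of the remaining path and the vertex Wt split off; the triples
  -- with a finite distance are queued in the order of their discovery.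
  record Tables : Set where
    constructor tables
    field
      D K P Wt qA qU qV : ℕ → ℕ
      tail              : ℕ

    t : ℕ → ℕ
    t i = τ (qA i) (qU i) (qV i)

  open Tables

  -- What a query reads off the tables from entry `k`. An entry of `D` represents a distance by its
  -- successor, which is the number of vertices on the path and thus the length of the list.
  data Chain (g : Tables) : ℕ → List ℕ → Set where
    stop  : ∀ {k} → k < DL → D g k ≡ 1 → K g k ≡ 0 → Chain g k [ Wt g k ]
    left  : ∀ {k xs} → k < DL → D g k ≡ suc (length xs) → K g k ≡ 1 →
            Chain g (P g k) xs → Chain g k (Wt g k ∷ xs)
    right : ∀ {k xs} → k < DL → D g k ≡ suc (length xs) → K g k ≡ 2 →
            Chain g (P g k) xs → Chain g k (xs ++ [ Wt g k ])

  length-∷ʳ : ∀ (xs : List ℕ) x → length (xs ++ [ x ]) ≡ suc (length xs)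
  length-∷ʳ xs x = trans (length-++ xs) (+-comm (length xs) 1)

  Chain-D : ∀ {g k xs} → Chain g k xs → D g k ≡ length xs
  Chain-D (stop _ d _) = d
  Chain-D (left _ d _ _) = d
  Chain-D {g} {k} (right {xs = xs} _ d _ _) = trans d (sym (length-∷ʳ xs (Wt g k)))

  Chain-pos : ∀ {g k xs} → Chain g k xs → D g k ≢ 0
  Chain-pos (stop _ d _) e with trans (sym d) e
  ... | ()
  Chain-pos (left _ d _ _) e with trans (sym d) e
  ... | ()
  Chain-pos (right _ d _ _) e with trans (sym d) e
  ... | ()

  Chain-< : ∀ {g k xs} → Chain g k xs → k < DL
  Chain-< (stop l _ _) = l
  Chain-< (left l _ _ _) = l
  Chain-< (right l _ _ _) = l

  infix 4 _⊑_
  record _⊑_ (g g′ : Tables) : Set where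
    field
      tail≤ : tail g ≤ tail g′
      D≡    : ∀ k → D g k ≢ 0 → D g′ k ≡ D g k
      qA≡   : ∀ i → i < tail g → qA g′ i ≡ qA g i
      qU≡   : ∀ i → i < tail g → qU g′ i ≡ qU g i
      qV≡   : ∀ i → i < tail g → qV g′ i ≡ qV g i

    t≡ : ∀ i → i < tail g → t g′ i ≡ t g i
    t≡ i i< rewrite qA≡ i i< | qU≡ i i< | qV≡ i i< = refl
  open _⊑_

  ⊑-refl : ∀ {g} → g ⊑ g
  ⊑-refl = record { tail≤ = ≤-refl ; D≡ = λ _ _ → refl
                  ; qA≡ = λ _ _ → refl ; qU≡ = λ _ _ → refl ; qV≡ = λ _ _ → refl }

  ⊑-trans : ∀ {g g′ g″} → g ⊑ g′ → g′ ⊑ g″ → g ⊑ g″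
  ⊑-trans x y = record
    { tail≤ = ≤-trans (tail≤ x) (tail≤ y)
    ; D≡    = λ k d → trans (D≡ y k (d ∘ trans (sym (D≡ x k d)))) (D≡ x k d)
    ; qA≡   = λ i i< → trans (qA≡ y i (<-≤-trans i< (tail≤ x))) (qA≡ x i i<)
    ; qU≡   = λ i i< → trans (qU≡ y i (<-≤-trans i< (tail≤ x))) (qU≡ x i i<)
    ; qV≡   = λ i i< → trans (qV≡ y i (<-≤-trans i< (tail≤ x))) (qV≡ x i i<)
    }

  Covered : Tables → ℕ → ℕ → ℕ → ℕ → Set
  Covered g A u v d = D g (τ A u v) ≢ 0 × D g (τ A u v) ≤ d

  Covered-⊑ : ∀ {g g′ A u v d} → g ⊑ g′ → Covered g A u v d → Covered g′ A u v d
  Covered-⊑ e (d≢0 , d≤) = d≢0 ∘ trans (sym (D≡ e _ d≢0)) , subst (_≤ _) (sym (D≡ e _ d≢0)) d≤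

  -- Breadth-first search whose first h queue elements have been processed.
  record Core (g : Tables) (h : ℕ) : Set where
    field
      bnd    : ∀ i → i < tail g → qA g i ≤ ν × qU g i < n × qV g i < n
      inj    : ∀ i j → i < tail g → j < tail g → t g i ≡ t g j → i ≡ j
      found  : ∀ k → D g k ≢ 0 → ∃[ i ] i < tail g × t g i ≡ k
      -- The remaining triple of an element stands earlier in the queue, hence `length xs ≤ suc i`.
      -- With the bound on the queue this keeps every entry at most `DL`, so that distances fit into
      -- words and paths into the output array.
      wit    : ∀ i → i < tail g → ∃[ xs ]
               Chain g (t g i) xs × Walk (qA g i) (qU g i) (qV g i) xs × length xs ≤ suc i
      sorted : ∀ i j → i ≤ j → j < tail g → D g (t g i) ≤ D g (t g j)
      -- The unprocessed elements have at most two distances, and these are consecutive. As `j` is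
      -- arbitrary, one more than the distance of the next element bounds the whole queue.
      near   : ∀ i j → i < tail g → j < tail g → h ≤ i → D g (t g j) ≤ suc (D g (t g i))

    t< : ∀ i → i < tail g → t g i < DL
    t< i i< = let a , b , c = bnd i i< in τ< a b c

    tail≤DL : tail g ≤ DL
    tail≤DL = injective-bound (t g) t< inj

    D-pos : ∀ i → i < tail g → D g (t g i) ≢ 0
    D-pos i i< = Chain-pos (proj₁ (proj₂ (wit i i<)))
  open Core

  Core-suc : ∀ {g h} → Core g h → Core g (suc h)
  Core-suc c = record
    { bnd = bnd c ; inj = inj c ; found = found c ; wit = wit c ; sorted = sorted c
    ; near = λ i j i< j< h≤ → near c i j i< j< (≤-trans (n≤1+n _) h≤) }

  data Link (g : Tables) : (κ par w : ℕ) → List ℕ → Set where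
    stop  : ∀ {par w} → Link g 0 par w [ w ]
    left  : ∀ {par w xs} → Chain g par xs → Link g 1 par w (w ∷ xs)
    right : ∀ {par w xs} → Chain g par xs → Link g 2 par w (xs ++ [ w ])

  -- `upper` and `lower` are what `sorted` and `near` require of a new last element. Seeds and
  -- extensions of the popped element establish them for different reasons.
  record Candidate (g : Tables) (h A u v d κ par w : ℕ) : Set where
    field
      A≤    : A ≤ ν
      u<    : u < n
      v<    : v < n
      xs    : List ℕ
      walk  : Walk A u v xs
      link  : Link g κ par w xs
      d≡    : d ≡ length xs
      d≤    : d ≤ suc (tail g)
      upper : ∀ j → j < tail g → D g (t g j) ≤ d
      lower : ∀ j → j < tail g → h ≤ j → d ≤ suc (D g (t g j))

  push : Tables → (A u v d κ par w : ℕ) → Tables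
  push g A u v d κ par w = tables
    (D g [ τ A u v ↦ d ]) (K g [ τ A u v ↦ κ ]) (P g [ τ A u v ↦ par ]) (Wt g [ τ A u v ↦ w ])
    (qA g [ tail g ↦ A ]) (qU g [ tail g ↦ u ]) (qV g [ tail g ↦ v ]) (suc (tail g))

  Link-pos : ∀ {g κ par w xs} → Link g κ par w xs → length xs ≢ 0
  Link-pos stop ()
  Link-pos (left _) ()
  Link-pos {w = w} (right {xs = xs} _) e with trans (sym (length-∷ʳ xs w)) e
  ... | ()

  module Push {g h A u v d κ par w} (c : Core g h) (cand : Candidate g h A u v d κ par w)
              (new : D g (τ A u v) ≡ 0) where
    open Candidate cand

    g′ : Tables
    g′ = push g A u v d κ par w

    k₀ : ℕ
    k₀ = τ A u v

    other : ∀ {k} → D g k ≢ 0 → k ≢ k₀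
    other d≢0 refl = d≢0 new

    extends : g ⊑ g′
    extends = record
      { tail≤ = n≤1+n _
      ; D≡    = λ k d≢0 → ↦-other (D g) d (other d≢0)
      ; qA≡   = λ i i< → ↦-other (qA g) A (<⇒≢ i<)
      ; qU≡   = λ i i< → ↦-other (qU g) u (<⇒≢ i<)
      ; qV≡   = λ i i< → ↦-other (qV g) v (<⇒≢ i<)
      }

    -- A chain visits only entries with nonzero `D`, whereas `D` was 0 at the new entry; so no
    -- update touches the chain.
    chain : ∀ {k xs} → Chain g k xs → Chain g′ k xs
    chain {k} ch@(stop l e f) =
      subst (Chain g′ k ∘ [_]) (↦-other (Wt g) w k≢)
        (stop l (trans (↦-other (D g) d k≢) e) (trans (↦-other (K g) κ k≢) f))
      where k≢ = other (Chain-pos ch)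
    chain {k} ch@(left {xs = xs} l e f r) =
      subst (λ x → Chain g′ k (x ∷ xs)) (↦-other (Wt g) w k≢)
        (left l (trans (↦-other (D g) d k≢) e) (trans (↦-other (K g) κ k≢) f)
          (subst (λ x → Chain g′ x xs) (sym (↦-other (P g) par k≢)) (chain r)))
      where k≢ = other (Chain-pos ch)
    chain {k} ch@(right {xs = xs} l e f r) =
      subst (λ x → Chain g′ k (xs ++ [ x ])) (↦-other (Wt g) w k≢)
        (right l (trans (↦-other (D g) d k≢) e) (trans (↦-other (K g) κ k≢) f)
          (subst (λ x → Chain g′ x xs) (sym (↦-other (P g) par k≢)) (chain r)))
      where k≢ = other (Chain-pos ch)

    chain₀ : Chain g′ k₀ xs
    chain₀ = go link (trans (↦-same (D g) k₀ d) d≡) (↦-same (K g) k₀ κ)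
      where
      go : ∀ {xs κ′} → Link g κ′ par w xs → D g′ k₀ ≡ length xs → K g′ k₀ ≡ κ′ → Chain g′ k₀ xs
      go stop e f = subst (Chain g′ k₀ ∘ [_]) (↦-same (Wt g) k₀ w) (stop (τ< A≤ u< v<) e f)
      go (left {xs = ys} r) e f = subst (λ x → Chain g′ k₀ (x ∷ ys)) (↦-same (Wt g) k₀ w)
        (left (τ< A≤ u< v<) e f (subst (λ x → Chain g′ x ys) (sym (↦-same (P g) k₀ par)) (chain r)))
      go (right {xs = ys} r) e f = subst (λ x → Chain g′ k₀ (ys ++ [ x ])) (↦-same (Wt g) k₀ w)
        (right (τ< A≤ u< v<) (trans e (length-∷ʳ ys w)) f
          (subst (λ x → Chain g′ x ys) (sym (↦-same (P g) k₀ par)) (chain r)))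

    qA₀ : qA g′ (tail g) ≡ A
    qA₀ = ↦-same (qA g) (tail g) A
    qU₀ : qU g′ (tail g) ≡ u
    qU₀ = ↦-same (qU g) (tail g) u
    qV₀ : qV g′ (tail g) ≡ v
    qV₀ = ↦-same (qV g) (tail g) v

    t₀ : t g′ (tail g) ≡ k₀
    t₀ rewrite qA₀ | qU₀ | qV₀ = refl

    D₀ : D g′ k₀ ≡ d
    D₀ = ↦-same (D g) k₀ d

    old-or-new : ∀ (R : ℕ → Set) → (∀ i → i < tail g → R i) → R (tail g) → ∀ i → i < tail g′ → R i
    old-or-new R old new i i< with m≤n⇒m<n∨m≡n (s≤s⁻¹ i<)
    ... | inj₁ i<′  = old i i<′
    ... | inj₂ refl = new

    D-old : ∀ i → i < tail g → D g′ (t g′ i) ≡ D g (t g i)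
    D-old i i< = trans (cong (D g′) (t≡ extends i i<)) (D≡ extends _ (D-pos c i i<))

    D-new : D g′ (t g′ (tail g)) ≡ d
    D-new = trans (cong (D g′) t₀) D₀

    t-old≢k₀ : ∀ i → i < tail g → t g′ i ≢ k₀
    t-old≢k₀ i i< e = D-pos c i i< (trans (cong (D g) (trans (sym (t≡ extends i i<)) e)) new)

    upper′ : ∀ j → j < tail g′ → D g′ (t g′ j) ≤ d
    upper′ = old-or-new _ (λ i i< → subst (_≤ d) (sym (D-old i i<)) (upper i i<)) (≤-reflexive D-new)

    core : Core g′ h
    core = record
      { bnd = old-or-new _
          (λ i i< → let a , b , e = bnd c i i< in
            subst (_≤ ν) (sym (qA≡ extends i i<)) a ,
            subst (_< n) (sym (qU≡ extends i i<)) b ,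
            subst (_< n) (sym (qV≡ extends i i<)) e)
          (subst (_≤ ν) (sym qA₀) A≤ , subst (_< n) (sym qU₀) u< , subst (_< n) (sym qV₀) v<)
      ; inj = λ i j i< j< → old-or-new (λ i → ∀ j → j < tail g′ → t g′ i ≡ t g′ j → i ≡ j)
          (λ i i< → old-or-new _
            (λ j j< e → inj c i j i< j< (trans (sym (t≡ extends i i<)) (trans e (t≡ extends j j<))))
            (λ e → contradiction (trans e t₀) (t-old≢k₀ i i<)))
          (old-or-new _
            (λ j j< e → contradiction (trans (sym e) t₀) (t-old≢k₀ j j<))
            (λ _ → refl))
          i i< j j<
      ; found = found′
      ; wit = old-or-new _
          (λ i i< → let ys , ch , wk , len = wit c i i< in
            ys , subst (λ k → Chain g′ k ys) (sym (t≡ extends i i<)) (chain ch) ,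
            walk-at (qA≡ extends i i<) (qU≡ extends i i<) (qV≡ extends i i<) wk , len)
          (xs , subst (λ k → Chain g′ k xs) (sym t₀) chain₀ , walk-at qA₀ qU₀ qV₀ walk ,
           subst (_≤ suc (tail g)) d≡ d≤)
      ; sorted = λ i j i≤j j< → old-or-new (λ j → ∀ i → i ≤ j → D g′ (t g′ i) ≤ D g′ (t g′ j))
          (λ j j< i i≤j → subst₂ _≤_ (sym (D-old i (≤-<-trans i≤j j<))) (sym (D-old j j<)) (sorted c i j i≤j j<))
          (λ i i≤ → subst (D g′ (t g′ i) ≤_) (sym D-new) (upper′ i (s≤s i≤)))
          j j< i i≤j
      ; near = λ i j i< j< → old-or-new (λ i → ∀ j → j < tail g′ → h ≤ i → D g′ (t g′ j) ≤ suc (D g′ (t g′ i)))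
          (λ i i< → old-or-new _
            (λ j j< h≤ → subst₂ _≤_ (sym (D-old j j<)) (sym (cong suc (D-old i i<))) (near c i j i< j< h≤))
            (λ h≤ → subst₂ _≤_ (sym D-new) (sym (cong suc (D-old i i<))) (lower i i< h≤)))
          (λ j j< _ → ≤-trans (upper′ j j<) (≤-trans (n≤1+n d) (s≤s (≤-reflexive (sym D-new)))))
          i i< j j<
      }
      where
      walk-at : ∀ {A u v A′ u′ v′ xs} → A′ ≡ A → u′ ≡ u → v′ ≡ v → Walk A u v xs → Walk A′ u′ v′ xs
      walk-at refl refl refl wk = wk
      found′ : ∀ k → D g′ k ≢ 0 → ∃[ i ] i < tail g′ × t g′ i ≡ k
      found′ k d≢0 with k ≟ k₀
      ... | yes refl = tail g , ≤-refl , t₀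
      ... | no k≢ with found c k d≢0
      ... | i , i< , e = i , m<n⇒m<1+n i< , trans (t≡ extends i i<) e

    covered : Covered g′ A u v d
    covered = subst (_≢ 0) (sym D₀) (Link-pos link ∘ trans (sym d≡)) , ≤-reflexive D₀

    -- The pigeonhole bound for the queue after the insertion is a strict one for the queue before
    -- it: there was room for the element.
    tail<DL : tail g < DL
    tail<DL = tail≤DL core

  -- By `found` the old entry belongs to a queue element, and `upper` compares the candidate with
  -- all of these.
  found-covered : ∀ {g h A u v d κ par w} → Core g h → Candidate g h A u v d κ par w →
                  D g (τ A u v) ≢ 0 → Covered g A u v d
  found-covered {g} {d = d} c cand d≢0 with found c _ d≢0
  ... | i , i< , e = d≢0 , subst (λ k → D g k ≤ d) e (Candidate.upper cand i i<)

  record Popped (g : Tables) (h b u v : ℕ) : Set where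
    field
      core : Core g h
      h<   : h < tail g
      b≡   : qA g h ≡ b
      u≡   : qU g h ≡ u
      v≡   : qV g h ≡ v

  Popped-⊑ : ∀ {g g′ h b u v} → g ⊑ g′ → Core g′ h → Popped g h b u v → Popped g′ h b u v
  Popped-⊑ e c r = record
    { core = c ; h< = <-≤-trans (Popped.h< r) (tail≤ e)
    ; b≡ = trans (qA≡ e _ (Popped.h< r)) (Popped.b≡ r)
    ; u≡ = trans (qU≡ e _ (Popped.h< r)) (Popped.u≡ r)
    ; v≡ = trans (qV≡ e _ (Popped.h< r)) (Popped.v≡ r)
    }

  -- `complete` is stated for `A < ν` because it must also hold of the empty table left by a skipped
  -- search, which misses the walks `nil` of the extra nonterminal.
  record IndexFacts (g : Tables) : Set where
    field
      sound    : ∀ {A u v} → u < n → v < n → D g (τ A u v) ≢ 0 →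
                 ∃[ xs ] Chain g (τ A u v) xs × Walk A u v xs × length xs ≤ DL
      complete : ∀ {A u v xs} → A < ν → Walk A u v xs → Covered g A u v (length xs)

  module Bounded (endp< : ∀ j → j < m → endp 0 j < n × endp 1 j < n)
                 (lhs≤ : ∀ i → i < p → lhs i ≤ ν)
                 (key≤ : ∀ i → i < p → ty i ≤ 2 → key i ≤ ν) where

    endp<′ : ∀ {j δ} → δ ≤ 1 → j < m → endp δ j < n
    endp<′ {j} {0} _ j< = proj₁ (endp< j j<)
    endp<′ {j} {1} _ j< = proj₂ (endp< j j<)
    endp<′ {j} {suc (suc _)} (s≤s ()) j<

    Walk-bounded : ∀ {A u v xs} → Walk A u v xs → A ≤ ν × u < n × v < n
    Walk-bounded (nil v<) = ≤-refl , v< , v<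
    Walk-bounded (eps i< _ v<) = lhs≤ _ i< , v< , v<
    Walk-bounded (left i< _ j< _ wk) =
      lhs≤ _ i< , endp<′ z≤n j< , proj₂ (proj₂ (Walk-bounded wk))
    Walk-bounded (right i< _ j< _ wk) =
      lhs≤ _ i< , proj₁ (proj₂ (Walk-bounded wk)) , endp<′ ≤-refl j<

    -- The endpoint `1 ∸ dir i` of the edge is glued to the start or the end of the walk, as `dir i`
    -- is 0 or 1, and the endpoint `dir i` becomes the new start or end.
    Matches : (b u v i j : ℕ) → Set
    Matches b u v i j = i < p × ty i ≤ 2 × key i ≡ b × j < m × endp 2 j ≡ ltr i ×
                        endp (1 ∸ dir i) j ≡ sel (dir i) u v

    childU childV : (u v i j : ℕ) → ℕ
    childU u v i j = sel (dir i) (endp (dir i) j) u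
    childV u v i j = sel (dir i) v (endp (dir i) j)

    -- Leads from the branch-free arithmetic that the program computes back to the constructors of
    -- `Walk` and `Link`.
    extend : ∀ {g par b u v xs i j} → Matches b u v i j → Chain g par xs → Walk b u v xs →
             ∃[ ys ] Walk (lhs i) (childU u v i j) (childV u v i j) ys × length ys ≡ suc (length xs) ×
                     Link g (suc (dir i)) par (endp (dir i) j) ys
    extend {g} {par} {b} {u} {v} {xs} {i} {j} (i< , ty≤ , refl , j< , lab , end) ch wk = go (ty i) refl ty≤
      where
      Result : ℕ → Set
      Result δ = ∃[ ys ] Walk (lhs i) (sel δ (endp δ j) u) (sel δ v (endp δ j)) ys ×
                 length ys ≡ suc (length xs) × Link g (suc δ) par (endp δ j) ys
      first : ty i ≤ 1 → endp 1 j ≡ sel 0 u v → Result 0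
      first le e rewrite sel₀ u v | sel₀ (endp 0 j) u | sel₀ v (endp 0 j) =
        endp 0 j ∷ xs , left i< le j< lab (subst (λ z → Walk (key i) z v xs) (sym e) wk) , refl , left ch
      last : ty i ≡ 2 → endp 0 j ≡ sel 1 u v → Result 1
      last eq e rewrite sel₁ u v | sel₁ (endp 1 j) u | sel₁ v (endp 1 j) =
        xs ++ [ endp 1 j ] , right i< eq j< lab (subst (λ z → Walk (key i) u z xs) (sym e) wk) ,
        length-∷ʳ xs _ , right ch
      go : ∀ x → ty i ≡ x → x ≤ 2 → Result (dir i)
      go 0 eq _ = subst Result (sym (cong (_∸ 1) eq))
        (first (≤-trans (≤-reflexive eq) z≤n) (subst (λ x → endp (1 ∸ x) j ≡ sel x u v) (cong (_∸ 1) eq) end))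
      go 1 eq _ = subst Result (sym (cong (_∸ 1) eq))
        (first (≤-reflexive eq) (subst (λ x → endp (1 ∸ x) j ≡ sel x u v) (cong (_∸ 1) eq) end))
      go 2 eq _ = subst Result (sym (cong (_∸ 1) eq))
        (last eq (subst (λ x → endp (1 ∸ x) j ≡ sel x u v) (cong (_∸ 1) eq) end))
      go (suc (suc (suc _))) eq (s≤s (s≤s ()))

    -- By `sorted` the popped element is nearest among those from `h` on, which gives `lower`;
    -- `near` at `h` itself gives `upper`.
    child : ∀ {g h b u v i j} → Popped g h b u v → Matches b u v i j →
            Candidate g h (lhs i) (childU u v i j) (childV u v i j) (suc (D g (τ b u v))) (suc (dir i))
              (τ b u v) (endp (dir i) j)
    child {g} {h} {i = i} {j} r@record { core = c ; h< = h< ; b≡ = refl ; u≡ = refl ; v≡ = refl } mt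
      with wit c h h<
    ... | xs , ch , wk , len with extend {i = i} {j} mt ch wk
    ... | ys , wk′ , len′ , lk with Walk-bounded wk′
    ... | A≤ , u< , v< = record
      { A≤ = A≤ ; u< = u< ; v< = v< ; xs = ys ; walk = wk′ ; link = lk
      ; d≡ = trans (cong suc (Chain-D ch)) (sym len′)
      ; d≤ = s≤s (≤-trans (≤-reflexive (Chain-D ch)) (≤-trans len h<))
      ; upper = λ j j< → near c h j h< j< ≤-refl
      ; lower = λ j j< h≤ → s≤s (sorted c h j h≤ j<)
      }

    Closed : Tables → ℕ → ℕ → ℕ → Set
    Closed g b u v = ∀ i j → Matches b u v i j →
      Covered g (lhs i) (childU u v i j) (childV u v i j) (suc (D g (τ b u v)))

    module Complete {g h} (c : Core g h) (done : ∀ i → i < tail g → Closed g (qA g i) (qU g i) (qV g i))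
                    (nils : ∀ v → v < n → Covered g ν v v 1)
                    (epss : ∀ i v → i < p → ty i ≡ 3 → v < n → Covered g (lhs i) v v 1) where

      closed : ∀ {b u v d} → b ≤ ν → u < n → v < n → Covered g b u v d → ∀ i j → Matches b u v i j →
               Covered g (lhs i) (childU u v i j) (childV u v i j) (suc d)
      closed {b} {u} {v} b≤ u< v< (d≢0 , d≤) i j mt with found c _ d≢0
      ... | k , k< , e with bnd c k k<
      ... | _ , u′< , v′< with τ-injective {qA g k} {qU g k} {qV g k} {b} {u} {v} u′< v′< u< v< e
      ... | refl , refl , refl with done k k< i j mt
      ... | a , b = a , ≤-trans b (s≤s d≤)

      complete : ∀ {A u v xs} → Walk A u v xs → Covered g A u v (length xs)
      complete (nil v<) = nils _ v<
      complete (eps i< eq v<) = epss _ _ i< eq v<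
      complete (left {i} {j} {v} {xs} i< ty≤ j< lab wk) with Walk-bounded wk
      ... | b≤ , u< , v< = go (ty i) refl ty≤
        where
        Goal : ℕ → Set
        Goal δ = endp (1 ∸ δ) j ≡ sel δ (endp 1 j) v →
                 Covered g (lhs i) (sel δ (endp δ j) (endp 1 j)) (sel δ v (endp δ j)) (suc (length xs))
        finish : Goal 0 → Covered g (lhs i) (endp 0 j) v (suc (length xs))
        finish f rewrite sel₀ (endp 1 j) v | sel₀ (endp 0 j) (endp 1 j) | sel₀ v (endp 0 j) = f refl
        goal : Goal (dir i)
        goal e = closed b≤ u< v< (complete wk) i j (i< , ≤-trans ty≤ (s≤s z≤n) , refl , j< , lab , e)
        go : ∀ x → ty i ≡ x → x ≤ 1 → Covered g (lhs i) (endp 0 j) v (suc (length xs))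
        go 0 eq _ = finish (subst Goal (cong (_∸ 1) eq) goal)
        go 1 eq _ = finish (subst Goal (cong (_∸ 1) eq) goal)
        go (suc (suc _)) eq (s≤s ())
      complete (right {i} {j} {u} {xs} i< ty≡ j< lab wk) with Walk-bounded wk
      ... | b≤ , u< , v< =
        subst (Covered g (lhs i) u (endp 1 j)) (sym (length-∷ʳ xs _)) (finish (subst Goal (cong (_∸ 1) ty≡) goal))
        where
        Goal : ℕ → Set
        Goal δ = endp (1 ∸ δ) j ≡ sel δ u (endp 0 j) →
                 Covered g (lhs i) (sel δ (endp δ j) u) (sel δ (endp 0 j) (endp δ j)) (suc (length xs))
        finish : Goal 1 → Covered g (lhs i) u (endp 1 j) (suc (length xs))
        finish f rewrite sel₁ u (endp 0 j) | sel₁ (endp 1 j) u | sel₁ (endp 0 j) (endp 1 j) = f refl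
        goal : Goal (dir i)
        goal e = closed b≤ u< v< (complete wk) i j (i< , ≤-reflexive ty≡ , refl , j< , lab , e)

-- Linked lists

-- The pointer to item j is suc j, and 0 ends the list.
data IsList (next : ℕ → ℕ) : ℕ → List ℕ → Set where
  []  : IsList next 0 []
  _∷_ : ∀ j {js} → IsList next (next j) js → IsList next (suc j) (j ∷ js)

addIf : ∀ {P : Set} → Dec P → ℕ → List ℕ → List ℕ
addIf (yes _) i is = i ∷ is
addIf (no _)  i is = is

bucket : (ℕ → ℕ) → ℕ → ℕ → List ℕ
bucket key zero    x = []
bucket key (suc i) x = addIf (key i ≟ x) i (bucket key i x)

bucket-sound : ∀ key i x {j} → j ∈ bucket key i x → j < i × key j ≡ x
bucket-sound key (suc i) x j∈ with key i ≟ x | j∈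
... | yes eq | here refl = ≤-refl , eq
... | yes eq | there j∈′ = let a , b = bucket-sound key i x j∈′ in m<n⇒m<1+n a , b
... | no _   | j∈′       = let a , b = bucket-sound key i x j∈′ in m<n⇒m<1+n a , b

bucket-complete : ∀ key i x {j} → j < i → key j ≡ x → j ∈ bucket key i x
bucket-complete key (suc i) x {j} j< eq with m≤n⇒m<n∨m≡n (s≤s⁻¹ j<) | key i ≟ x
... | inj₁ j<′  | yes _ = there (bucket-complete key i x j<′ eq)
... | inj₁ j<′  | no _  = bucket-complete key i x j<′ eq
... | inj₂ refl | yes _ = here refl
... | inj₂ refl | no ¬p = contradiction eq ¬p

IsList-cong : ∀ {f g p js} → (∀ j → j ∈ js → f j ≡ g j) → IsList f p js → IsList g p js
IsList-cong f≡g [] = []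
IsList-cong {f} {g} {js = _ ∷ js} f≡g (j ∷ l) =
  j ∷ subst (λ p → IsList g p js) (f≡g j (here refl)) (IsList-cong (λ k k∈ → f≡g k (there k∈)) l)

IsList-pointer : ∀ {next p js i} → IsList next p js → (∀ j → j ∈ js → j < i) → p ≤ i
IsList-pointer [] _ = z≤n
IsList-pointer (j ∷ _) js< = js< j (here refl)

-- Nothing is required of `next` from `i` on, so an array of links may still hold other data there,
-- such as the right-hand sides of the productions not yet linked.
Linked : (next head key : ℕ → ℕ) → (N i : ℕ) → Set
Linked next head key N i = ∀ x → x < N → IsList next (head x) (bucket key i x)

link-insert : ∀ {next head key N i} → Linked next head key N i →
              Linked (next [ i ↦ head (key i) ]) (head [ key i ↦ suc i ]) key N (suc i)
link-insert {next} {head} {key} {N} {i} l x x< with key i ≟ x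
... | yes refl = subst (λ p → IsList next′ p (i ∷ bucket key i x)) (sym (↦-same head x (suc i)))
                   (i ∷ subst (λ p → IsList next′ p (bucket key i x)) (sym (↦-same next i (head x)))
                          (IsList-cong old (l x x<)))
  where
  next′ : ℕ → ℕ
  next′ = next [ i ↦ head x ]
  old : ∀ j → j ∈ bucket key i x → next j ≡ next′ j
  old j j∈ = sym (↦-other next (head x) (<⇒≢ (proj₁ (bucket-sound key i x j∈))))
... | no key≢x = subst (λ p → IsList next′ p (bucket key i x)) (sym (↦-other head (suc i) (≢-sym key≢x)))
                   (IsList-cong old (l x x<))
  where
  next′ : ℕ → ℕ
  next′ = next [ i ↦ head (key i) ]
  old : ∀ j → j ∈ bucket key i x → next j ≡ next′ j
  old j j∈ = sym (↦-other next (head (key i)) (<⇒≢ (proj₁ (bucket-sound key i x j∈))))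

link-skip : ∀ {next head key N i} → N ≤ key i → Linked next head key N i → Linked next head key N (suc i)
link-skip {key = key} {i = i} N≤ l x x< with key i ≟ x
... | yes refl = contradiction x< (≤⇒≯ N≤)
... | no _     = l x x<

-- The search

-- A bound on the cost of all straight-line code below.
abstract
  tick : ℕ
  tick = 1000

  ≤tick : ∀ t → T (t ≤ᵇ 1000) → t ≤ tick
  ≤tick t = ≤ᵇ⇒≤ t 1000

2tick : ℕ
2tick = tick + tick

-- The fields of a production are its kind, left-hand side, letter and right-hand
-- nonterminal; the last one gives way to the pointer to the next production with
-- the same right-hand nonterminal.
pattern tyA  = prods zero
pattern lhsA = prods (suc zero)
pattern ltrA = prods (suc (suc zero))
pattern rhsA = prods (suc (suc (suc zero)))

-- The lists of the edges with a given target (hd₀, nx₀) or source (hd₁, nx₁) and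
-- of the productions with a given right-hand nonterminal (ph); the table of
-- kinds, remaining entries and split vertices (K, P, W); the queue (qA, qU, qV).
hd₀A hd₁A nx₀A nx₁A phA KA PA WA qAA qUA qVA : Arr
hd₀A = cell (# 0)
hd₁A = cell (# 1)
nx₀A = cell (# 2)
nx₁A = cell (# 3)
phA  = cell (# 4)
KA   = cell (# 5)
PA   = cell (# 6)
WA   = cell (# 7)
qAA  = cell (# 8)
qUA  = cell (# 9)
qVA  = cell (# 10)

nR mR pR νR startR tlR hR bR uR vR parR dR iR AR aR δR eR wR ruR rvR τR κR : Fin #regs
nR     = # 5
mR     = # 6
pR     = # 7
νR     = # 8
startR = # 9
tlR    = # 13
hR     = # 14
bR     = # 15
uR     = # 16
vR     = # 17
parR   = # 18
dR     = # 19
iR     = # 20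
AR     = # 21
aR     = # 22
δR     = # 23
eR     = # 24
wR     = # 25
ruR    = # 26
rvR    = # 27
τR     = # 28
κR     = # 29

selT : Term → Term → Term → Term
selT δ x y = (con 1 ⊖ δ) ⊗ x ⊕ δ ⊗ y

τT : Term → Term → Term → Term
τT A u v = (A ⊗ var nR ⊕ u) ⊗ var nR ⊕ v

item : Fin #regs → Term
item r = var r ⊖ con 1

locate enter enqueue : List Instr
locate = τR := τT (var AR) (var ruR) (var rvR) ∷ []
enter =
  put dist (var dR) (var τR) ∷ put KA (var κR) (var τR) ∷
  put PA (var parR) (var τR) ∷ put WA (var wR) (var τR) ∷ []
enqueue =
  put qAA (var AR) (var tlR) ∷ put qUA (var ruR) (var tlR) ∷ put qVA (var rvR) (var tlR) ∷
  -- The literal comes first because `1 + x` reduces to `suc x`.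
  tlR := con 1 ⊕ var tlR ∷ []

discover : Prog
discover = blk locate ⨾ ite (get dist (var τR)) (blk []) (blk enter ⨾ blk enqueue)

field-of-edge : Term → Term
field-of-edge f = get input (con 6 ⊕ item eR ⊗ con 3 ⊕ f)

crossEdge : List Instr
crossEdge =
  wR := field-of-edge (var δR) ∷ ruR := selT (var δR) (var wR) (var uR) ∷
  rvR := selT (var δR) (var vR) (var wR) ∷ []

nextEdge : List Instr
nextEdge = eR := selT (var δR) (get nx₀A (item eR)) (get nx₁A (item eR)) ∷ []

-- The truncated differences in both orders add up to the distance of the two letters, which is
-- nonzero exactly if they differ.
labelT edgeTest : Term
labelT   = field-of-edge (con 2)
edgeTest = (labelT ⊖ var aR) ⊕ (var aR ⊖ labelT)

edgeLoop : Prog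
edgeLoop = loop (var eR) (ite edgeTest (blk []) (blk crossEdge ⨾ discover) ⨾ blk nextEdge)

prodStart : List Instr
prodStart =
  AR := get lhsA (item iR) ∷ aR := get ltrA (item iR) ∷ δR := get tyA (item iR) ⊖ con 1 ∷
  eR := selT (var δR) (get hd₀A (var uR)) (get hd₁A (var vR)) ∷ κR := con 1 ⊕ var δR ∷ []

nextProd : List Instr
nextProd = iR := get rhsA (item iR) ∷ []

prodLoop : Prog
prodLoop = loop (var iR) (blk prodStart ⨾ edgeLoop ⨾ blk nextProd)

popStart : List Instr
popStart =
  bR := get qAA (var hR) ∷ uR := get qUA (var hR) ∷ vR := get qVA (var hR) ∷
  parR := τT (var bR) (var uR) (var vR) ∷ dR := con 1 ⊕ get dist (var parR) ∷
  iR := get phA (var bR) ∷ []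

search : Prog
search = loop (var tlR ⊖ var hR) (blk popStart ⨾ prodLoop ⨾ blk (hR := con 1 ⊕ var hR ∷ []))

sumFrom : (ℕ → ℕ) → ℕ → ℕ → ℕ
sumFrom f h zero    = 0
sumFrom f h (suc k) = f h + sumFrom f (suc h) k

∸-both-zero : ∀ x y → (x ∸ y) + (y ∸ x) ≡ 0 → x ≡ y
∸-both-zero x y eq =
  ≤-antisym (m∸n≡0⇒m≤n (m+n≡0⇒m≡0 (x ∸ y) eq)) (m∸n≡0⇒m≤n (m+n≡0⇒n≡0 (x ∸ y) eq))

∸-self-zero : ∀ x → (x ∸ x) + (x ∸ x) ≡ 0
∸-self-zero x rewrite n∸n≡0 x = refl

-- start is the start symbol; tb, ib, pb and ob are the addresses of the arrays
-- of the respective kinds and ou is the initial contents of the output array.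
record Placement : Set where
  field
    start tb ib pb ob L B : ℕ
    ou                    : ℕ → ℕ

module Execution (X : Input) (Y : Placement) where

  open Input X
  open Placement Y
  open Instance X
  open Tables
  open Layout tb ib pb ob (6 + m * 3) p DL L using (len)
  open Semantics len B public

  file : (tl h b u v par d i A a δ e w ru rv τ κ : ℕ) → Vec ℕ #regs
  file tl h b u v par d i A a δ e w ru rv τ κ =
    tb ∷ 0 ∷ 0 ∷ 0 ∷ 0 ∷ n ∷ m ∷ p ∷ ν ∷ start ∷ ib ∷ pb ∷ ob ∷
    tl ∷ h ∷ b ∷ u ∷ v ∷ par ∷ d ∷ i ∷ A ∷ a ∷ δ ∷ e ∷ w ∷ ru ∷ rv ∷ τ ∷ κ ∷ []

  -- `ts` collects the registers that the body of a loop overwrites and whose final values are of no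
  -- interest.
  frame₉ : (tl h b u v par d i : ℕ) → Vec ℕ 9 → Vec ℕ #regs
  frame₉ tl h b u v par d i ts =
    tb ∷ 0 ∷ 0 ∷ 0 ∷ 0 ∷ n ∷ m ∷ p ∷ ν ∷ start ∷ ib ∷ pb ∷ ob ∷
    tl ∷ h ∷ b ∷ u ∷ v ∷ par ∷ d ∷ i ∷ ts

  frame₁₅ : (tl h : ℕ) → Vec ℕ 15 → Vec ℕ #regs
  frame₁₅ tl h ts =
    tb ∷ 0 ∷ 0 ∷ 0 ∷ 0 ∷ n ∷ m ∷ p ∷ ν ∷ start ∷ ib ∷ pb ∷ ob ∷ tl ∷ h ∷ ts

  memory : (hd₀ hd₁ nx₀ nx₁ ph px : ℕ → ℕ) → Tables → Vec (ℕ → ℕ) #arrays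
  memory hd₀ hd₁ nx₀ nx₁ ph px g =
    inp ∷ D g ∷ ou ∷ ty ∷ lhs ∷ ltr ∷ px ∷ hd₀ ∷ hd₁ ∷ nx₀ ∷ nx₁ ∷ ph ∷
    K g ∷ P g ∷ Wt g ∷ qA g ∷ qU g ∷ qV g ∷ []

  record Bounds : Set where
    field
      DL+4≤B : 4 + DL ≤ B
      16≤B   : 16 ≤ B
      n≤B    : n ≤ B
      m<B    : m < B
      p<B    : p < B
      ν<B    : ν < B
      DL≤L   : DL ≤ L
      n≤L    : n ≤ L
      m≤L    : m ≤ L
      ν<L    : ν < L
      endp<  : ∀ j → j < m → endp 0 j < n × endp 1 j < n
      lhs≤   : ∀ i → i < p → lhs i ≤ ν
      key≤   : ∀ i → i < p → ty i ≤ 2 → key i ≤ ν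
      ty≤3   : ∀ i → i < p → ty i ≤ 3
      1≤n    : 1 ≤ n
      1≤p    : 1 ≤ p

-- Correctness and cost of the loops of the search

module Steps (X : Input) (Y : Placement) (bounds : Execution.Bounds X Y) where

  open Input X
  open Placement Y
  open Instance X
  open Tables
  open _⊑_
  open Execution X Y
  open Bounds bounds
  open Bounded endp< lhs≤ key≤
  open Core

  DL<B : ∀ {x} → x < DL → x < B
  DL<B x< = <-≤-trans x< (≤-trans (m≤n+m DL 4) DL+4≤B)

  DL≤B : ∀ {x} → x ≤ DL → x < B
  DL≤B x≤ = ≤-<-trans x≤ (<-≤-trans (m<n+m DL {4} z<s) DL+4≤B)

  dir≤1 : ∀ {i} → ty i ≤ 2 → dir i ≤ 1
  dir≤1 ty≤ = ∸-monoˡ-≤ 1 ty≤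

  slot< : ∀ {j δ} → j < m → δ < 3 → 6 + j * 3 + δ < 6 + m * 3
  slot< {j} {δ} j< δ< = subst (_< 6 + m * 3) (sym (+-assoc 6 (j * 3) δ)) (+-monoʳ-< 6 (pair-bound j< δ<))

  -- Productions S → ε get a key outside the range of the lists, so that the search never meets
  -- them.
  key′ : ℕ → ℕ
  key′ i with ty i ≤? 2
  ... | yes _ = key i
  ... | no _  = suc ν

  key′-sound : ∀ {i b} → b ≤ ν → key′ i ≡ b → ty i ≤ 2 × key i ≡ b
  key′-sound {i} b≤ eq with ty i ≤? 2
  ... | yes ty≤ = ty≤ , eq
  ... | no _    = contradiction (subst (_≤ ν) (sym eq) b≤) (n≮n ν)

  key′-complete : ∀ {i} → ty i ≤ 2 → key′ i ≡ key i
  key′-complete {i} ty≤ with ty i ≤? 2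
  ... | yes _   = refl
  ... | no ty≰  = contradiction ty≤ ty≰

  -- A production runs through only one of the two lists. Counting both makes the charge independent
  -- of its direction, so that `work` becomes a product.
  deg : ℕ → ℕ → ℕ
  deg u v = length (bucket (endp 1) m u) + length (bucket (endp 0) m v)

  rules : ℕ → List ℕ
  rules b = bucket key′ p b

  work : ℕ → ℕ → ℕ → ℕ
  work b u v = length (rules b) * suc (deg u v)

  record Discovered (g : Tables) (h A u v d : ℕ) (g′ : Tables) : Set where
    field
      core    : Core g′ h
      extends : g ⊑ g′
      covered : Covered g′ A u v d
      tail≤   : tail g′ ≤ suc (tail g)
      upper   : ∀ j → j < tail g′ → D g′ (t g′ j) ≤ d

  module _ {hd₀ hd₁ nx₀ nx₁ ph px : ℕ → ℕ} where

    arrays : Tables → Vec (ℕ → ℕ) #arrays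
    arrays = memory hd₀ hd₁ nx₀ nx₁ ph px

    discover-exec : ∀ {g h A u v d κ par w b′ u′ v′ i′ a′ δ′ e′ τ′} →
      Core g h → Candidate g h A u v d κ par w →
      Σ[ g′ ∈ Tables ] Σ[ time ∈ ℕ ]
        Exec discover
          (file (tail g) h b′ u′ v′ par d i′ A a′ δ′ e′ w u v τ′ κ , arrays g) time
          (file (tail g′) h b′ u′ v′ par d i′ A a′ δ′ e′ w u v (τ A u v) κ , arrays g′) ×
        time ≤ tick × Discovered g h A u v d g′
    discover-exec {g} {h} {A} {u} {v} {d} {κ} {par} {w} {b′} {u′} {v′} {i′} {a′} {δ′} {e′} {τ′} c cand =
      decide (D g (τ A u v) ≟ 0)
      where
      k< : τ A u v < DL
      k< = τ< (Candidate.A≤ cand) (Candidate.u< cand) (Candidate.v< cand)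
      k<L : τ A u v < L
      k<L = <-≤-trans k< DL≤L
      decide : Dec (D g (τ A u v) ≡ 0) →
        Σ[ g′ ∈ Tables ] Σ[ time ∈ ℕ ]
        Exec discover
          (file (tail g) h b′ u′ v′ par d i′ A a′ δ′ e′ w u v τ′ κ , arrays g) time
          (file (tail g′) h b′ u′ v′ par d i′ A a′ δ′ e′ w u v (τ A u v) κ , arrays g′) ×
        time ≤ tick × Discovered g h A u v d g′
      decide (no d≢0) =
        g , _ , block (DL<B k< , tt) then ite-true (k< , tt) d≢0 (block tt) ,
        ≤tick (suc (costₗ locate + suc (cost ⌊ get dist (var τR) ⌋ₜ + 1))) tt ,
        record { core = c ; extends = ⊑-refl ; covered = found-covered c cand d≢0 ; tail≤ = n≤1+n _
               ; upper = Candidate.upper cand }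
      decide (yes d≡0) =
        Push.g′ c cand d≡0 , _ ,
        block (DL<B k< , tt) then
          ite-false (k< , tt) d≡0
            -- Between the two blocks the triple is in the tables but not yet in the queue.
            (_then_ {s′ = _ , arrays (record g′ { qA = qA g ; qU = qU g ; qV = qV g })}
              (block (k< , k<L , k<L , k<L , tt)) (block (tl< , tl< , tl< , DL≤B tail<DL , tt))) ,
        ≤tick (suc (costₗ locate + suc (cost ⌊ get dist (var τR) ⌋ₜ + suc (costₗ enter + costₗ enqueue)))) tt ,
        record { core = core′ ; extends = extends ; covered = covered ; tail≤ = ≤-refl ; upper = upper′ }
        where
        open Push c cand d≡0 renaming (core to core′)
        tl< : tail g < L
        tl< = <-≤-trans tail<DL DL≤L

    nx : ℕ → ℕ → ℕ
    nx δ j = sel δ (nx₀ j) (nx₁ j)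

    record Edges (g : Tables) (h b u v i : ℕ) (js : List ℕ) (g′ : Tables) : Set where
      field
        popped  : Popped g′ h b u v
        extends : g ⊑ g′
        covered : ∀ j → j ∈ js → endp 2 j ≡ ltr i →
                  Covered g′ (lhs i) (childU u v i j) (childV u v i j) (suc (D g (τ b u v)))
        tail≤   : tail g′ ≤ length js + tail g

    Popped-D : ∀ {g h b u v} → Popped g h b u v → D g (τ b u v) ≢ 0
    Popped-D {g} {h} record { core = c ; h< = h< ; b≡ = refl ; u≡ = refl ; v≡ = refl } = D-pos c h h<

    EdgesResult : List ℕ → Tables → (h b u v i i′ e w ru rv τ′ : ℕ) → Set
    EdgesResult js g h b u v i i′ e w ru rv τ′ =
      Σ[ g′ ∈ Tables ] Σ[ w′ ∈ ℕ ] Σ[ ru′ ∈ ℕ ] Σ[ rv′ ∈ ℕ ] Σ[ τ″ ∈ ℕ ] Σ[ time ∈ ℕ ]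
        Exec edgeLoop
          (file (tail g) h b u v (τ b u v) (suc (D g (τ b u v))) i′ (lhs i) (ltr i) (dir i) e w ru rv τ′ (suc (dir i)) ,
           arrays g) time
          (file (tail g′) h b u v (τ b u v) (suc (D g (τ b u v))) i′ (lhs i) (ltr i) (dir i) 0 w′ ru′ rv′ τ″ (suc (dir i)) ,
           arrays g′) ×
        time ≤ tick + length js * 2tick × Edges g h b u v i js g′

    -- An edge costs one tick for its own code and one for `discover`, and it adds at most one
    -- triple to the queue; the single tick pays for the final test.
    edges-exec : ∀ js {g h b u v i i′ e w ru rv τ′} →
      i < p → ty i ≤ 2 → key i ≡ b → Popped g h b u v →
      (∀ j → j ∈ js → j < m × endp (1 ∸ dir i) j ≡ sel (dir i) u v) → IsList (nx (dir i)) e js →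
      EdgesResult js g h b u v i i′ e w ru rv τ′
    edges-exec [] {g} _ _ _ pop _ [] =
      g , _ , _ , _ , _ , _ , stop tt refl , ≤-trans (≤tick 2 tt) (m≤m+n tick _) ,
      record { popped = pop ; extends = ⊑-refl ; covered = λ _ () ; tail≤ = ≤-refl }
    edges-exec (j ∷ js) {g} {h} {b} {u} {v} {i} {i′} {_} {w} {ru} {rv} {τ′} i< ty≤ key≡ pop js∈ (.j ∷ l) =
      iteration (endp 2 j ≟ ltr i)
      where
      δ≤1 : dir i ≤ 1
      δ≤1 = dir≤1 {i} ty≤
      j< : j < m
      j< = proj₁ (js∈ j (here refl))
      next≤ : nx (dir i) j ≤ m
      next≤ = IsList-pointer l (λ k k∈ → proj₁ (js∈ k (there k∈)))
      next-safe : j < L × (j < L × (nx (dir i) j < B × ⊤))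
      next-safe = <-≤-trans j< m≤L , <-≤-trans j< m≤L , ≤-<-trans next≤ m<B , tt
      label-safe : 6 + j * 3 + 2 < 6 + m * 3 × (6 + j * 3 + 2 < 6 + m * 3 × ⊤)
      label-safe = slot< j< ≤-refl , slot< j< ≤-refl , tt
      Result : Set
      Result = EdgesResult (j ∷ js) g h b u v i i′ (suc j) w ru rv τ′
      passed : endp 2 j ≢ ltr i → EdgesResult js g h b u v i i′ (nx (dir i) j) w ru rv τ′ → Result
      passed ≢lab (g′ , w′ , ru′ , rv′ , τ″ , time , run , time≤ , E) =
        g′ , w′ , ru′ , rv′ , τ″ , _ ,
        again tt (λ ()) (ite-true label-safe (≢lab ∘ ∸-both-zero (endp 2 j) (ltr i)) (block tt) then block next-safe) run ,
        iterate-bound (length js) 2tick (≤-trans (≤tick (suc (1 + suc (suc (cost ⌊ edgeTest ⌋ₜ + 1) + costₗ nextEdge))) tt) (m≤m+n tick tick)) time≤ ,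
        record { popped = Edges.popped E ; extends = Edges.extends E
               ; covered = λ { k (here refl) eq → contradiction eq ≢lab
                             ; k (there k∈) eq → Edges.covered E k k∈ eq }
               ; tail≤ = ≤-trans (Edges.tail≤ E) (n≤1+n _) }
      w₁ ru₁ rv₁ τ₁ : ℕ
      w₁  = endp (dir i) j
      ru₁ = childU u v i j
      rv₁ = childV u v i j
      τ₁  = τ (lhs i) ru₁ rv₁
      module Crossed {g₁ : Tables} (dis : Discovered g h (lhs i) ru₁ rv₁ (suc (D g (τ b u v))) g₁) where
        D≡₁ : D g₁ (τ b u v) ≡ D g (τ b u v)
        D≡₁ = D≡ (Discovered.extends dis) _ (Popped-D pop)
        edges : ∀ {g′} → Edges g₁ h b u v i js g′ → Edges g h b u v i (j ∷ js) g′
        edges {g′} E = record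
          { popped = Edges.popped E ; extends = ⊑-trans (Discovered.extends dis) (Edges.extends E)
          ; covered = λ { k (here refl) eq → Covered-⊑ {A = lhs i} {childU u v i k} {childV u v i k} (Edges.extends E) (Discovered.covered dis)
                        ; k (there k∈) eq → subst (Covered g′ (lhs i) (childU u v i k) (childV u v i k)) (cong suc D≡₁) (Edges.covered E k k∈ eq) }
          ; tail≤ = ≤-trans (Edges.tail≤ E)
              (≤-trans (+-monoʳ-≤ (length js) (Discovered.tail≤ dis)) (≤-reflexive (+-suc (length js) (tail g)))) }
      cross-safe : 6 + j * 3 + dir i < 6 + m * 3 × (ru₁ < B × (rv₁ < B × ⊤))
      cross-safe =
        slot< j< (s≤s (≤-trans δ≤1 (n≤1+n 1))) ,
        <-≤-trans (sel-bound {_< n} (dir i) δ≤1 w< u<) n≤B ,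
        <-≤-trans (sel-bound {_< n} (dir i) δ≤1 v< w<) n≤B , tt
        where
        w< : w₁ < n
        w< = endp<′ {j} {dir i} δ≤1 j<
        u< : u < n
        u< = subst (_< n) (Popped.u≡ pop) (proj₁ (proj₂ (bnd (Popped.core pop) _ (Popped.h< pop))))
        v< : v < n
        v< = subst (_< n) (Popped.v≡ pop) (proj₂ (proj₂ (bnd (Popped.core pop) _ (Popped.h< pop))))
      Rest : Tables → ℕ → Set
      Rest g₁ d = Σ[ g′ ∈ Tables ] Σ[ w′ ∈ ℕ ] Σ[ ru′ ∈ ℕ ] Σ[ rv′ ∈ ℕ ] Σ[ τ″ ∈ ℕ ] Σ[ time ∈ ℕ ]
        Exec edgeLoop
          (file (tail g₁) h b u v (τ b u v) (suc d) i′ (lhs i) (ltr i) (dir i) (nx (dir i) j) w₁ ru₁ rv₁ τ₁ (suc (dir i)) ,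
           arrays g₁) time
          (file (tail g′) h b u v (τ b u v) (suc d) i′ (lhs i) (ltr i) (dir i) 0 w′ ru′ rv′ τ″ (suc (dir i)) ,
           arrays g′) ×
        time ≤ tick + length js * 2tick × Edges g₁ h b u v i js g′
      crossed : ∀ {g₁ time₁} → endp 2 j ≡ ltr i →
        Exec discover
          (file (tail g) h b u v (τ b u v) (suc (D g (τ b u v))) i′ (lhs i) (ltr i) (dir i) (suc j) w₁ ru₁ rv₁ τ′ (suc (dir i)) ,
           arrays g) time₁
          (file (tail g₁) h b u v (τ b u v) (suc (D g (τ b u v))) i′ (lhs i) (ltr i) (dir i) (suc j) w₁ ru₁ rv₁ τ₁ (suc (dir i)) ,
           arrays g₁) →
        time₁ ≤ tick → Discovered g h (lhs i) ru₁ rv₁ (suc (D g (τ b u v))) g₁ →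
        Rest g₁ (D g (τ b u v)) → Result
      crossed {g₁} {time₁} lab run₁ time₁≤ dis (g′ , w′ , ru′ , rv′ , τ″ , time , run , time≤ , E) =
        g′ , w′ , ru′ , rv′ , τ″ , _ ,
        again tt (λ ())
          (ite-false label-safe (subst (λ x → (x ∸ ltr i) + (ltr i ∸ x) ≡ 0) (sym lab) (∸-self-zero (ltr i)))
             (block cross-safe then run₁)
           then block next-safe) run ,
        iterate-bound (length js) 2tick
          (≤-trans (+-middle (suc (1 + suc (suc (cost ⌊ edgeTest ⌋ₜ + suc (costₗ crossEdge))))) time₁ (costₗ nextEdge))
            (+-mono-≤ (≤tick (suc (1 + suc (suc (cost ⌊ edgeTest ⌋ₜ + suc (costₗ crossEdge)))) + costₗ nextEdge) tt) time₁≤)) time≤ ,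
        Crossed.edges dis E
      continue : endp 2 j ≡ ltr i →
        (Σ[ g₁ ∈ Tables ] Σ[ time₁ ∈ ℕ ]
          Exec discover
            (file (tail g) h b u v (τ b u v) (suc (D g (τ b u v))) i′ (lhs i) (ltr i) (dir i) (suc j) w₁ ru₁ rv₁ τ′ (suc (dir i)) ,
             arrays g) time₁
            (file (tail g₁) h b u v (τ b u v) (suc (D g (τ b u v))) i′ (lhs i) (ltr i) (dir i) (suc j) w₁ ru₁ rv₁ τ₁ (suc (dir i)) ,
             arrays g₁) ×
          time₁ ≤ tick × Discovered g h (lhs i) ru₁ rv₁ (suc (D g (τ b u v))) g₁) → Result
      continue lab (g₁ , time₁ , run₁ , time₁≤ , dis) = crossed lab run₁ time₁≤ dis
        -- The distance register was loaded when the triple was popped, and the entry of that triple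
        -- has not changed since.
        (subst (Rest g₁) (Crossed.D≡₁ dis)
          (edges-exec js i< ty≤ key≡ (Popped-⊑ (Discovered.extends dis) (Discovered.core dis) pop)
            (λ k k∈ → js∈ k (there k∈)) l))
      iteration : Dec (endp 2 j ≡ ltr i) → Result
      iteration (no ≢lab) = passed ≢lab (edges-exec js i< ty≤ key≡ pop (λ k k∈ → js∈ k (there k∈)) l)
      iteration (yes lab) = continue lab (discover-exec (Popped.core pop)
        (child {i = i} {j} pop (i< , ty≤ , key≡ , j< , lab , proj₂ (js∈ j (here refl)))))

    record Prods (g : Tables) (h b u v : ℕ) (is : List ℕ) (g′ : Tables) : Set where
      field
        popped  : Popped g′ h b u v
        extends : g ⊑ g′
        covered : ∀ i → i ∈ is → ∀ j → Matches b u v i j →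
                  Covered g′ (lhs i) (childU u v i j) (childV u v i j) (suc (D g (τ b u v)))
        tail≤   : tail g′ ≤ length is * suc (deg u v) + tail g

    module Searching (l₀ : Linked nx₀ hd₀ (endp 1) n m) (l₁ : Linked nx₁ hd₁ (endp 0) n m)
                     (lₚ : Linked px ph key′ (suc ν) p) where

      adjacency : ∀ {u v} δ → δ ≤ 1 → u < n → v < n →
                  IsList (nx δ) (sel δ (hd₀ u) (hd₁ v)) (bucket (endp (1 ∸ δ)) m (sel δ u v)) ×
                  length (bucket (endp (1 ∸ δ)) m (sel δ u v)) ≤ deg u v
      adjacency {u} {v} 0 _ u< v< rewrite sel₀ (hd₀ u) (hd₁ v) | sel₀ u v =
        IsList-cong (λ j _ → sym (sel₀ (nx₀ j) (nx₁ j))) (l₀ u u<) , m≤m+n _ _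
      adjacency {u} {v} 1 _ u< v< rewrite sel₁ (hd₀ u) (hd₁ v) | sel₁ u v =
        IsList-cong (λ j _ → sym (sel₁ (nx₀ j) (nx₁ j))) (l₁ v v<) ,
        m≤n+m _ (length (bucket (endp 1) m u))
      adjacency (suc (suc _)) (s≤s ()) u< v<

      ProdsRun : (d ptr : ℕ) → List ℕ → Tables → (h b u v : ℕ) → Vec ℕ 9 → Set
      ProdsRun d ptr is g h b u v ts =
        Σ[ g′ ∈ Tables ] Σ[ ts′ ∈ Vec ℕ 9 ] Σ[ time ∈ ℕ ]
          Exec prodLoop
            (frame₉ (tail g) h b u v (τ b u v) (suc d) ptr ts , arrays g) time
            (frame₉ (tail g′) h b u v (τ b u v) (suc d) 0 ts′ , arrays g′) ×
          time ≤ tick + length is * suc (deg u v) * 2tick × Prods g h b u v is g′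

      ProdsResult : (ptr : ℕ) → List ℕ → Tables → (h b u v : ℕ) → Vec ℕ 9 → Set
      ProdsResult ptr is g h b u v = ProdsRun (D g (τ b u v)) ptr is g h b u v

      prods-exec : ∀ is {g h b u v ptr} (ts : Vec ℕ 9) → Popped g h b u v →
        (∀ i → i ∈ is → i < p × ty i ≤ 2 × key i ≡ b) → IsList px ptr is →
        ProdsResult ptr is g h b u v ts
      prods-exec [] {g} ts pop _ [] =
        g , ts , _ , stop tt refl , ≤-trans (≤tick 2 tt) (m≤m+n tick _) ,
        record { popped = pop ; extends = ⊑-refl ; covered = λ _ () ; tail≤ = ≤-refl }
      prods-exec (i ∷ is) {g} {h} {b} {u} {v} (A ∷ a ∷ δ ∷ e ∷ w ∷ ru ∷ rv ∷ τ₀ ∷ κ ∷ []) pop is∈ (.i ∷ l) =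
        after-edges (edges-exec js i< ty≤ key≡ pop (λ j j∈ → bucket-sound (endp (1 ∸ dir i)) m _ j∈) (proj₁ adj))
        where
        js : List ℕ
        js = bucket (endp (1 ∸ dir i)) m (sel (dir i) u v)
        i< : i < p
        i< = proj₁ (is∈ i (here refl))
        ty≤ : ty i ≤ 2
        ty≤ = proj₁ (proj₂ (is∈ i (here refl)))
        key≡ : key i ≡ b
        key≡ = proj₂ (proj₂ (is∈ i (here refl)))
        δ≤1 : dir i ≤ 1
        δ≤1 = dir≤1 {i} ty≤
        u< : u < n
        u< = subst (_< n) (Popped.u≡ pop) (proj₁ (proj₂ (bnd (Popped.core pop) _ (Popped.h< pop))))
        v< : v < n
        v< = subst (_< n) (Popped.v≡ pop) (proj₂ (proj₂ (bnd (Popped.core pop) _ (Popped.h< pop))))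
        e₀ : ℕ
        e₀ = sel (dir i) (hd₀ u) (hd₁ v)
        adj : IsList (nx (dir i)) e₀ js × length js ≤ deg u v
        adj = adjacency (dir i) δ≤1 u< v<
        start-safe : i < p × (i < p × (i < p × (dir i < B × (u < L × (v < L × (e₀ < B × (suc (dir i) < B × ⊤)))))))
        start-safe = i< , i< , i< , ≤-<-trans δ≤1 (<-≤-trans (s≤s (s≤s z≤n)) 16≤B) ,
          <-≤-trans u< n≤L , <-≤-trans v< n≤L ,
          ≤-<-trans (IsList-pointer (proj₁ adj) (λ j j∈ → proj₁ (bucket-sound (endp (1 ∸ dir i)) m _ j∈))) m<B ,
          ≤-<-trans (s≤s δ≤1) (<-≤-trans (s≤s (s≤s (s≤s z≤n))) 16≤B) , tt
        W c₁ : ℕ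
        W  = length is * suc (deg u v)
        c₁ = suc (1 + suc (costₗ prodStart + 1))

        module _ {g₁} (E : Edges g h b u v i js g₁) where
          D≡₁ : D g₁ (τ b u v) ≡ D g (τ b u v)
          D≡₁ = D≡ (Edges.extends E) _ (Popped-D pop)

          all-prods : ∀ {g′} → Prods g₁ h b u v is g′ → Prods g h b u v (i ∷ is) g′
          all-prods {g′} R = record
            { popped = Prods.popped R ; extends = ⊑-trans (Edges.extends E) (Prods.extends R)
            ; covered = λ { k (here refl) j mt →
                  Covered-⊑ {A = lhs k} {childU u v k j} {childV u v k j} (Prods.extends R)
                    (Edges.covered E j (bucket-complete (endp (1 ∸ dir k)) m _
                       (proj₁ (proj₂ (proj₂ (proj₂ mt)))) (proj₂ (proj₂ (proj₂ (proj₂ (proj₂ mt))))))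
                       (proj₁ (proj₂ (proj₂ (proj₂ (proj₂ mt))))))
                          ; k (there k∈) j mt →
                  subst (Covered g′ (lhs k) (childU u v k j) (childV u v k j)) (cong suc D≡₁)
                    (Prods.covered R k k∈ j mt) }
            ; tail≤ = begin
                tail g′                      ≤⟨ Prods.tail≤ R ⟩
                W + tail g₁                  ≤⟨ +-monoʳ-≤ W (≤-trans (Edges.tail≤ E) (+-monoˡ-≤ (tail g) (≤-trans (proj₂ adj) (n≤1+n _)))) ⟩
                W + (suc (deg u v) + tail g) ≡⟨ +-rotate W (suc (deg u v)) (tail g) ⟩
                suc (deg u v) + W + tail g   ∎ }
            where open ≤-Reasoning

        bound : ∀ {time₁ time} → time₁ ≤ tick + length js * 2tick → time ≤ tick + W * 2tick →
                suc (1 + suc (costₗ prodStart + suc (time₁ + costₗ nextProd))) + time ≤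
                tick + (suc (deg u v) + W) * 2tick
        bound {time₁} {time} time₁≤ time≤ = amortise (suc (deg u v)) W 2tick (begin
          suc (1 + suc (costₗ prodStart + suc (time₁ + costₗ nextProd)))
            ≤⟨ +-middle c₁ time₁ (costₗ nextProd) ⟩
          c₁ + costₗ nextProd + time₁
            ≤⟨ +-mono-≤ (≤tick (c₁ + costₗ nextProd) tt) (≤-trans time₁≤ (+-monoʳ-≤ tick (*-monoˡ-≤ 2tick (proj₂ adj)))) ⟩
          tick + (tick + deg u v * 2tick)
            ≡⟨ +-assoc tick tick _ ⟨
          suc (deg u v) * 2tick ∎) time≤
          where open ≤-Reasoning

        Result : Set
        Result = ProdsResult (suc i) (i ∷ is) g h b u v (A ∷ a ∷ δ ∷ e ∷ w ∷ ru ∷ rv ∷ τ₀ ∷ κ ∷ [])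

        after-prods : ∀ {g₁ w₁ ru₁ rv₁ τ₁ time₁} →
          Exec edgeLoop
            (file (tail g) h b u v (τ b u v) (suc (D g (τ b u v))) (suc i) (lhs i) (ltr i) (dir i) e₀ w ru rv τ₀ (suc (dir i)) ,
             arrays g) time₁
            (file (tail g₁) h b u v (τ b u v) (suc (D g (τ b u v))) (suc i) (lhs i) (ltr i) (dir i) 0 w₁ ru₁ rv₁ τ₁ (suc (dir i)) ,
             arrays g₁) →
          time₁ ≤ tick + length js * 2tick → Edges g h b u v i js g₁ →
          ProdsRun (D g (τ b u v)) (px i) is g₁ h b u v (lhs i ∷ ltr i ∷ dir i ∷ 0 ∷ w₁ ∷ ru₁ ∷ rv₁ ∷ τ₁ ∷ suc (dir i) ∷ []) →
          Result
        after-prods run₁ time₁≤ E (g′ , ts′ , time , run , time≤ , R) =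
          g′ , ts′ , _ ,
          again tt (λ ()) (block start-safe then run₁ then block (i< , tt)) run ,
          bound time₁≤ time≤ , all-prods E R

        after-edges : EdgesResult js g h b u v i (suc i) e₀ w ru rv τ₀ → Result
        after-edges (g₁ , w₁ , ru₁ , rv₁ , τ₁ , time₁ , run₁ , time₁≤ , E) = after-prods run₁ time₁≤ E
          (subst (λ d → ProdsRun d (px i) is g₁ h b u v (lhs i ∷ ltr i ∷ dir i ∷ 0 ∷ w₁ ∷ ru₁ ∷ rv₁ ∷ τ₁ ∷ suc (dir i) ∷ []))
            (D≡₁ E)
            (prods-exec is (lhs i ∷ ltr i ∷ dir i ∷ 0 ∷ w₁ ∷ ru₁ ∷ rv₁ ∷ τ₁ ∷ suc (dir i) ∷ [])
              (Edges.popped E) (λ k k∈ → is∈ k (there k∈)) l))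

      ClosedBefore : Tables → ℕ → Set
      ClosedBefore g h = ∀ i → i < h → Closed g (qA g i) (qU g i) (qV g i)

      workAt : Tables → ℕ → ℕ
      workAt g i = work (qA g i) (qU g i) (qV g i)

      ClosedBefore-⊑ : ∀ {g g′ h} → Core g h → h ≤ tail g → g ⊑ g′ → ClosedBefore g h → ClosedBefore g′ h
      ClosedBefore-⊑ {g} {g′} c h≤ e cl i i< k j mt
        rewrite qA≡ e i (<-≤-trans i< h≤) | qU≡ e i (<-≤-trans i< h≤) | qV≡ e i (<-≤-trans i< h≤) =
        subst (λ d → Covered g′ (lhs k) (childU (qU g i) (qV g i) k j) (childV (qU g i) (qV g i) k j) (suc d))
          (sym (D≡ e _ (D-pos c i (<-≤-trans i< h≤))))
          (Covered-⊑ {A = lhs k} {childU (qU g i) (qV g i) k j} {childV (qU g i) (qV g i) k j} e (cl i i< k j mt))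

      record Searched (g : Tables) (h : ℕ) (time : ℕ) (g′ : Tables) : Set where
        field
          core    : Core g′ (tail g′)
          extends : g ⊑ g′
          closed  : ClosedBefore g′ (tail g′)
          count   : ℕ
          total   : h + count ≡ tail g′
          tail≤   : tail g′ ≤ sumFrom (workAt g′) h count + tail g
          time≤   : time ≤ tick + (count + sumFrom (workAt g′) h count) * 2tick

      SearchResult : Tables → ℕ → Vec ℕ 15 → Set
      SearchResult g h ts =
        Σ[ g′ ∈ Tables ] Σ[ ts′ ∈ Vec ℕ 15 ] Σ[ time ∈ ℕ ]
          Exec search (frame₁₅ (tail g) h ts , arrays g) time
                      (frame₁₅ (tail g′) (tail g′) ts′ , arrays g′) ×
          Searched g h time g′

      -- `fuel` makes the recursion structural. It cannot run out before the queue is exhausted, as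
      -- a position in the queue is below `DL`.
      search-exec : ∀ fuel {g h} (ts : Vec ℕ 15) → DL ≤ h + fuel → Core g h → h ≤ tail g → ClosedBefore g h →
        SearchResult g h ts
      search-more : ∀ fuel {g h} (ts : Vec ℕ 15) → DL ≤ h + fuel → Core g h → h < tail g → ClosedBefore g h →
        SearchResult g h ts

      search-exec fuel {g} {h} ts DL≤ c h≤ cl = decide (m≤n⇒m<n∨m≡n h≤)
        where
        decide : h < tail g ⊎ h ≡ tail g → SearchResult g h ts
        decide (inj₁ h<)   = search-more fuel ts DL≤ c h< cl
        decide (inj₂ refl) =
          g , ts , _ , stop tt (n∸n≡0 (tail g)) ,
          record { core = c ; extends = ⊑-refl ; closed = cl ; count = 0 ; total = +-identityʳ _
                 ; tail≤ = ≤-refl ; time≤ = ≤-trans (≤tick 4 tt) (m≤m+n tick _) }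

      search-more zero {g} {h} ts DL≤ c h< cl =
        contradiction (<-≤-trans h< (tail≤DL c)) (≤⇒≯ (subst (DL ≤_) (+-identityʳ h) DL≤))
      search-more (suc fuel) {g} {h} (b₀ ∷ u₀ ∷ v₀ ∷ par₀ ∷ d₀ ∷ i₀ ∷ ts) DL≤ c h< cl =
        after-prods (prods-exec (rules (qA g h)) ts
          (record { core = c ; h< = h< ; b≡ = refl ; u≡ = refl ; v≡ = refl })
          (λ i i∈ → let i< , eq = bucket-sound key′ p (qA g h) i∈ in i< , key′-sound b≤ eq)
          (lₚ (qA g h) (s≤s b≤)))
        where
        b≤ : qA g h ≤ ν
        b≤ = proj₁ (bnd c h h<)
        k< : t g h < DL
        k< = t< c h h<
        h<DL : h < DL
        h<DL = <-≤-trans h< (tail≤DL c)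
        h<L : h < L
        h<L = <-≤-trans h<DL DL≤L
        d<B : suc (D g (t g h)) < B
        d<B = let _ , ch , _ , len = wit c h h< in
          <-≤-trans (s≤s (s≤s (≤-trans (≤-reflexive (Chain-D ch)) (≤-trans len h<DL))))
                    (≤-trans (+-monoˡ-≤ DL {2} {4} (s≤s (s≤s z≤n))) DL+4≤B)
        pop-safe : h < L × (h < L × (h < L × (t g h < B × (t g h < DL × (suc (D g (t g h)) < B × (qA g h < L × ⊤))))))
        pop-safe = h<L , h<L , h<L , DL<B k< , k< , d<B , ≤-<-trans b≤ ν<L , tt
        W c₁ c₂ : ℕ
        W  = workAt g h
        c₁ = suc (3 + suc (costₗ popStart + 1))
        c₂ = costₗ (hR := con 1 ⊕ var hR ∷ [])

        module _ {g₁} (R : Prods g h (qA g h) (qU g h) (qV g h) (rules (qA g h)) g₁) where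
          closed₁ : ClosedBefore g₁ (suc h)
          closed₁ i i< with m≤n⇒m<n∨m≡n (s≤s⁻¹ i<)
          ... | inj₁ i<h  = ClosedBefore-⊑ c (<⇒≤ h<) (Prods.extends R) cl i i<h
          ... | inj₂ refl = closed-h
            where
            closed-h : Closed g₁ (qA g₁ h) (qU g₁ h) (qV g₁ h)
            closed-h k j mt
              rewrite qA≡ (Prods.extends R) h h< | qU≡ (Prods.extends R) h h< | qV≡ (Prods.extends R) h h< =
              subst (λ d → Covered g₁ (lhs k) (childU (qU g h) (qV g h) k j) (childV (qU g h) (qV g h) k j) (suc d))
                (sym (D≡ (Prods.extends R) _ (D-pos c h h<)))
                (Prods.covered R k
                  (bucket-complete key′ p _ (proj₁ mt)
                    (trans (key′-complete {k} (proj₁ (proj₂ mt))) (proj₁ (proj₂ (proj₂ mt))))) j mt)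

          module _ {g′ time time₁} (S : Searched g₁ (suc h) time g′)
                   (time₁≤ : time₁ ≤ tick + W * 2tick) where
            k S′ : ℕ
            k  = Searched.count S
            S′ = sumFrom (workAt g′) (suc h) k
            extends : g ⊑ g′
            extends = ⊑-trans (Prods.extends R) (Searched.extends S)
            W≡ : workAt g′ h ≡ W
            W≡ rewrite qA≡ extends h h< | qU≡ extends h h< | qV≡ extends h h< = refl
            tail-bound : tail g′ ≤ workAt g′ h + S′ + tail g
            tail-bound = begin
              tail g′                     ≤⟨ Searched.tail≤ S ⟩
              S′ + tail g₁                ≤⟨ +-monoʳ-≤ S′ (Prods.tail≤ R) ⟩
              S′ + (W + tail g)           ≡⟨ +-rotate S′ W (tail g) ⟩
              W + S′ + tail g             ≡⟨ cong (λ x → x + S′ + tail g) W≡ ⟨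
              workAt g′ h + S′ + tail g   ∎
              where open ≤-Reasoning
            bound : suc (3 + suc (costₗ popStart + suc (time₁ + c₂))) + time ≤
                    tick + (suc k + (workAt g′ h + S′)) * 2tick
            bound = ≤-trans
              (amortise (suc W) (k + S′) 2tick
                (≤-trans (+-middle c₁ time₁ c₂)
                  (≤-trans (+-mono-≤ (≤tick (c₁ + c₂) tt) time₁≤) (≤-reflexive (sym (+-assoc tick tick _)))))
                (Searched.time≤ S))
              (≤-reflexive (cong (λ x → tick + suc x * 2tick)
                (trans (+-rotate W k S′) (trans (+-assoc k W S′) (cong (λ z → k + (z + S′)) (sym W≡))))))
            searched : Searched g h (suc (3 + suc (costₗ popStart + suc (time₁ + c₂))) + time) g′
            searched = record
              { core = Searched.core S ; extends = extends ; closed = Searched.closed S ; count = suc k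
              ; total = trans (+-suc h k) (Searched.total S) ; tail≤ = tail-bound ; time≤ = bound }

        after-search : ∀ {g₁ ts₁ time₁} →
          Exec prodLoop
            (frame₉ (tail g) h (qA g h) (qU g h) (qV g h) (t g h) (suc (D g (t g h))) (ph (qA g h)) ts ,
             arrays g) time₁
            (frame₉ (tail g₁) h (qA g h) (qU g h) (qV g h) (t g h) (suc (D g (t g h))) 0 ts₁ ,
             arrays g₁) →
          time₁ ≤ tick + W * 2tick →
          Prods g h (qA g h) (qU g h) (qV g h) (rules (qA g h)) g₁ →
          SearchResult g₁ (suc h) (qA g h ∷ qU g h ∷ qV g h ∷ t g h ∷ suc (D g (t g h)) ∷ 0 ∷ ts₁) →
          SearchResult g h (b₀ ∷ u₀ ∷ v₀ ∷ par₀ ∷ d₀ ∷ i₀ ∷ ts)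
        after-search run₁ time₁≤ R (g′ , ts′ , time , run , S) =
          g′ , ts′ , _ ,
          again tt (λ eq → contradiction (m∸n≡0⇒m≤n eq) (<⇒≱ h<))
            (block pop-safe then run₁ then block (DL≤B h<DL , tt)) run ,
          searched R S time₁≤

        after-prods : ProdsResult (ph (qA g h)) (rules (qA g h)) g h (qA g h) (qU g h) (qV g h) ts →
                      SearchResult g h (b₀ ∷ u₀ ∷ v₀ ∷ par₀ ∷ d₀ ∷ i₀ ∷ ts)
        after-prods (g₁ , ts₁ , time₁ , run₁ , time₁≤ , R) = after-search run₁ time₁≤ R
          (search-exec fuel (qA g h ∷ qU g h ∷ qV g h ∷ t g h ∷ suc (D g (t g h)) ∷ 0 ∷ ts₁)
            (subst (DL ≤_) (+-suc h fuel) DL≤) (Core-suc (Popped.core (Prods.popped R)))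
            (Popped.h< (Prods.popped R)) (closed₁ R))

-- Building the lists and queueing the seeds

linkEdge : List Instr
linkEdge =
  wR := get input (con 6 ⊕ var iR ⊗ con 3 ⊕ con 1) ∷
  put nx₀A (get hd₀A (var wR)) (var iR) ∷ put hd₀A (con 1 ⊕ var iR) (var wR) ∷
  ruR := get input (con 6 ⊕ var iR ⊗ con 3 ⊕ con 0) ∷
  put nx₁A (get hd₁A (var ruR)) (var iR) ∷ put hd₁A (con 1 ⊕ var iR) (var ruR) ∷
  iR := con 1 ⊕ var iR ∷ []

linkEdges : Prog
linkEdges = loop (var mR ⊖ var iR) (blk linkEdge)

seedStart seedNext : List Instr
seedStart = ruR := var wR ∷ rvR := var wR ∷ []
seedNext  = wR := con 1 ⊕ var wR ∷ []

seedLoop : Prog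
seedLoop = loop (var nR ⊖ var wR) (blk seedStart ⨾ discover ⨾ blk seedNext)

seedProd linkProd nextI : List Instr
seedProd = AR := get lhsA (var iR) ∷ wR := con 0 ∷ []
linkProd =
  bR := (con 1 ⊖ get tyA (var iR)) ⊗ var νR ⊕ get rhsA (var iR) ∷
  put rhsA (get phA (var bR)) (var iR) ∷ put phA (con 1 ⊕ var iR) (var bR) ∷ []
nextI = iR := con 1 ⊕ var iR ∷ []

linkProds : Prog
linkProds = loop (var pR ⊖ var iR)
  -- The difference is nonzero for kind 3 only, that is for S → ε, whose seeds are queued in the
  -- same pass.
  (ite (get tyA (var iR) ⊖ con 2) (blk seedProd ⨾ seedLoop) (blk linkProd) ⨾ blk nextI)

seedInit prodInit : List Instr
-- Distance 0 is represented by 1; the register of the kind still has its initial value 0, the kind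
-- of a path without edges.
seedInit = AR := var νR ∷ wR := con 0 ∷ dR := con 1 ∷ []
prodInit = iR := con 0 ∷ []

buildBody : Prog
buildBody = linkEdges ⨾ blk seedInit ⨾ seedLoop ⨾ blk prodInit ⨾ linkProds ⨾ search

module Setup (X : Input) (Y : Placement) (bounds : Execution.Bounds X Y) where

  open Input X
  open Placement Y
  open Instance X
  open Tables
  open _⊑_
  open Execution X Y
  open Bounds bounds
  open Bounded endp< lhs≤ key≤
  open Core
  open Steps X Y bounds

  m∸i≢0 : ∀ {i x k} → i + suc k ≡ x → x ∸ i ≢ 0
  m∸i≢0 {i} {k = k} refl eq = contradiction (trans (sym (m+n∸m≡n i (suc k))) eq) λ ()

  <-of-sum : ∀ {i x k} → i + suc k ≡ x → i < x
  <-of-sum {i} {k = k} refl = m<m+n i z<s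

  LinkEdgesResult : ℕ → (hd₀ hd₁ nx₀ nx₁ ph px : ℕ → ℕ) → Tables →
    (tl h b u v par d i A a δ e w ru rv τ′ κ : ℕ) → Set
  LinkEdgesResult k hd₀ hd₁ nx₀ nx₁ ph px g tl h b u v par d i A a δ e w ru rv τ′ κ =
    Σ[ hd₀′ ∈ (ℕ → ℕ) ] Σ[ hd₁′ ∈ (ℕ → ℕ) ] Σ[ nx₀′ ∈ (ℕ → ℕ) ] Σ[ nx₁′ ∈ (ℕ → ℕ) ]
    Σ[ w′ ∈ ℕ ] Σ[ ru′ ∈ ℕ ] Σ[ time ∈ ℕ ]
      Exec linkEdges
        (file tl h b u v par d i A a δ e w ru rv τ′ κ , memory hd₀ hd₁ nx₀ nx₁ ph px g) time
        (file tl h b u v par d m A a δ e w′ ru′ rv τ′ κ , memory hd₀′ hd₁′ nx₀′ nx₁′ ph px g) ×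
      time ≤ tick + k * tick × Linked nx₀′ hd₀′ (endp 1) n m × Linked nx₁′ hd₁′ (endp 0) n m

  link-edges-exec : ∀ k {hd₀ hd₁ nx₀ nx₁ ph px g tl h b u v par d i A a δ e w ru rv τ′ κ} → i + k ≡ m →
    Linked nx₀ hd₀ (endp 1) n i → Linked nx₁ hd₁ (endp 0) n i →
    LinkEdgesResult k hd₀ hd₁ nx₀ nx₁ ph px g tl h b u v par d i A a δ e w ru rv τ′ κ
  link-edges-exec zero {hd₀} {hd₁} {nx₀} {nx₁} {ph} {px} {g} {tl} {h} {b} {u} {v} {par} {d} {i} {A} {a} {δ} {e} {w} {ru} {rv} {τ′} {κ} eq l₀ l₁ =
    finish (trans (sym (+-identityʳ i)) eq)
    where
    finish : i ≡ m → LinkEdgesResult 0 hd₀ hd₁ nx₀ nx₁ ph px g tl h b u v par d i A a δ e w ru rv τ′ κ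
    finish refl = _ , _ , _ , _ , _ , _ , _ , stop tt (n∸n≡0 m) , ≤-trans (≤tick 4 tt) (m≤m+n tick _) , l₀ , l₁
  link-edges-exec (suc k) {hd₀} {hd₁} {nx₀} {nx₁} {ph} {px} {g} {tl} {h} {b} {u} {v} {par} {d} {i} {A} {a} {δ} {e} {w} {ru} {rv} {τ′} {κ} eq l₀ l₁ =
    finish (link-edges-exec k {ph = ph} {px} {g} {tl} {h} {b} {u} {v} {par} {d} {suc i} {A} {a} {δ} {e} {endp 1 i} {endp 0 i} {rv} {τ′} {κ} (trans (sym (+-suc i k)) eq)
      (link-insert {key = endp 1} {i = i} l₀) (link-insert {key = endp 0} {i = i} l₁))
    where
    i< : i < m
    i< = <-of-sum eq
    i<L : i < L
    i<L = <-≤-trans i< m≤L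
    suci<B : suc i < B
    suci<B = ≤-<-trans i< m<B
    s<L : endp 0 i < L
    s<L = <-≤-trans (proj₁ (endp< i i<)) n≤L
    t<L : endp 1 i < L
    t<L = <-≤-trans (proj₂ (endp< i i<)) n≤L
    finish : LinkEdgesResult k (hd₀ [ endp 1 i ↦ suc i ]) (hd₁ [ endp 0 i ↦ suc i ])
               (nx₀ [ i ↦ hd₀ (endp 1 i) ]) (nx₁ [ i ↦ hd₁ (endp 0 i) ]) ph px g
               tl h b u v par d (suc i) A a δ e (endp 1 i) (endp 0 i) rv τ′ κ →
             LinkEdgesResult (suc k) hd₀ hd₁ nx₀ nx₁ ph px g tl h b u v par d i A a δ e w ru rv τ′ κ
    finish (_ , _ , _ , _ , _ , _ , _ , run , time≤ , l₀′ , l₁′) =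
      _ , _ , _ , _ , _ , _ , _ ,
      again tt (m∸i≢0 eq)
        (block (slot< i< (s≤s (s≤s z≤n)) , t<L , i<L , suci<B , t<L , slot< i< (s≤s z≤n) , s<L , i<L , suci<B , s<L , suci<B , tt)) run ,
      iterate-bound {suc (3 + costₗ linkEdge)} k tick (≤tick (suc (3 + costₗ linkEdge)) tt) time≤ , l₀′ , l₁′

  -- As long as all entries represent distance 0, a further seed keeps the queue sorted: `zero-dist`
  -- is the `upper` of the next seed.
  record Seeded (g : Tables) : Set where
    field
      core : Core g 0
      zero-dist : ∀ j → j < tail g → D g (t g j) ≤ 1

  record Seeds (g : Tables) (A w k : ℕ) (g′ : Tables) : Set where
    field
      seeded  : Seeded g′
      extends : g ⊑ g′
      covered : ∀ v → w ≤ v → v < n → Covered g′ A v v 1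
      tail≤   : tail g′ ≤ k + tail g

  seed : ∀ {g A v par} → Seeded g → A ≤ ν → Walk A v v [ v ] → v < n → Candidate g 0 A v v 1 0 par v
  seed {g} {v = v} s A≤ wk v< = record
    { A≤ = A≤ ; u< = v< ; v< = v< ; xs = [ v ] ; walk = wk ; link = stop ; d≡ = refl ; d≤ = s≤s z≤n
    ; upper = Seeded.zero-dist s
    ; lower = λ j j< _ → s≤s z≤n }

  module _ {hd₀ hd₁ nx₀ nx₁ ph px : ℕ → ℕ} where

    SeedsResult : ℕ → Tables → (b u v par i A a δ e w ru rv τ′ : ℕ) → Set
    SeedsResult k g b u v par i A a δ e w ru rv τ′ =
      Σ[ g′ ∈ Tables ] Σ[ ru′ ∈ ℕ ] Σ[ rv′ ∈ ℕ ] Σ[ τ″ ∈ ℕ ] Σ[ time ∈ ℕ ]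
        Exec seedLoop
          (file (tail g) 0 b u v par 1 i A a δ e w ru rv τ′ 0 , memory hd₀ hd₁ nx₀ nx₁ ph px g) time
          (file (tail g′) 0 b u v par 1 i A a δ e n ru′ rv′ τ″ 0 , memory hd₀ hd₁ nx₀ nx₁ ph px g′) ×
        time ≤ tick + k * 2tick × Seeds g A w k g′

    seeds-exec : ∀ k {g b u v par i A a δ e w ru rv τ′} → w + k ≡ n → Seeded g → A ≤ ν →
      (∀ v → v < n → Walk A v v [ v ]) → SeedsResult k g b u v par i A a δ e w ru rv τ′
    seeds-exec zero {g} {b} {u} {v} {par} {i} {A} {a} {δ} {e} {w} {ru} {rv} {τ′} eq s A≤ wk =
      finish (trans (sym (+-identityʳ w)) eq)
      where
      finish : w ≡ n → SeedsResult 0 g b u v par i A a δ e w ru rv τ′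
      finish refl = _ , _ , _ , _ , _ , stop tt (n∸n≡0 n) , ≤-trans (≤tick 4 tt) (m≤m+n tick _) ,
        record { seeded = s ; extends = ⊑-refl ; covered = λ v w≤ v< → contradiction v< (≤⇒≯ w≤) ; tail≤ = ≤-refl }
    seeds-exec (suc k) {g} {b} {u} {v} {par} {i} {A} {a} {δ} {e} {w} {ru} {rv} {τ′} eq s A≤ wk =
      continue (discover-exec (Seeded.core s) (seed {par = par} s A≤ (wk w w<) w<))
      where
      w< : w < n
      w< = <-of-sum eq
      sw<B : suc w < B
      sw<B = ≤-trans (s≤s w<)
        (≤-trans (s≤s (≤-trans (m≤m*n n (suc ν * n) ⦃ >-nonZero (≤-trans (≤-trans (s≤s z≤n) w<) (m≤m+n n (ν * n))) ⦄)
           (≤-reflexive (*-comm n (suc ν * n))))) (≤-trans (m≤n+m (suc DL) 3) (≤-trans (≤-reflexive (+-suc 3 DL)) DL+4≤B)))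
      c₁ : ℕ
      c₁ = suc (3 + suc (costₗ seedStart + 1))
      seeds : ∀ {g₁ g′} → Discovered g 0 A w w 1 g₁ → Seeds g₁ A (suc w) k g′ → Seeds g A w (suc k) g′
      seeds {g₁} {g′} dis S = record
        { seeded = Seeds.seeded S ; extends = ⊑-trans (Discovered.extends dis) (Seeds.extends S)
        ; covered = covered′
        ; tail≤ = ≤-trans (Seeds.tail≤ S) (≤-trans (+-monoʳ-≤ k (Discovered.tail≤ dis)) (≤-reflexive (+-suc k (tail g)))) }
        where
        covered′ : ∀ x → w ≤ x → x < n → Covered g′ A x x 1
        covered′ x w≤ x< with m≤n⇒m<n∨m≡n w≤
        ... | inj₁ w<x  = Seeds.covered S x w<x x<
        ... | inj₂ refl = Covered-⊑ {A = A} {w} {w} (Seeds.extends S) (Discovered.covered dis)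
      finish : ∀ {g₁ time₁} →
        Exec discover
          (file (tail g) 0 b u v par 1 i A a δ e w w w τ′ 0 , memory hd₀ hd₁ nx₀ nx₁ ph px g) time₁
          (file (tail g₁) 0 b u v par 1 i A a δ e w w w (τ A w w) 0 , memory hd₀ hd₁ nx₀ nx₁ ph px g₁) →
        time₁ ≤ tick → Discovered g 0 A w w 1 g₁ →
        SeedsResult k g₁ b u v par i A a δ e (suc w) w w (τ A w w) →
        SeedsResult (suc k) g b u v par i A a δ e w ru rv τ′
      finish {time₁ = time₁} run₁ time₁≤ dis (g′ , ru′ , rv′ , τ″ , time , run , time≤ , S) =
        g′ , ru′ , rv′ , τ″ , _ ,
        again tt (m∸i≢0 eq) (block tt then run₁ then block (sw<B , tt)) run ,
        iterate-bound k 2tick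
          (≤-trans (+-middle c₁ time₁ (costₗ seedNext)) (+-mono-≤ (≤tick (c₁ + costₗ seedNext) tt) time₁≤)) time≤ ,
        seeds dis S
      continue :
        (Σ[ g₁ ∈ Tables ] Σ[ time₁ ∈ ℕ ]
          Exec discover
            (file (tail g) 0 b u v par 1 i A a δ e w w w τ′ 0 , memory hd₀ hd₁ nx₀ nx₁ ph px g) time₁
            (file (tail g₁) 0 b u v par 1 i A a δ e w w w (τ A w w) 0 , memory hd₀ hd₁ nx₀ nx₁ ph px g₁) ×
          time₁ ≤ tick × Discovered g 0 A w w 1 g₁) →
        SeedsResult (suc k) g b u v par i A a δ e w ru rv τ′
      continue (g₁ , time₁ , run₁ , time₁≤ , dis) = finish run₁ time₁≤ dis
        (seeds-exec k (trans (sym (+-suc w k)) eq)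
          (record { core = Discovered.core dis ; zero-dist = Discovered.upper dis }) A≤ wk)

  record Prepared (g : Tables) (i k : ℕ) (ph′ px′ : ℕ → ℕ) (g′ : Tables) : Set where
    field
      seeded  : Seeded g′
      extends : g ⊑ g′
      epss    : ∀ j v → i ≤ j → j < p → ty j ≡ 3 → v < n → Covered g′ (lhs j) v v 1
      linked  : Linked px′ ph′ key′ (suc ν) p
      tail≤   : tail g′ ≤ k * n + tail g

  module _ {hd₀ hd₁ nx₀ nx₁ : ℕ → ℕ} where

    LinkProdsResult : ℕ → (ph px : ℕ → ℕ) → Tables → (b u v par i A a δ e w ru rv τ′ : ℕ) → Set
    LinkProdsResult k ph px g b u v par i A a δ e w ru rv τ′ =
      Σ[ ph′ ∈ (ℕ → ℕ) ] Σ[ px′ ∈ (ℕ → ℕ) ] Σ[ g′ ∈ Tables ] Σ[ b′ ∈ ℕ ] Σ[ A′ ∈ ℕ ] Σ[ w′ ∈ ℕ ]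
      Σ[ ru′ ∈ ℕ ] Σ[ rv′ ∈ ℕ ] Σ[ τ″ ∈ ℕ ] Σ[ time ∈ ℕ ]
        Exec linkProds
          (file (tail g) 0 b u v par 1 i A a δ e w ru rv τ′ 0 , memory hd₀ hd₁ nx₀ nx₁ ph px g) time
          (file (tail g′) 0 b′ u v par 1 p A′ a δ e w′ ru′ rv′ τ″ 0 , memory hd₀ hd₁ nx₀ nx₁ ph′ px′ g′) ×
        time ≤ tick + k * (suc n * 2tick) × Prepared g i k ph′ px′ g′

    -- The hypothesis on `px` says that from `i` on the right-hand sides have not yet given way to
    -- links. Each production is charged `suc n` double ticks, enough for S → ε with a seed at every
    -- vertex.
    link-prods-exec : ∀ k {ph px g b u v par i A a δ e w ru rv τ′} → i + k ≡ p → Seeded g →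
      Linked px ph key′ (suc ν) i → (∀ j → i ≤ j → j < p → px j ≡ rhs j) →
      LinkProdsResult k ph px g b u v par i A a δ e w ru rv τ′
    link-prods-exec zero {ph} {px} {g} {b} {u} {v} {par} {i} {A} {a} {δ} {e} {w} {ru} {rv} {τ′} eq s l px≡ =
      finish (trans (sym (+-identityʳ i)) eq)
      where
      finish : i ≡ p → LinkProdsResult 0 ph px g b u v par i A a δ e w ru rv τ′
      finish refl = _ , _ , _ , _ , _ , _ , _ , _ , _ , _ , stop tt (n∸n≡0 p) , ≤-trans (≤tick 4 tt) (m≤m+n tick _) ,
        record { seeded = s ; extends = ⊑-refl ; epss = λ j v i≤ j< → contradiction j< (≤⇒≯ i≤) ; linked = l
               ; tail≤ = ≤-refl }
    link-prods-exec (suc k) {ph} {px} {g} {b} {u} {v} {par} {i} {A} {a} {δ} {e} {w} {ru} {rv} {τ′} eq s l px≡ =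
      choose (ty i ≤? 2)
      where
      i< : i < p
      i< = <-of-sum eq
      suci<B : suc i < B
      suci<B = ≤-<-trans i< p<B
      Result : Set
      Result = LinkProdsResult (suc k) ph px g b u v par i A a δ e w ru rv τ′

      module Linking (ty≤ : ty i ≤ 2) where
        b′ : ℕ
        b′ = (1 ∸ ty i) * ν + px i
        b′≡ : key′ i ≡ b′
        b′≡ = trans (key′-complete {i} ty≤) (cong ((1 ∸ ty i) * ν +_) (sym (px≡ i ≤-refl i<)))
        linked₁ : Linked (px [ i ↦ ph b′ ]) (ph [ b′ ↦ suc i ]) key′ (suc ν) (suc i)
        linked₁ = subst (λ x → Linked (px [ i ↦ ph x ]) (ph [ x ↦ suc i ]) key′ (suc ν) (suc i)) b′≡
                    (link-insert {key = key′} {i = i} l)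
        b≤ν : b′ ≤ ν
        b≤ν = subst (λ x → (1 ∸ ty i) * ν + x ≤ ν) (sym (px≡ i ≤-refl i<)) (key≤ i i< ty≤)
        safe : i < p × (i < p × (b′ < B × (b′ < L × (i < p × (suc i < B × (b′ < L × ⊤))))))
        safe = i< , i< , ≤-<-trans b≤ν ν<B , ≤-<-trans b≤ν ν<L , i< , suci<B , ≤-<-trans b≤ν ν<L , tt
        prepared : ∀ {ph′ px′ g′} → Prepared g (suc i) k ph′ px′ g′ → Prepared g i (suc k) ph′ px′ g′
        prepared {g′ = g′} R = record
          { seeded = Prepared.seeded R ; extends = Prepared.extends R
          ; epss = epss′
          ; linked = Prepared.linked R
          ; tail≤ = ≤-trans (Prepared.tail≤ R) (+-monoˡ-≤ (tail g) (m≤n+m (k * n) n)) }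
          where
          epss′ : ∀ j x → i ≤ j → j < p → ty j ≡ 3 → x < n → Covered g′ (lhs j) x x 1
          epss′ j x i≤ j< ty≡ x< with m≤n⇒m<n∨m≡n i≤
          ... | inj₁ i<j  = Prepared.epss R j x i<j j< ty≡ x<
          ... | inj₂ refl = contradiction (subst (_≤ 2) ty≡ ty≤) λ { (s≤s (s≤s ())) }
        finish : LinkProdsResult k (ph [ b′ ↦ suc i ]) (px [ i ↦ ph b′ ]) g b′ u v par (suc i) A a δ e w ru rv τ′ → Result
        finish (_ , _ , g′ , _ , _ , _ , _ , _ , _ , time , run , time≤ , R) =
          _ , _ , g′ , _ , _ , _ , _ , _ , _ , _ ,
          again tt (m∸i≢0 eq)
            (ite-false (i< , tt) (m≤n⇒m∸n≡0 ty≤) (block safe) then block (suci<B , tt)) run ,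
          iterate-bound {suc (3 + suc (suc (cost ⌊ get tyA (var iR) ⊖ con 2 ⌋ₜ + costₗ linkProd) + costₗ nextI))}
            k (suc n * 2tick)
            (≤-trans (≤tick (suc (3 + suc (suc (cost ⌊ get tyA (var iR) ⊖ con 2 ⌋ₜ + costₗ linkProd) + costₗ nextI))) tt) (≤-trans (m≤m+n tick tick) (m≤m+n 2tick _))) time≤ ,
          prepared R

      module Seeding (ty≰ : ¬ ty i ≤ 2) where
        ty≡3 : ty i ≡ 3
        ty≡3 = ≤-antisym (ty≤3 i i<) (≰⇒> ty≰)
        key′≡ : key′ i ≡ suc ν
        key′≡ with ty i ≤? 2
        ... | yes ty≤ = contradiction ty≤ ty≰
        ... | no _    = refl
        c₁ : ℕ
        c₁ = suc (3 + suc (suc (cost ⌊ get tyA (var iR) ⊖ con 2 ⌋ₜ + suc (costₗ seedProd))))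
        prepared : ∀ {g₁ ph′ px′ g′} → Seeds g (lhs i) 0 n g₁ → Prepared g₁ (suc i) k ph′ px′ g′ →
                   Prepared g i (suc k) ph′ px′ g′
        prepared {g₁} {g′ = g′} S R = record
          { seeded = Prepared.seeded R ; extends = ⊑-trans (Seeds.extends S) (Prepared.extends R)
          ; epss = epss′
          ; linked = Prepared.linked R
          ; tail≤ = begin
              tail g′              ≤⟨ Prepared.tail≤ R ⟩
              k * n + tail g₁      ≤⟨ +-monoʳ-≤ (k * n) (Seeds.tail≤ S) ⟩
              k * n + (n + tail g) ≡⟨ +-rotate (k * n) n (tail g) ⟩
              n + k * n + tail g   ∎ }
          where
          open ≤-Reasoning
          epss′ : ∀ j x → i ≤ j → j < p → ty j ≡ 3 → x < n → Covered g′ (lhs j) x x 1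
          epss′ j x i≤ j< ty≡ x< with m≤n⇒m<n∨m≡n i≤
          ... | inj₁ i<j  = Prepared.epss R j x i<j j< ty≡ x<
          ... | inj₂ refl = Covered-⊑ {A = lhs i} {x} {x} (Prepared.extends R) (Seeds.covered S x z≤n x<)
        bound : ∀ {time₁} → time₁ ≤ tick + n * 2tick →
                suc (3 + suc (suc (cost ⌊ get tyA (var iR) ⊖ con 2 ⌋ₜ + suc (costₗ seedProd + time₁)) + costₗ nextI))
                ≤ suc n * 2tick
        bound {time₁} time₁≤ = begin
          c₁ + (time₁ + costₗ nextI)           ≤⟨ +-middle c₁ time₁ (costₗ nextI) ⟩
          (c₁ + costₗ nextI) + time₁           ≤⟨ +-mono-≤ (≤tick (c₁ + costₗ nextI) tt) time₁≤ ⟩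
          tick + (tick + n * 2tick)    ≡⟨ +-assoc tick tick _ ⟨
          suc n * 2tick                ∎
          where open ≤-Reasoning
        finish : ∀ {g₁ ru₁ rv₁ τ₁ time₁} →
          Exec seedLoop
            (file (tail g) 0 b u v par 1 i (lhs i) a δ e 0 ru rv τ′ 0 , memory hd₀ hd₁ nx₀ nx₁ ph px g) time₁
            (file (tail g₁) 0 b u v par 1 i (lhs i) a δ e n ru₁ rv₁ τ₁ 0 , memory hd₀ hd₁ nx₀ nx₁ ph px g₁) →
          time₁ ≤ tick + n * 2tick → Seeds g (lhs i) 0 n g₁ →
          LinkProdsResult k ph px g₁ b u v par (suc i) (lhs i) a δ e n ru₁ rv₁ τ₁ → Result
        finish run₁ time₁≤ S (_ , _ , g′ , _ , _ , _ , _ , _ , _ , time , run , time≤ , R) =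
          _ , _ , g′ , _ , _ , _ , _ , _ , _ , _ ,
          again tt (m∸i≢0 eq)
            (ite-true (i< , tt) (λ z → ty≰ (m∸n≡0⇒m≤n z)) (block (i< , tt) then run₁) then block (suci<B , tt)) run ,
          iterate-bound k (suc n * 2tick) (bound time₁≤) time≤ ,
          prepared S R
        continue : SeedsResult {hd₀} {hd₁} {nx₀} {nx₁} {ph} {px} n g b u v par i (lhs i) a δ e 0 ru rv τ′ → Result
        continue (g₁ , ru₁ , rv₁ , τ₁ , time₁ , run₁ , time₁≤ , S) = finish run₁ time₁≤ S
          (link-prods-exec k (trans (sym (+-suc i k)) eq) (Seeds.seeded S)
            (link-skip {key = key′} {i = i} (≤-reflexive (sym key′≡)) l) (λ j i<j → px≡ j (<⇒≤ i<j)))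

      choose : Dec (ty i ≤ 2) → Result
      choose (yes ty≤) = Linking.finish ty≤
        (link-prods-exec k (trans (sym (+-suc i k)) eq) s (Linking.linked₁ ty≤)
          (λ j i<j j< → trans (↦-other px _ (≢-sym (<⇒≢ i<j))) (px≡ j (<⇒≤ i<j) j<)))
      choose (no ty≰) = Seeding.continue ty≰
        (seeds-exec n refl s (lhs≤ i i<) (λ x x< → eps i< (Seeding.ty≡3 ty≰) x<))

-- Counting the steps of the search

Σ< : ℕ → (ℕ → ℕ) → ℕ
Σ< zero    f = 0
Σ< (suc k) f = f k + Σ< k f

Σ<-cong : ∀ k {f g} → (∀ i → i < k → f i ≡ g i) → Σ< k f ≡ Σ< k g
Σ<-cong zero    eq = refl
Σ<-cong (suc k) eq = cong₂ _+_ (eq k ≤-refl) (Σ<-cong k (λ i i< → eq i (m<n⇒m<1+n i<)))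

interchange : ∀ a b c d → (a + b) + (c + d) ≡ (a + c) + (b + d)
interchange a b c d = begin
  (a + b) + (c + d) ≡⟨ +-assoc a b (c + d) ⟩
  a + (b + (c + d)) ≡⟨ cong (a +_) (trans (sym (+-assoc b c d)) (trans (cong (_+ d) (+-comm b c)) (+-assoc c b d))) ⟩
  a + (c + (b + d)) ≡⟨ +-assoc a c (b + d) ⟨
  (a + c) + (b + d) ∎
  where open ≡-Reasoning

Σ<-+ : ∀ k f g → Σ< k (λ i → f i + g i) ≡ Σ< k f + Σ< k g
Σ<-+ zero    f g = refl
Σ<-+ (suc k) f g = trans (cong (f k + g k +_) (Σ<-+ k f g)) (interchange (f k) (g k) (Σ< k f) (Σ< k g))

Σ<-* : ∀ k c f → Σ< k (λ i → c * f i) ≡ c * Σ< k f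
Σ<-* zero    c f = sym (*-zeroʳ c)
Σ<-* (suc k) c f = trans (cong (c * f k +_) (Σ<-* k c f)) (sym (*-distribˡ-+ c (f k) (Σ< k f)))

Σ<-const : ∀ k c → Σ< k (λ _ → c) ≡ k * c
Σ<-const zero    c = refl
Σ<-const (suc k) c = cong (c +_) (Σ<-const k c)

Σ<-split : ∀ x y f → Σ< (x + y) f ≡ Σ< x (λ r → f (y + r)) + Σ< y f
Σ<-split zero    y f = refl
Σ<-split (suc x) y f = begin
  f (x + y) + Σ< (x + y) f                              ≡⟨ cong₂ _+_ (cong f (+-comm x y)) (Σ<-split x y f) ⟩
  f (y + x) + (Σ< x (λ r → f (y + r)) + Σ< y f)         ≡⟨ +-assoc (f (y + x)) _ _ ⟨
  Σ< (suc x) (λ r → f (y + r)) + Σ< y f                 ∎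
  where open ≡-Reasoning

Σ<-blocks : ∀ a k f → Σ< (a * k) f ≡ Σ< a (λ q → Σ< k (λ r → f (q * k + r)))
Σ<-blocks zero    k f = refl
Σ<-blocks (suc a) k f = trans (Σ<-split k (a * k) f) (cong (Σ< k (λ r → f (a * k + r)) +_) (Σ<-blocks a k f))

Σ<-remove : ∀ N w {k} → k < N → Σ< N w ≡ w k + Σ< N (w [ k ↦ 0 ])
Σ<-remove (suc N) w {k} k< with m≤n⇒m<n∨m≡n (s≤s⁻¹ k<)
... | inj₂ refl = cong (w N +_) (trans (Σ<-cong N (λ i i< → sym (↦-other w 0 (<⇒≢ i<))))
                                       (cong (_+ Σ< N (w [ N ↦ 0 ])) (sym (↦-same w N 0))))
... | inj₁ k<N = begin
  w N + Σ< N w                                      ≡⟨ cong (w N +_) (Σ<-remove N w k<N) ⟩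
  w N + (w k + Σ< N (w [ k ↦ 0 ]))                  ≡⟨ +-assoc (w N) (w k) _ ⟨
  w N + w k + Σ< N (w [ k ↦ 0 ])                    ≡⟨ cong (_+ Σ< N (w [ k ↦ 0 ])) (+-comm (w N) (w k)) ⟩
  w k + w N + Σ< N (w [ k ↦ 0 ])                    ≡⟨ +-assoc (w k) (w N) _ ⟩
  w k + (w N + Σ< N (w [ k ↦ 0 ]))                  ≡⟨ cong (λ x → w k + (x + Σ< N (w [ k ↦ 0 ]))) (↦-other w 0 (≢-sym (<⇒≢ k<N))) ⟨
  w k + Σ< (suc N) (w [ k ↦ 0 ])                    ∎
  where open ≡-Reasoning

-- Induction on `T`: once the weight at `t T` has been taken out of the sum, it is replaced by 0,
-- and by injectivity no other summand notices.
Σ<-injective : ∀ T {N} (t w : ℕ → ℕ) → (∀ i → i < T → t i < N) →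
               (∀ i j → i < T → j < T → t i ≡ t j → i ≡ j) → Σ< T (w ∘ t) ≤ Σ< N w
Σ<-injective zero        t w t< inj = z≤n
Σ<-injective (suc T) {N} t w t< inj = begin
  w (t T) + Σ< T (w ∘ t)                   ≡⟨ cong (w (t T) +_) (Σ<-cong T (λ i i< → sym (↦-other w 0 (distinct i i<)))) ⟩
  w (t T) + Σ< T (w [ t T ↦ 0 ] ∘ t)       ≤⟨ +-monoʳ-≤ (w (t T)) (Σ<-injective T t (w [ t T ↦ 0 ])
                                                (λ i i< → t< i (m<n⇒m<1+n i<))
                                                (λ i j i< j< → inj i j (m<n⇒m<1+n i<) (m<n⇒m<1+n j<))) ⟩
  w (t T) + Σ< N (w [ t T ↦ 0 ])           ≡⟨ Σ<-remove N w (t< T ≤-refl) ⟨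
  Σ< N w                                   ∎
  where
  open ≤-Reasoning
  distinct : ∀ i → i < T → t i ≢ t T
  distinct i i< eq = <⇒≢ i< (inj i T (m<n⇒m<1+n i<) ≤-refl eq)

sumFrom-last : ∀ f h k → sumFrom f h (suc k) ≡ f (h + k) + sumFrom f h k
sumFrom-last f h zero    = cong (λ x → f x + 0) (sym (+-identityʳ h))
sumFrom-last f h (suc k) = begin
  f h + sumFrom f (suc h) (suc k)                   ≡⟨ cong (f h +_) (sumFrom-last f (suc h) k) ⟩
  f h + (f (suc h + k) + sumFrom f (suc h) k)       ≡⟨ +-assoc (f h) (f (suc h + k)) _ ⟨
  f h + f (suc h + k) + sumFrom f (suc h) k         ≡⟨ cong (_+ sumFrom f (suc h) k) (+-comm (f h) _) ⟩
  f (suc h + k) + f h + sumFrom f (suc h) k         ≡⟨ +-assoc (f (suc h + k)) (f h) _ ⟩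
  f (suc h + k) + sumFrom f h (suc k)               ≡⟨ cong (λ x → f x + sumFrom f h (suc k)) (+-suc h k) ⟨
  f (h + suc k) + sumFrom f h (suc k)               ∎
  where open ≡-Reasoning

sumFrom-Σ< : ∀ f k → sumFrom f 0 k ≡ Σ< k f
sumFrom-Σ< f zero    = refl
sumFrom-Σ< f (suc k) = trans (sumFrom-last f 0 k) (cong (f k +_) (sumFrom-Σ< f k))

indicator : ℕ → ℕ → ℕ
indicator k x = length (addIf (k ≟ x) 0 [])

-- The second component carries the induction: when the range reaches `k`, nothing below has
-- contributed.
Σ<-indicator : ∀ k N → Σ< N (indicator k) ≤ 1 × (N ≤ k → Σ< N (indicator k) ≡ 0)
Σ<-indicator k zero    = z≤n , λ _ → refl
Σ<-indicator k (suc N) with k ≟ N | Σ<-indicator k N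
... | yes refl | _ , none = s≤s (≤-reflexive (none ≤-refl)) , λ N<N → contradiction N<N (n≮n N)
... | no _     | ≤1 , none = ≤1 , λ N< → none (<⇒≤ N<)

length-addIf : ∀ {P : Set} (d : Dec P) i is → length (addIf d i is) ≡ length (addIf d 0 []) + length is
length-addIf (yes _) i is = refl
length-addIf (no _)  i is = refl

-- An item lies in the bucket of its key only, and in none of these if its key is not below `N`.
Σ<-bucket : ∀ key i N → Σ< N (λ x → length (bucket key i x)) ≤ i
Σ<-bucket key zero    N = ≤-reflexive (trans (Σ<-const N 0) (*-zeroʳ N))
Σ<-bucket key (suc i) N = begin
  Σ< N (λ x → length (bucket key (suc i) x))
    ≡⟨ Σ<-cong N (λ x _ → length-addIf (key i ≟ x) i (bucket key i x)) ⟩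
  Σ< N (λ x → indicator (key i) x + length (bucket key i x))
    ≡⟨ Σ<-+ N (indicator (key i)) (λ x → length (bucket key i x)) ⟩
  Σ< N (indicator (key i)) + Σ< N (λ x → length (bucket key i x))
    ≤⟨ +-mono-≤ (proj₁ (Σ<-indicator (key i) N)) (Σ<-bucket key i N) ⟩
  suc i ∎
  where open ≤-Reasoning

module _ {n : ℕ} ⦃ _ : NonZero n ⦄ where

  pair-/ : ∀ q {r} → r < n → (q * n + r) / n ≡ q
  pair-/ q {r} r< = trans (+-distrib-/-∣ˡ r (n∣m*n q))
    (trans (cong₂ _+_ (m*n/n≡m q n) (m<n⇒m/n≡0 r<)) (+-identityʳ q))

  pair-% : ∀ q {r} → r < n → (q * n + r) % n ≡ r
  pair-% q {r} r< = trans (cong (_% n) (+-comm (q * n) r)) (trans ([m+kn]%n≡m%n r q n) (m<n⇒m%n≡m r<))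

  -- The indices of the triples (A , u , v) are (A * n + u) * n + v.
  Σ<-triples : ∀ T N (a u v : ℕ → ℕ) (f : ℕ → ℕ → ℕ → ℕ) →
    (∀ i → i < T → a i < N × u i < n × v i < n) →
    (∀ i j → i < T → j < T → (a i * n + u i) * n + v i ≡ (a j * n + u j) * n + v j → i ≡ j) →
    Σ< T (λ i → f (a i) (u i) (v i)) ≤ Σ< N (λ x → Σ< n (λ y → Σ< n (λ z → f x y z)))
  Σ<-triples T N a u v f bnd inj = begin
    Σ< T (λ i → f (a i) (u i) (v i))
      ≡⟨ Σ<-cong T (λ i i< → let _ , u< , v< = bnd i i< in sym (w-index (a i) u< v<)) ⟩
    Σ< T (λ i → w ((a i * n + u i) * n + v i))
      ≤⟨ Σ<-injective T _ w (λ i i< → let a< , u< , v< = bnd i i< in pair-bound (pair-bound a< u<) v<) inj ⟩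
    Σ< (N * n * n) w
      ≡⟨ Σ<-blocks (N * n) n w ⟩
    Σ< (N * n) (λ q → Σ< n (λ z → w (q * n + z)))
      ≡⟨ Σ<-blocks N n _ ⟩
    Σ< N (λ x → Σ< n (λ y → Σ< n (λ z → w ((x * n + y) * n + z))))
      ≡⟨ Σ<-cong N (λ x _ → Σ<-cong n (λ y y< → Σ<-cong n (λ z z< → w-index x y< z<))) ⟩
    Σ< N (λ x → Σ< n (λ y → Σ< n (λ z → f x y z))) ∎
    where
    open ≤-Reasoning
    w : ℕ → ℕ
    w k = f (k / n / n) (k / n % n) (k % n)
    w-index : ∀ x {y z} → y < n → z < n → w ((x * n + y) * n + z) ≡ f x y z
    w-index x {y} {z} y< z<
      rewrite pair-/ (x * n + y) z< | pair-% (x * n + y) z< | pair-/ x y< | pair-% x y< = refl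

Σ<-rules : ∀ N n (r d₀ d₁ : ℕ → ℕ) →
  Σ< N (λ x → Σ< n (λ y → Σ< n (λ z → r x * suc (d₀ y + d₁ z)))) ≡
  Σ< N r * (n * (n + Σ< n d₁) + n * Σ< n d₀)
Σ<-rules N n r d₀ d₁ = begin
  Σ< N (λ x → Σ< n (λ y → Σ< n (λ z → r x * suc (d₀ y + d₁ z))))
    ≡⟨ Σ<-cong N (λ x _ → trans (Σ<-cong n (λ y _ → Σ<-* n (r x) _)) (Σ<-* n (r x) _)) ⟩
  Σ< N (λ x → r x * Q)
    ≡⟨ trans (Σ<-cong N (λ x _ → *-comm (r x) Q)) (trans (Σ<-* N Q r) (*-comm Q (Σ< N r))) ⟩
  Σ< N r * Q
    ≡⟨ cong (Σ< N r *_) Q≡ ⟩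
  Σ< N r * (n * (n + Σ< n d₁) + n * Σ< n d₀) ∎
  where
  open ≡-Reasoning
  Q : ℕ
  Q = Σ< n (λ y → Σ< n (λ z → suc (d₀ y + d₁ z)))
  inner : ∀ y → Σ< n (λ z → suc (d₀ y + d₁ z)) ≡ n + Σ< n d₁ + n * d₀ y
  inner y = begin
    Σ< n (λ z → suc (d₀ y + d₁ z))          ≡⟨ Σ<-+ n (λ _ → suc (d₀ y)) d₁ ⟩
    Σ< n (λ _ → suc (d₀ y)) + Σ< n d₁       ≡⟨ cong (_+ Σ< n d₁) (trans (Σ<-const n _) (*-suc n (d₀ y))) ⟩
    n + n * d₀ y + Σ< n d₁                  ≡⟨ +-assoc n (n * d₀ y) _ ⟩
    n + (n * d₀ y + Σ< n d₁)                ≡⟨ cong (n +_) (+-comm (n * d₀ y) _) ⟩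
    n + (Σ< n d₁ + n * d₀ y)                ≡⟨ +-assoc n (Σ< n d₁) _ ⟨
    n + Σ< n d₁ + n * d₀ y                  ∎
  Q≡ : Q ≡ n * (n + Σ< n d₁) + n * Σ< n d₀
  Q≡ = begin
    Q                                                    ≡⟨ Σ<-cong n (λ y _ → inner y) ⟩
    Σ< n (λ y → n + Σ< n d₁ + n * d₀ y)                  ≡⟨ Σ<-+ n (λ _ → n + Σ< n d₁) (λ y → n * d₀ y) ⟩
    Σ< n (λ _ → n + Σ< n d₁) + Σ< n (λ y → n * d₀ y)     ≡⟨ cong₂ _+_ (Σ<-const n _) (Σ<-* n n d₀) ⟩
    n * (n + Σ< n d₁) + n * Σ< n d₀                      ∎

-- The construction of the index

module Building (X : Input) (Y : Placement) (bounds : Execution.Bounds X Y) where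

  open Input X
  open Placement Y
  open Instance X
  open Tables
  open Execution X Y
  open Bounds bounds
  open Bounded endp< lhs≤ key≤
  open Core
  open Steps X Y bounds
  open Setup X Y bounds

  instance
    n-nonZero : NonZero n
    n-nonZero = >-nonZero 1≤n

  linked-empty : ∀ {next head key N} → (∀ x → head x ≡ 0) → Linked next head key N 0
  linked-empty {next} head≡0 x _ = subst (λ q → IsList next q []) (sym (head≡0 x)) []

  seeded-empty : ∀ {g} → tail g ≡ 0 → (∀ k → D g k ≡ 0) → Seeded g
  seeded-empty {g} refl D≡0 = record
    { core = record
        { bnd = λ _ () ; inj = λ _ _ () ; found = λ k d≢0 → contradiction (D≡0 k) d≢0
        ; wit = λ _ () ; sorted = λ _ _ _ () ; near = λ _ _ () }
    ; zero-dist = λ _ () }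

  total-work : ∀ {g} → Core g (tail g) →
    Σ< (tail g) (λ i → work (qA g i) (qU g i) (qV g i)) ≤ p * (n * (n + m) + n * m)
  total-work {g} c = begin
    Σ< (tail g) (λ i → work (qA g i) (qU g i) (qV g i))
      ≤⟨ Σ<-triples (tail g) (suc ν) (qA g) (qU g) (qV g) work
           (λ i i< → let a , b , d = bnd c i i< in s≤s a , b , d) (inj c) ⟩
    Σ< (suc ν) (λ x → Σ< n (λ y → Σ< n (λ z → work x y z)))
      ≡⟨ Σ<-rules (suc ν) n (λ x → length (rules x)) (λ y → length (bucket (endp 1) m y)) (λ z → length (bucket (endp 0) m z)) ⟩
    Σ< (suc ν) (λ x → length (rules x)) *
      (n * (n + Σ< n (λ z → length (bucket (endp 0) m z))) + n * Σ< n (λ y → length (bucket (endp 1) m y)))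
      ≤⟨ *-mono-≤ (Σ<-bucket key′ p (suc ν))
           (+-mono-≤ (*-monoʳ-≤ n (+-monoʳ-≤ n (Σ<-bucket (endp 0) m n))) (*-monoʳ-≤ n (Σ<-bucket (endp 1) m n))) ⟩
    p * (n * (n + m) + n * m) ∎
    where open ≤-Reasoning

  Arrays : Set
  Arrays = (ℕ → ℕ) × (ℕ → ℕ) × (ℕ → ℕ) × (ℕ → ℕ) × (ℕ → ℕ) × (ℕ → ℕ)

  BuildResult : ℕ → (hd₀ hd₁ nx₀ nx₁ ph : ℕ → ℕ) → Tables → Set
  BuildResult c hd₀ hd₁ nx₀ nx₁ ph g =
    Σ[ g′ ∈ Tables ] Σ[ ts ∈ Vec ℕ 15 ] Σ[ arrays ∈ Arrays ] Σ[ time ∈ ℕ ]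
      let hd₀′ , hd₁′ , nx₀′ , nx₁′ , ph′ , px′ = arrays in
      Exec buildBody
        (file (tail g) 0 0 0 0 0 0 0 0 0 0 0 0 0 0 0 0 , memory hd₀ hd₁ nx₀ nx₁ ph rhs g) time
        (frame₁₅ (tail g′) (tail g′) ts , memory hd₀′ hd₁′ nx₀′ nx₁′ ph′ px′ g′) ×
      time ≤ (20 + 9 * c) * (p * (n * n)) * tick × IndexFacts g′

  module Finished {g g₂ g₃ g′ ph′ px′ t₄} (tail≡ : tail g ≡ 0) (S : Seeds g ν 0 n g₂) (R : Prepared g₂ 0 p ph′ px′ g₃)
    {hd₀ hd₁ nx₀ nx₁} {l₀ : Linked nx₀ hd₀ (endp 1) n m} {l₁ : Linked nx₁ hd₁ (endp 0) n m}
    (Z : Searching.Searched l₀ l₁ (Prepared.linked R) g₃ 0 t₄ g′) where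

    open Searching.Searched Z

    facts : IndexFacts g′
    facts = record { sound = sound ; complete = λ _ → complete }
      where
      open Complete core closed
        (λ v v< → Covered-⊑ {A = ν} {v} {v} extends
                    (Covered-⊑ {A = ν} {v} {v} (Prepared.extends R) (Seeds.covered S v z≤n v<)))
        (λ i v i< ty≡ v< → Covered-⊑ {A = lhs i} {v} {v} extends (Prepared.epss R i v z≤n i< ty≡ v<))
      sound : ∀ {A u v} → u < n → v < n → D g′ (τ A u v) ≢ 0 →
              ∃[ xs ] Chain g′ (τ A u v) xs × Walk A u v xs × length xs ≤ DL
      sound {A} {u} {v} u< v< d≢0 with found core _ d≢0
      ... | i , i< , eq with bnd core i i<
      ... | _ , u′< , v′< with τ-injective {qA g′ i} {qU g′ i} {qV g′ i} {A} {u} {v} u′< v′< u< v< eq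
      ... | refl , refl , refl with wit core i i<
      ... | xs , ch , wk , len = xs , ch , wk , ≤-trans len (≤-trans i< (tail≤DL core))

    W : ℕ
    W = sumFrom (λ i → work (qA g′ i) (qU g′ i) (qV g′ i)) 0 count

    W≤ : W ≤ p * (n * (n + m) + n * m)
    W≤ = ≤-trans (≤-reflexive (trans (sumFrom-Σ< _ count) (cong (λ k → Σ< k _) total))) (total-work core)

    -- Every element of the queue was pushed by a charged step of the search or is a seed, of which
    -- there are at most `n` for the extra nonterminal and `n` per production.
    count≤ : count ≤ W + (p * n + n)
    count≤ = ≤-trans (≤-reflexive total) (≤-trans (Searching.Searched.tail≤ Z)
      (+-monoʳ-≤ W (≤-trans (Prepared.tail≤ R)
        (+-monoʳ-≤ (p * n) (≤-trans (Seeds.tail≤ S) (≤-reflexive (trans (cong (n +_) tail≡) (+-identityʳ n))))))))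

    doubled : ∀ k → k * 2tick ≡ k * 2 * tick
    doubled k = trans (cong (λ x → k * (tick + x)) (sym (+-identityʳ tick))) (sym (*-assoc k 2 tick))

    T₁ T₂ T₃ T₄ : ℕ
    T₁ = 1 + m
    T₂ = 1 + n * 2
    T₃ = 1 + p * (suc n * 2)
    T₄ = 1 + (count + W) * 2

    bound : ∀ c {t₁ t₂ t₃} → m ≤ c * n → t₁ ≤ tick + m * tick → t₂ ≤ tick + n * 2tick →
            t₃ ≤ tick + p * (suc n * 2tick) →
            suc (t₁ + suc (costₗ seedInit + suc (t₂ + suc (costₗ prodInit + suc (t₃ + t₄))))) ≤
            (20 + 9 * c) * (p * (n * n)) * tick
    bound c {t₁} {t₂} {t₃} m≤ t₁≤ t₂≤ t₃≤ = begin
      suc (t₁ + suc (costₗ seedInit + suc (t₂ + suc (costₗ prodInit + suc (t₃ + t₄)))))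
        ≡⟨ shuffle-times t₁ t₂ t₃ t₄ (costₗ seedInit) (costₗ prodInit) ⟩
      (5 + costₗ seedInit + costₗ prodInit) + t₁ + t₂ + t₃ + t₄
        ≤⟨ +-mono-≤ (+-mono-≤ (+-mono-≤ (+-mono-≤ (≤tick (5 + costₗ seedInit + costₗ prodInit) tt) t₁≤)
             (≤-trans t₂≤ (≤-reflexive (cong (tick +_) (doubled n)))))
             (≤-trans t₃≤ (≤-reflexive (cong (tick +_) (trans (cong (p *_) (doubled (suc n))) (sym (*-assoc p (suc n * 2) tick)))))))
             (≤-trans time≤ (≤-reflexive (cong (tick +_) (doubled (count + W))))) ⟩
      tick + T₁ * tick + T₂ * tick + T₃ * tick + T₄ * tick
        ≡⟨ cong (λ x → x + T₁ * tick + T₂ * tick + T₃ * tick + T₄ * tick) (*-identityˡ tick) ⟨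
      1 * tick + T₁ * tick + T₂ * tick + T₃ * tick + T₄ * tick
        ≡⟨ collect-times 1 T₁ T₂ T₃ T₄ tick ⟩
      (1 + T₁ + T₂ + T₃ + T₄) * tick
        ≤⟨ *-monoˡ-≤ tick (build-time-bound c 1≤n 1≤p m≤ W≤ count≤) ⟩
      (20 + 9 * c) * (p * (n * n)) * tick ∎
      where open ≤-Reasoning

  build-exec : ∀ c {hd₀ hd₁ nx₀ nx₁ ph g} → m ≤ c * n →
    (∀ x → hd₀ x ≡ 0) → (∀ x → hd₁ x ≡ 0) → (∀ x → ph x ≡ 0) → tail g ≡ 0 → (∀ k → D g k ≡ 0) →
    BuildResult c hd₀ hd₁ nx₀ nx₁ ph g
  build-exec c {hd₀} {hd₁} {nx₀} {nx₁} {ph} {g} m≤ hd₀≡ hd₁≡ ph≡ tail≡ D≡ =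
    after-links (link-edges-exec m {g = g} refl (linked-empty {key = endp 1} hd₀≡) (linked-empty {key = endp 0} hd₁≡))
    where
    Result : Set
    Result = BuildResult c hd₀ hd₁ nx₀ nx₁ ph g

    module _ {hd₀′ hd₁′ nx₀′ nx₁′ : ℕ → ℕ} {w₁ ru₁ t₁ : ℕ}
      (run₁ : Exec linkEdges
        (file (tail g) 0 0 0 0 0 0 0 0 0 0 0 0 0 0 0 0 , memory hd₀ hd₁ nx₀ nx₁ ph rhs g) t₁
        (file (tail g) 0 0 0 0 0 0 m 0 0 0 0 w₁ ru₁ 0 0 0 , memory hd₀′ hd₁′ nx₀′ nx₁′ ph rhs g))
      (t₁≤ : t₁ ≤ tick + m * tick)
      (l₀ : Linked nx₀′ hd₀′ (endp 1) n m) (l₁ : Linked nx₁′ hd₁′ (endp 0) n m) where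

      module _ {g₂ : Tables} {ru₂ rv₂ τ₂ t₂ : ℕ}
        (run₂ : Exec seedLoop
          (file (tail g) 0 0 0 0 0 1 m ν 0 0 0 0 ru₁ 0 0 0 , memory hd₀′ hd₁′ nx₀′ nx₁′ ph rhs g) t₂
          (file (tail g₂) 0 0 0 0 0 1 m ν 0 0 0 n ru₂ rv₂ τ₂ 0 , memory hd₀′ hd₁′ nx₀′ nx₁′ ph rhs g₂))
        (t₂≤ : t₂ ≤ tick + n * 2tick) (S : Seeds g ν 0 n g₂) where

        module _ {ph′ px′ : ℕ → ℕ} {g₃ : Tables} {b₃ A₃ w₃ ru₃ rv₃ τ₃ t₃ : ℕ}
          (run₃ : Exec linkProds
            (file (tail g₂) 0 0 0 0 0 1 0 ν 0 0 0 n ru₂ rv₂ τ₂ 0 , memory hd₀′ hd₁′ nx₀′ nx₁′ ph rhs g₂) t₃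
            (file (tail g₃) 0 b₃ 0 0 0 1 p A₃ 0 0 0 w₃ ru₃ rv₃ τ₃ 0 , memory hd₀′ hd₁′ nx₀′ nx₁′ ph′ px′ g₃))
          (t₃≤ : t₃ ≤ tick + p * (suc n * 2tick)) (R : Prepared g₂ 0 p ph′ px′ g₃) where

          open Searching {hd₀′} {hd₁′} {nx₀′} {nx₁′} {ph′} {px′} l₀ l₁ (Prepared.linked R)

          after-search : SearchResult g₃ 0 (b₃ ∷ 0 ∷ 0 ∷ 0 ∷ 1 ∷ p ∷ A₃ ∷ 0 ∷ 0 ∷ 0 ∷ w₃ ∷ ru₃ ∷ rv₃ ∷ τ₃ ∷ 0 ∷ []) → Result
          after-search (g′ , ts , t₄ , run₄ , Z) =
            g′ , ts , (hd₀′ , hd₁′ , nx₀′ , nx₁′ , ph′ , px′) , _ ,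
            run₁ then block tt then run₂ then block tt then run₃ then run₄ ,
            Finished.bound tail≡ S R Z c m≤ t₁≤ t₂≤ t₃≤ , Finished.facts tail≡ S R Z

          searched : Result
          searched = after-search (search-exec DL _ ≤-refl (Seeded.core (Prepared.seeded R)) z≤n (λ _ ()))

        after-prods : LinkProdsResult {hd₀′} {hd₁′} {nx₀′} {nx₁′} p ph rhs g₂ 0 0 0 0 0 ν 0 0 0 n ru₂ rv₂ τ₂ → Result
        after-prods (ph′ , px′ , g₃ , b₃ , A₃ , w₃ , ru₃ , rv₃ , τ₃ , t₃ , run₃ , t₃≤ , R) = searched run₃ t₃≤ R

      after-seeds : SeedsResult {hd₀′} {hd₁′} {nx₀′} {nx₁′} {ph} {rhs} n g 0 0 0 0 m ν 0 0 0 0 ru₁ 0 0 → Result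
      after-seeds (g₂ , ru₂ , rv₂ , τ₂ , t₂ , run₂ , t₂≤ , S) = after-prods run₂ t₂≤ S
        (link-prods-exec p refl (Seeds.seeded S) (linked-empty {key = key′} ph≡) (λ _ _ _ → refl))

    after-links : LinkEdgesResult m hd₀ hd₁ nx₀ nx₁ ph rhs g (tail g) 0 0 0 0 0 0 0 0 0 0 0 0 0 0 0 0 → Result
    after-links (hd₀′ , hd₁′ , nx₀′ , nx₁′ , w₁ , ru₁ , t₁ , run₁ , t₁≤ , l₀ , l₁) = after-seeds run₁ t₁≤ l₀ l₁
      (seeds-exec n refl (seeded-empty tail≡ D≡) ≤-refl (λ _ → nil))

-- Queries

srcR tgtR dstR pthR loR hiR : Fin #regs
srcR = # 1
tgtR = # 2
dstR = # 3
pthR = # 4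
loR  = iR
hiR  = eR

queryStart emitFirst emitLast emitOnly nextEntry : List Instr
queryStart =
  τR := τT (var startR) (var srcR) (var tgtR) ∷ dstR := get dist (var τR) ∷ pthR := var obR ∷
  loR := con 0 ∷ hiR := var dstR ⊖ con 1 ∷ []
emitFirst = put out (get WA (var τR)) (var loR) ∷ loR := con 1 ⊕ var loR ∷ []
emitLast  = put out (get WA (var τR)) (var hiR) ∷ hiR := var hiR ⊖ con 1 ∷ []
emitOnly  = put out (get WA (var τR)) (var loR) ∷ []
nextEntry = τR := get PA (var τR) ∷ []

-- The number of vertices is known beforehand, so vertices split off in front fill the output from
-- `loR` upwards and those split off at the end fill it from `hiR` downwards; the last vertex goes
-- where the two meet. No reversal or shift is needed.
unwind : Prog
unwind = loop (get KA (var τR))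
  (ite (get KA (var τR) ⊖ con 1) (blk emitLast) (blk emitFirst) ⨾ blk nextEntry)

queryBody : Prog
queryBody = blk queryStart ⨾ ite (var dstR) (unwind ⨾ blk emitOnly) (blk [])

Holds-∷ʳ : ∀ f a xs {x} → Holds f a xs → f (a + length xs) ≡ x → Holds f a (xs ++ [ x ])
Holds-∷ʳ f a []       _       eq = trans (cong f (sym (+-identityʳ a))) eq , tt
Holds-∷ʳ f a (y ∷ ys) (e , h) eq = e , Holds-∷ʳ f (suc a) ys h (trans (cong f (sym (+-suc a (length ys)))) eq)

module Querying (X : Input) (Y : Placement) where

  open Input X
  open Placement Y
  open Instance X
  open Tables
  open Execution X Y

  answering : (s t d pa tl h b u v par d′ lo A a δ hi w ru rv τ κ : ℕ) → Vec ℕ #regs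
  answering s t d pa tl h b u v par d′ lo A a δ hi w ru rv τ κ =
    tb ∷ s ∷ t ∷ d ∷ pa ∷ n ∷ m ∷ p ∷ ν ∷ start ∷ ib ∷ pb ∷ ob ∷
    tl ∷ h ∷ b ∷ u ∷ v ∷ par ∷ d′ ∷ lo ∷ A ∷ a ∷ δ ∷ hi ∷ w ∷ ru ∷ rv ∷ τ ∷ κ ∷ []

  indexed : (s t d pa : ℕ) → Vec ℕ 17 → Vec ℕ #regs
  indexed s t d pa ts = tb ∷ s ∷ t ∷ d ∷ pa ∷ n ∷ m ∷ p ∷ ν ∷ start ∷ ib ∷ pb ∷ ob ∷ ts

  store′ : (inp′ ty′ lhs′ ltr′ px hd₀ hd₁ nx₀ nx₁ ph : ℕ → ℕ) → (ℕ → ℕ) → Tables → Vec (ℕ → ℕ) #arrays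
  store′ inp′ ty′ lhs′ ltr′ px hd₀ hd₁ nx₀ nx₁ ph ou g =
    inp′ ∷ D g ∷ ou ∷ ty′ ∷ lhs′ ∷ ltr′ ∷ px ∷ hd₀ ∷ hd₁ ∷ nx₀ ∷ nx₁ ∷ ph ∷
    K g ∷ P g ∷ Wt g ∷ qA g ∷ qU g ∷ qV g ∷ []

  module Answering (DL+4≤B : 4 + DL ≤ B) (DL≤L : DL ≤ L) {inp′ ty′ lhs′ ltr′ px hd₀ hd₁ nx₀ nx₁ ph : ℕ → ℕ} where

    arrays : (ℕ → ℕ) → Tables → Vec (ℕ → ℕ) #arrays
    arrays = store′ inp′ ty′ lhs′ ltr′ px hd₀ hd₁ nx₀ nx₁ ph

    DL≤B : ∀ {x} → x ≤ DL → x < B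
    DL≤B x≤ = ≤-<-trans x≤ (<-≤-trans (m<n+m DL {4} z<s) DL+4≤B)

    -- Describes the output after `emitOnly`, although the loop ends before it. `frame` protects the
    -- vertices written earlier, which lie outside the window from `lo` to `hi`.
    record Written (g : Tables) (k′ lo′ : ℕ) (ou₁ ou : ℕ → ℕ) (lo hi : ℕ) (xs : List ℕ) : Set where
      field
        k′<   : k′ < DL
        lo′<  : lo′ < DL
      ou′ : ℕ → ℕ
      ou′ = ou₁ [ lo′ ↦ Wt g k′ ]
      field
        holds : Holds ou′ lo xs
        frame : ∀ i → i < lo ⊎ hi < i → ou′ i ≡ ou i

    UnwindResult : Tables → ℕ → List ℕ → (s t d pa tl h b u v par d′ lo A a δ hi w ru rv κ : ℕ) → (ℕ → ℕ) → Set
    UnwindResult g k xs s t d pa tl h b u v par d′ lo A a δ hi w ru rv κ ou =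
      Σ[ k′ ∈ ℕ ] Σ[ lo′ ∈ ℕ ] Σ[ hi′ ∈ ℕ ] Σ[ ou₁ ∈ (ℕ → ℕ) ] Σ[ time ∈ ℕ ]
        Exec unwind (answering s t d pa tl h b u v par d′ lo A a δ hi w ru rv k κ , arrays ou g) time
                    (answering s t d pa tl h b u v par d′ lo′ A a δ hi′ w ru rv k′ κ , arrays ou₁ g) ×
        time ≤ length xs * tick × Written g k′ lo′ ou₁ ou lo hi xs

    unwind-exec : ∀ {g k xs} → Chain g k xs →
      ∀ {s t d pa tl h b u v par d′ lo A a δ hi w ru rv κ ou} → suc hi ≡ lo + length xs → hi < DL →
      UnwindResult g k xs s t d pa tl h b u v par d′ lo A a δ hi w ru rv κ ou
    unwind-exec {g} {k} (stop k< D≡ K≡) {s} {t} {d} {pa} {tl} {h} {b} {u} {v} {par} {d′} {lo} {A} {a} {δ} {hi} {w} {ru} {rv} {κ} {ou} eq hi< =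
      finish (suc-injective (trans eq (+-comm lo 1)))
      where
      finish : hi ≡ lo → UnwindResult g k [ Wt g k ] s t d pa tl h b u v par d′ lo A a δ hi w ru rv κ ou
      finish refl =
        k , lo , lo , ou , _ , Semantics.stop (<-≤-trans k< DL≤L , tt) K≡ ,
        ≤-trans (≤tick (suc (cost ⌊ get KA (var τR) ⌋ₜ)) tt) (≤-reflexive (sym (+-identityʳ tick))) ,
        record { k′< = k< ; lo′< = hi< ; holds = ↦-same ou lo _ , tt
               ; frame = λ { i (inj₁ i<) → ↦-other ou _ (<⇒≢ i<) ; i (inj₂ <i) → ↦-other ou _ (≢-sym (<⇒≢ <i)) } }
    unwind-exec {g} {k} (left {xs = xs} k< D≡ K≡ ch) {s} {t} {d} {pa} {tl} {h} {b} {u} {v} {par} {d′} {lo} {A} {a} {δ} {hi} {w} {ru} {rv} {κ} {ou} eq hi< =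
      finish (unwind-exec ch (trans eq (+-suc lo (length xs))) hi<)
      where
      k<L : k < L
      k<L = <-≤-trans k< DL≤L
      lo≤hi : lo ≤ hi
      lo≤hi = ≤-trans (m≤m+n lo (length xs)) (≤-reflexive (suc-injective (trans (sym (+-suc lo (length xs))) (sym eq))))
      lo< : lo < DL
      lo< = ≤-<-trans lo≤hi hi<
      finish : UnwindResult g (P g k) xs s t d pa tl h b u v par d′ (suc lo) A a δ hi w ru rv κ (ou [ lo ↦ Wt g k ]) →
               UnwindResult g k (Wt g k ∷ xs) s t d pa tl h b u v par d′ lo A a δ hi w ru rv κ ou
      finish (k′ , lo′ , hi′ , ou₁ , time , run , time≤ , R) =
        k′ , lo′ , hi′ , ou₁ , _ ,
        again (k<L , tt) (λ z → contradiction (trans (sym K≡) z) λ ())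
          (ite-false (k<L , tt) (cong (_∸ 1) K≡) (block (k<L , lo< , DL≤B lo< , tt)) then block (k<L , tt)) run ,
        +-mono-≤ (≤tick (suc (cost ⌊ get KA (var τR) ⌋ₜ + suc (suc (cost ⌊ get KA (var τR) ⊖ con 1 ⌋ₜ + costₗ emitFirst) + costₗ nextEntry))) tt) time≤ ,
        record { k′< = Written.k′< R ; lo′< = Written.lo′< R
               ; holds = trans (Written.frame R lo (inj₁ ≤-refl)) (↦-same ou lo _) , Written.holds R
               ; frame = λ { i (inj₁ i<) → trans (Written.frame R i (inj₁ (m<n⇒m<1+n i<))) (↦-other ou _ (<⇒≢ i<))
                           ; i (inj₂ <i) → trans (Written.frame R i (inj₂ <i)) (↦-other ou _ (≢-sym (<⇒≢ (≤-<-trans lo≤hi <i)))) } }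
    unwind-exec {g} {k} (right {xs = xs} k< D≡ K≡ ch) {s} {t} {d} {pa} {tl} {h} {b} {u} {v} {par} {d′} {lo} {A} {a} {δ} {hi} {w} {ru} {rv} {κ} {ou} eq hi< =
      finish (unwind-exec ch (trans suc-hi-1 hi≡) (<-trans (≤-reflexive suc-hi-1) hi<))
      where
      k<L : k < L
      k<L = <-≤-trans k< DL≤L
      hi≡ : hi ≡ lo + length xs
      hi≡ = suc-injective (trans eq (trans (cong (lo +_) (length-∷ʳ xs (Wt g k))) (+-suc lo (length xs))))
      lo≤hi : lo ≤ hi
      lo≤hi = subst (lo ≤_) (sym hi≡) (m≤m+n lo (length xs))
      suc-hi-1 : suc (hi ∸ 1) ≡ hi
      suc-hi-1 = m+[n∸m]≡n {1} {hi} (subst (1 ≤_) (sym hi≡)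
        (≤-trans (n≢0⇒n>0 (λ z → Chain-pos ch (trans (Chain-D ch) z))) (m≤n+m (length xs) lo)))
      hi-1< : hi ∸ 1 < hi
      hi-1< = ≤-reflexive suc-hi-1
      finish : UnwindResult g (P g k) xs s t d pa tl h b u v par d′ lo A a δ (hi ∸ 1) w ru rv κ (ou [ hi ↦ Wt g k ]) →
               UnwindResult g k (xs ++ [ Wt g k ]) s t d pa tl h b u v par d′ lo A a δ hi w ru rv κ ou
      finish (k′ , lo′ , hi′ , ou₁ , time , run , time≤ , R) =
        k′ , lo′ , hi′ , ou₁ , _ ,
        again (k<L , tt) (λ z → contradiction (trans (sym K≡) z) λ ())
          (ite-true (k<L , tt) (λ z → contradiction (trans (sym (cong (_∸ 1) K≡)) z) λ ())
            (block (k<L , hi< , ≤-<-trans (m∸n≤m hi 1) (DL≤B (<⇒≤ hi<)) , tt)) then block (k<L , tt)) run ,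
        ≤-trans (+-mono-≤ (≤tick (suc (cost ⌊ get KA (var τR) ⌋ₜ + suc (suc (cost ⌊ get KA (var τR) ⊖ con 1 ⌋ₜ + costₗ emitLast) + costₗ nextEntry))) tt) time≤)
                (≤-reflexive (cong (_* tick) (sym (length-∷ʳ xs (Wt g k))))) ,
        record { k′< = Written.k′< R ; lo′< = Written.lo′< R
               ; holds = Holds-∷ʳ _ lo xs (Written.holds R)
                   (trans (cong (Written.ou′ R) (sym hi≡))
                          (trans (Written.frame R hi (inj₂ hi-1<)) (↦-same ou hi _)))
               ; frame = λ { i (inj₁ i<) → trans (Written.frame R i (inj₁ i<)) (↦-other ou _ (<⇒≢ (<-≤-trans i< lo≤hi)))
                           ; i (inj₂ <i) → trans (Written.frame R i (inj₂ (<-trans hi-1< <i))) (↦-other ou _ (≢-sym (<⇒≢ <i))) } }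

    module _ {g : Tables} {s t d pa : ℕ} {ou : ℕ → ℕ} where

      query-none : ∀ (ts : Vec ℕ 17) → τ start s t < DL → D g (τ start s t) ≡ 0 →
        Σ[ ts′ ∈ Vec ℕ 17 ] Σ[ time ∈ ℕ ]
          Exec queryBody (indexed s t d pa ts , arrays ou g) time (indexed s t 0 ob ts′ , arrays ou g) ×
          time ≤ tick
      query-none (tl ∷ h ∷ b ∷ u ∷ v ∷ par ∷ d′ ∷ lo ∷ A ∷ a ∷ δ ∷ hi ∷ w ∷ ru ∷ rv ∷ τ₀ ∷ κ ∷ []) k< D≡ =
        _ , _ ,
        subst (λ x → Exec queryBody (answering s t d pa tl h b u v par d′ lo A a δ hi w ru rv τ₀ κ , arrays ou g) _
                 (answering s t x ob tl h b u v par d′ 0 A a δ (D g (τ start s t) ∸ 1) w ru rv (τ start s t) κ ,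
                  arrays ou g)) D≡
          (block (DL≤B (<⇒≤ k<) , k< , ≤-<-trans (m∸n≤m (D g (τ start s t)) 1) (subst (_< B) (sym D≡) (DL≤B z≤n)) , tt)
            then ite-false tt D≡ (block tt)) ,
        ≤tick (suc (costₗ queryStart + suc (1 + 1))) tt

      query-some : ∀ (ts : Vec ℕ 17) {xs} → Chain g (τ start s t) xs → length xs ≤ DL →
        Σ[ ts′ ∈ Vec ℕ 17 ] Σ[ ou′ ∈ (ℕ → ℕ) ] Σ[ time ∈ ℕ ]
          Exec queryBody (indexed s t d pa ts , arrays ou g) time (indexed s t (length xs) ob ts′ , arrays ou′ g) ×
          time ≤ tick + length xs * tick × Holds ou′ 0 xs
      query-some (tl ∷ h ∷ b ∷ u ∷ v ∷ par ∷ d′ ∷ lo ∷ A ∷ a ∷ δ ∷ hi ∷ w ∷ ru ∷ rv ∷ τ₀ ∷ κ ∷ []) {xs} ch len≤ =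
        finish (unwind-exec ch suc-eq (≤-trans (≤-reflexive suc-eq) len≤))
        where
        dist₀ : ℕ
        dist₀ = D g (τ start s t)
        suc-eq : suc (dist₀ ∸ 1) ≡ length xs
        suc-eq = trans (m+[n∸m]≡n {1} (n≢0⇒n>0 (Chain-pos ch))) (Chain-D ch)
        k< : τ start s t < DL
        k< = Chain-< ch
        start-safe : τ start s t < B × (τ start s t < DL × (dist₀ ∸ 1 < B × ⊤))
        start-safe = DL≤B (<⇒≤ k<) , k< , ≤-<-trans (m∸n≤m dist₀ 1) (DL≤B (subst (_≤ DL) (sym (Chain-D ch)) len≤)) , tt
        c₁ : ℕ
        c₁ = suc (costₗ queryStart + suc (1 + 1))
        finish : UnwindResult g (τ start s t) xs s t dist₀ ob tl h b u v par d′ 0 A a δ (dist₀ ∸ 1) w ru rv κ ou →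
          Σ[ ts′ ∈ Vec ℕ 17 ] Σ[ ou′ ∈ (ℕ → ℕ) ] Σ[ time ∈ ℕ ]
            Exec queryBody (answering s t d pa tl h b u v par d′ lo A a δ hi w ru rv τ₀ κ , arrays ou g) time
                           (indexed s t (length xs) ob ts′ , arrays ou′ g) ×
            time ≤ tick + length xs * tick × Holds ou′ 0 xs
        finish (k′ , lo′ , hi′ , ou₁ , time , run , time≤ , R) =
          _ , Written.ou′ R , _ ,
          subst (λ x → Exec queryBody (answering s t d pa tl h b u v par d′ lo A a δ hi w ru rv τ₀ κ , arrays ou g) _
                   (answering s t x ob tl h b u v par d′ lo′ A a δ hi′ w ru rv k′ κ ,
                    arrays (Written.ou′ R) g)) (Chain-D ch)
            (block start-safe then ite-true tt (Chain-pos ch)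
              (run then block (<-≤-trans (Written.k′< R) DL≤L , Written.lo′< R , tt))) ,
          ≤-trans (+-middle c₁ time (costₗ emitOnly)) (+-mono-≤ (≤tick (c₁ + costₗ emitOnly) tt) time≤) ,
          Written.holds R

-- Derivations and paths

module Language {σ : ℕ} (𝒢 : CFG σ) where
  open CFG 𝒢

  data Generates : N → List (Fin σ) → Set where
    eps   : ∀ i {A} → prod i ≡ (A , []) → Generates A []
    term  : ∀ i {A a} → prod i ≡ (A , tm a ∷ []) → Generates A [ a ]
    left  : ∀ i {A a B w} → prod i ≡ (A , tm a ∷ nt B ∷ []) → Generates B w → Generates A (a ∷ w)
    right : ∀ i {A a B w} → prod i ≡ (A , nt B ∷ tm a ∷ []) → Generates B w → Generates A (w ++ [ a ])

  Step-∷ : ∀ s {x y} → Step 𝒢 x y → Step 𝒢 (s ∷ x) (s ∷ y)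
  Step-∷ s (step i α β from to) = step i (s ∷ α) β (cong (s ∷_) from) (cong (s ∷_) to)

  Step-++ : ∀ γ {x y} → Step 𝒢 x y → Step 𝒢 (x ++ γ) (y ++ γ)
  Step-++ γ (step i α β refl refl) =
    step i α (β ++ γ) (++-assoc α _ γ)
      (trans (++-assoc α _ γ) (cong (α ++_) (++-assoc (proj₂ (prod i)) β γ)))

  apply : ∀ i {A x} → prod i ≡ (A , x) → Step 𝒢 [ nt A ] x
  apply i {A} {x} eq = step i [] [] (cong (λ r → nt (proj₁ r) ∷ []) (sym eq))
    (trans (cong proj₂ (sym eq)) (sym (++-identityʳ (proj₂ (prod i)))))

  Generates⇒Derives : ∀ {A w} → Generates A w → Derives 𝒢 A w
  Generates⇒Derives (eps i eq)      = apply i eq ◅ ε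
  Generates⇒Derives (term i eq)     = apply i eq ◅ ε
  Generates⇒Derives (left i eq g)   = apply i eq ◅ gmap (tm _ ∷_) (Step-∷ (tm _)) (Generates⇒Derives g)
  Generates⇒Derives (right i {a = a} {w = w} eq g) =
    apply i eq ◅ subst (Star (Step 𝒢) _) (sym (map-++ tm w [ a ]))
      (gmap (_++ [ tm a ]) (Step-++ [ tm a ]) (Generates⇒Derives g))

  -- The words generated by a sentential form. Pulling them back along a derivation, from its last
  -- step to its first, yields `Generates` without reordering any steps.
  Matches : Form → List (Fin σ) → Set
  Matches []         w = w ≡ []
  Matches (tm a ∷ x) w = ∃[ w′ ] w ≡ a ∷ w′ × Matches x w′
  Matches (nt A ∷ x) w = ∃[ w₁ ] ∃[ w₂ ] w ≡ w₁ ++ w₂ × Generates A w₁ × Matches x w₂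

  Matches-++ : ∀ x {y w} → Matches (x ++ y) w → ∃[ w₁ ] ∃[ w₂ ] w ≡ w₁ ++ w₂ × Matches x w₁ × Matches y w₂
  Matches-++ []         m = [] , _ , refl , refl , m
  Matches-++ (tm a ∷ x) (w′ , refl , m) with Matches-++ x m
  ... | w₁ , w₂ , refl , m₁ , m₂ = a ∷ w₁ , w₂ , refl , (w₁ , refl , m₁) , m₂
  Matches-++ (nt A ∷ x) (v₁ , v₂ , refl , g , m) with Matches-++ x m
  ... | w₁ , w₂ , refl , m₁ , m₂ = v₁ ++ w₁ , w₂ , sym (++-assoc v₁ w₁ w₂) , (v₁ , w₁ , refl , g , m₁) , m₂

  ++-Matches : ∀ x {y w₁ w₂} → Matches x w₁ → Matches y w₂ → Matches (x ++ y) (w₁ ++ w₂)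
  ++-Matches []         refl m = m
  ++-Matches (tm a ∷ x) (w′ , refl , m₁) m = _ , refl , ++-Matches x m₁ m
  ++-Matches (nt A ∷ x) (v₁ , v₂ , refl , g , m₁) m = v₁ , _ , ++-assoc v₁ v₂ _ , g , ++-Matches x m₁ m

  Matches-tm : ∀ w → Matches (map tm w) w
  Matches-tm []      = refl
  Matches-tm (a ∷ w) = w , refl , Matches-tm w

  module _ (talnf : TALNF 𝒢) where

    Matches-rhs : ∀ i {w} → Matches (proj₂ (prod i)) w → Generates (proj₁ (prod i)) w
    Matches-rhs i = go (talnf i) refl
      where
      go : ∀ {r w} → TALNFProduction start r → prod i ≡ r → Matches (proj₂ r) w → Generates (proj₁ r) w
      go (A→a A a)    eq (_ , refl , refl) = term i eq
      go (A→aB A a B) eq (_ , refl , w₁ , _ , refl , g , refl) =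
        subst (λ w → Generates A (a ∷ w)) (sym (++-identityʳ w₁)) (left i eq g)
      go (A→Ba A B a) eq (w₁ , _ , refl , g , _ , refl , refl) = right i eq g
      go S→ε          eq refl = eps i eq

    Matches-Step : ∀ {x y w} → Step 𝒢 x y → Matches y w → Matches x w
    Matches-Step (step i α β refl refl) m with Matches-++ α m
    ... | w₁ , _ , refl , mα , m′ with Matches-++ (proj₂ (prod i)) m′
    ... | w₂ , w₃ , refl , mi , mβ = ++-Matches α mα (w₂ , w₃ , refl , Matches-rhs i mi , mβ)

    Matches-Star : ∀ {x y w} → Star (Step 𝒢) x y → Matches y w → Matches x w
    Matches-Star ε        m = m
    Matches-Star (s ◅ ss) m = Matches-Step s (Matches-Star ss m)

    Derives⇒Generates : ∀ {A w} → Derives 𝒢 A w → Generates A w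
    Derives⇒Generates {A} {w} d with Matches-Star d (Matches-tm w)
    ... | w₁ , _ , refl , g , refl = subst (Generates A) (sym (++-identityʳ w₁)) g

fin : ∀ {i N} → i < N → Σ[ i′ ∈ Fin N ] toℕ i′ ≡ i
fin i< = fromℕ< i< , toℕ-fromℕ< i<

module Paths {σ : ℕ} (G : LabeledDigraph σ) where
  open LabeledDigraph G

  snoc : ∀ {u v} → Path G u v → (e : Fin m) → v ≡ src e → Path G u (tgt e)
  snoc []      e refl = e ∷ []
  snoc (d ∷ π) e eq   = d ∷ snoc π e eq

  tr-snoc : ∀ {u v} (π : Path G u v) e eq → tr (snoc π e eq) ≡ tr π ++ [ label e ]
  tr-snoc []      e refl = refl
  tr-snoc (d ∷ π) e eq   = cong (label d ∷_) (tr-snoc π e eq)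

  nodes-snoc : ∀ {u v} (π : Path G u v) e eq → nodes (snoc π e eq) ≡ nodes π ++ [ tgt e ]
  nodes-snoc []      e refl = refl
  nodes-snoc (d ∷ π) e eq   = cong (src d ∷_) (nodes-snoc π e eq)

  length-nodes : ∀ {u v} (π : Path G u v) → length (nodes π) ≡ suc ∣ π ∣ₚ
  length-nodes []      = refl
  length-nodes (e ∷ π) = cong suc (length-nodes π)

  tr-[] : ∀ {u v} (π : Path G u v) → tr π ≡ [] → u ≡ v × ∣ π ∣ₚ ≡ 0
  tr-[] [] _ = refl , refl

  unsnoc : ∀ {u v} (π : Path G u v) w {a} → tr π ≡ w ++ [ a ] →
           Σ[ e ∈ Fin m ] Σ[ π′ ∈ Path G u (src e) ] tgt e ≡ v × label e ≡ a × tr π′ ≡ w × ∣ π ∣ₚ ≡ suc ∣ π′ ∣ₚ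
  unsnoc [] [] ()
  unsnoc [] (_ ∷ _) ()
  unsnoc (e ∷ π) [] eq with ∷-injective eq
  ... | l , t with tr-[] π t
  ... | end , len = e , [] , end , l , refl , cong suc len
  unsnoc (e ∷ π) (b ∷ w) eq with ∷-injective eq
  ... | l , t with unsnoc π w t
  ... | e′ , π′ , end , l′ , t′ , len = e′ , e ∷ π′ , end , l′ , cong₂ _∷_ l t′ , cong suc len

-- Walks of the encoded instance and derivations along paths

module Encoded {σ : ℕ} (G : LabeledDigraph σ) (𝒢 : CFG σ) (talnf : TALNF 𝒢)
  (inp ty lhs ltr rhs : ℕ → ℕ)
  (inp-src : ∀ e → inp (6 + toℕ e * 3 + 0) ≡ toℕ (LabeledDigraph.src G e))
  (inp-tgt : ∀ e → inp (6 + toℕ e * 3 + 1) ≡ toℕ (LabeledDigraph.tgt G e))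
  (inp-lab : ∀ e → inp (6 + toℕ e * 3 + 2) ≡ toℕ (LabeledDigraph.label G e))
  (prd : ∀ i → ty (toℕ i) ≡ contents (encodeProduction (talnf i)) 0 ×
               lhs (toℕ i) ≡ contents (encodeProduction (talnf i)) 1 ×
               ltr (toℕ i) ≡ contents (encodeProduction (talnf i)) 2 ×
               rhs (toℕ i) ≡ contents (encodeProduction (talnf i)) 3) where

  open LabeledDigraph G
  open CFG 𝒢

  X : Input
  X = record { n = n ; m = m ; p = p ; ν = ν ; inp = inp ; ty = ty ; lhs = lhs ; ltr = ltr ; rhs = rhs }

  open Instance X
  open Language 𝒢
  open Paths G

  Fields : Fin p → Production ν σ → Set
  Fields i (A , [])                 = ty (toℕ i) ≡ 3 × lhs (toℕ i) ≡ toℕ A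
  Fields i (A , tm a ∷ [])          = ty (toℕ i) ≡ 0 × lhs (toℕ i) ≡ toℕ A × ltr (toℕ i) ≡ toℕ a × key (toℕ i) ≡ ν
  Fields i (A , tm a ∷ nt B ∷ [])   = ty (toℕ i) ≡ 1 × lhs (toℕ i) ≡ toℕ A × ltr (toℕ i) ≡ toℕ a × key (toℕ i) ≡ toℕ B
  Fields i (A , nt B ∷ tm a ∷ [])   = ty (toℕ i) ≡ 2 × lhs (toℕ i) ≡ toℕ A × ltr (toℕ i) ≡ toℕ a × key (toℕ i) ≡ toℕ B
  Fields i _                        = ⊤

  fields : ∀ i {r} → prod i ≡ r → Fields i r
  fields i refl = go (talnf i) (prd i)
    where
    go : ∀ {r} (t : TALNFProduction start r) →
         ty (toℕ i) ≡ contents (encodeProduction t) 0 × lhs (toℕ i) ≡ contents (encodeProduction t) 1 ×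
         ltr (toℕ i) ≡ contents (encodeProduction t) 2 × rhs (toℕ i) ≡ contents (encodeProduction t) 3 → Fields i r
    go (A→a A a)    (t , l , a≡ , b) = t , l , a≡ ,
      trans (cong₂ (λ x y → (1 ∸ x) * ν + y) t b) (trans (+-identityʳ (ν + 0)) (+-identityʳ ν))
    go (A→aB A a B) (t , l , a≡ , b) = t , l , a≡ , cong₂ (λ x y → (1 ∸ x) * ν + y) t b
    go (A→Ba A B a) (t , l , a≡ , b) = t , l , a≡ , cong₂ (λ x y → (1 ∸ x) * ν + y) t b
    go S→ε          (t , l , a≡ , b) = t , l

  -- `talnf i` cannot be matched on directly, as its index `prod i` is not a variable; the cases
  -- carry an equation for `prod i` instead.
  data View (i : Fin p) : Set where
    term  : ∀ A a → prod i ≡ (A , tm a ∷ []) → View i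
    left  : ∀ A a B → prod i ≡ (A , tm a ∷ nt B ∷ []) → View i
    right : ∀ A B a → prod i ≡ (A , nt B ∷ tm a ∷ []) → View i
    eps   : prod i ≡ (start , []) → View i

  view : ∀ i → View i
  view i = go (talnf i) refl
    where
    go : ∀ {r} → TALNFProduction start r → prod i ≡ r → View i
    go (A→a A a)    eq = term A a eq
    go (A→aB A a B) eq = left A a B eq
    go (A→Ba A B a) eq = right A B a eq
    go S→ε          eq = eps eq

  endp< : ∀ j → j < m → endp 0 j < n × endp 1 j < n
  endp< j j< with fin j<
  ... | e , refl = subst (_< n) (sym (inp-src e)) (toℕ<n (src e)) , subst (_< n) (sym (inp-tgt e)) (toℕ<n (tgt e))

  lhs≤ : ∀ i → i < p → lhs i ≤ ν
  lhs≤ i i< with fin i<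
  ... | i′ , refl with view i′
  ... | term A a eq    = subst (_≤ ν) (sym (proj₁ (proj₂ (fields i′ eq)))) (<⇒≤ (toℕ<n A))
  ... | left A a B eq  = subst (_≤ ν) (sym (proj₁ (proj₂ (fields i′ eq)))) (<⇒≤ (toℕ<n A))
  ... | right A B a eq = subst (_≤ ν) (sym (proj₁ (proj₂ (fields i′ eq)))) (<⇒≤ (toℕ<n A))
  ... | eps eq         = subst (_≤ ν) (sym (proj₂ (fields i′ eq))) (<⇒≤ (toℕ<n start))

  ty≤3 : ∀ i → i < p → ty i ≤ 3
  ty≤3 i i< with fin i<
  ... | i′ , refl with view i′
  ... | term A a eq    = subst (_≤ 3) (sym (proj₁ (fields i′ eq))) z≤n
  ... | left A a B eq  = subst (_≤ 3) (sym (proj₁ (fields i′ eq))) (s≤s z≤n)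
  ... | right A B a eq = subst (_≤ 3) (sym (proj₁ (fields i′ eq))) (s≤s (s≤s z≤n))
  ... | eps eq         = ≤-reflexive (proj₁ (fields i′ eq))

  key≤ : ∀ i → i < p → ty i ≤ 2 → key i ≤ ν
  key≤ i i< ty≤ with fin i<
  ... | i′ , refl with view i′
  ... | term A a eq    = ≤-reflexive (proj₂ (proj₂ (proj₂ (fields i′ eq))))
  ... | left A a B eq  = subst (_≤ ν) (sym (proj₂ (proj₂ (proj₂ (fields i′ eq))))) (<⇒≤ (toℕ<n B))
  ... | right A B a eq = subst (_≤ ν) (sym (proj₂ (proj₂ (proj₂ (fields i′ eq))))) (<⇒≤ (toℕ<n B))
  ... | eps eq         = contradiction (subst (_≤ 2) (proj₁ (fields i′ eq)) ty≤) λ { (s≤s (s≤s ())) }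

  Derived : ℕ → List (Fin σ) → Set
  Derived A w = (A ≡ ν × w ≡ []) ⊎ (Σ[ A′ ∈ N ] toℕ A′ ≡ A × Generates A′ w)

  derived-nt : ∀ {A w} → A < ν → Derived A w → Σ[ A′ ∈ N ] toℕ A′ ≡ A × Generates A′ w
  derived-nt A< (inj₁ (refl , _)) = contradiction A< (n≮n _)
  derived-nt A< (inj₂ d) = d

  derived : ∀ {A w} → Derived (toℕ A) w → Generates A w
  derived {A} d with derived-nt (toℕ<n A) d
  ... | A′ , eq , g = subst (λ B → Generates B _) (toℕ-injective eq) g

  derived-ν : ∀ {w} → Derived ν w → w ≡ []
  derived-ν (inj₁ (_ , eq)) = eq
  derived-ν (inj₂ (A′ , eq , _)) = contradiction (subst (_< ν) eq (toℕ<n A′)) (n≮n ν)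

  Walk⇒Path : ∀ {A u v xs} → Walk A u v xs → ∀ {u′ v′} → toℕ u′ ≡ u → toℕ v′ ≡ v →
              Σ[ π ∈ Path G u′ v′ ] map toℕ (nodes π) ≡ xs × Derived A (tr π)
  Walk⇒Path (nil v<) u≡ v≡ with toℕ-injective (trans u≡ (sym v≡))
  ... | refl = [] , cong [_] u≡ , inj₁ (refl , refl)
  Walk⇒Path (eps i< ty≡ v<) u≡ v≡ with toℕ-injective (trans u≡ (sym v≡)) | fin i<
  ... | refl | i , refl = [] , cong [_] u≡ , inj₂ (go (view i))
    where
    impossible : ∀ {x} {P : Set} → x ≢ 3 → ty (toℕ i) ≡ x → P
    impossible x≢ eq = contradiction (trans (sym eq) ty≡) x≢
    go : View i → Σ[ A ∈ N ] toℕ A ≡ lhs (toℕ i) × Generates A []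
    go (eps eq)          = start , sym (proj₂ (fields i eq)) , eps i eq
    go (term A a eq)     = impossible (λ ()) (proj₁ (fields i eq))
    go (left A a B eq)   = impossible (λ ()) (proj₁ (fields i eq))
    go (right A B a eq)  = impossible (λ ()) (proj₁ (fields i eq))
  Walk⇒Path (left {xs = xs} i< ty≤ j< lab wk) {u′} u≡ v≡ with fin i< | fin j<
  ... | i , refl | e , refl with toℕ-injective {i = u′} {src e} (trans u≡ (inp-src e)) | Walk⇒Path wk {tgt e} (sym (inp-tgt e)) v≡
  ... | refl | π , nd , d = e ∷ π , cong₂ _∷_ u≡ nd , inj₂ (go (view i))
    where
    lab≡ : ∀ {a} → ltr (toℕ i) ≡ toℕ a → a ≡ label e
    lab≡ l = toℕ-injective (trans (sym l) (trans (sym lab) (inp-lab e)))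
    go : View i → Σ[ A ∈ N ] toℕ A ≡ lhs (toℕ i) × Generates A (label e ∷ tr π)
    go (term A a eq) = let _ , l , a≡ , k = fields i eq in A , sym l ,
      subst₂ (λ b w → Generates A (b ∷ w)) (lab≡ a≡) (sym (derived-ν (subst (λ x → Derived x _) k d))) (term i eq)
    go (left A a B eq) = let _ , l , a≡ , k = fields i eq in A , sym l ,
      subst (λ b → Generates A (b ∷ tr π)) (lab≡ a≡) (left i eq (derived (subst (λ x → Derived x _) k d)))
    go (right A B a eq) = contradiction (subst (_≤ 1) (proj₁ (fields i eq)) ty≤) λ { (s≤s ()) }
    go (eps eq)         = contradiction (subst (_≤ 1) (proj₁ (fields i eq)) ty≤) λ { (s≤s ()) }
  Walk⇒Path (right {xs = xs} i< ty≡ j< lab wk) {v′ = v′} u≡ v≡ with fin i< | fin j<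
  ... | i , refl | e , refl with toℕ-injective {i = v′} {tgt e} (trans v≡ (inp-tgt e)) | Walk⇒Path wk {v′ = src e} u≡ (sym (inp-src e))
  ... | refl | π , nd , d = snoc π e refl ,
    trans (cong (map toℕ) (nodes-snoc π e refl))
      (trans (map-++ toℕ (nodes π) [ tgt e ]) (cong₂ _++_ nd (cong [_] v≡))) ,
    inj₂ (go (view i))
    where
    lab≡ : ∀ {a} → ltr (toℕ i) ≡ toℕ a → a ≡ label e
    lab≡ l = toℕ-injective (trans (sym l) (trans (sym lab) (inp-lab e)))
    impossible : ∀ {x} {P : Set} → x ≢ 2 → ty (toℕ i) ≡ x → P
    impossible x≢ eq = contradiction (trans (sym eq) ty≡) x≢
    go : View i → Σ[ A ∈ N ] toℕ A ≡ lhs (toℕ i) × Generates A (tr (snoc π e refl))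
    go (right A B a eq) = let _ , l , a≡ , k = fields i eq in A , sym l ,
      subst (Generates A) (sym (tr-snoc π e refl))
        (subst (λ b → Generates A (tr π ++ [ b ])) (lab≡ a≡) (right i eq (derived (subst (λ x → Derived x _) k d))))
    go (term A a eq)   = impossible (λ ()) (proj₁ (fields i eq))
    go (left A a B eq) = impossible (λ ()) (proj₁ (fields i eq))
    go (eps eq)        = impossible (λ ()) (proj₁ (fields i eq))

  Walk-at : ∀ {A u v A′ u′ v′ xs} → A ≡ A′ → u ≡ u′ → v ≡ v′ → Walk A u v xs → Walk A′ u′ v′ xs
  Walk-at refl refl refl wk = wk

  WalkOf : ∀ {u v} → ℕ → Path G u v → Set
  WalkOf {u} {v} A π = ∃[ xs ] Walk A (toℕ u) (toℕ v) xs × length xs ≡ suc ∣ π ∣ₚ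

  left-walk : ∀ i e {u′ v A a b} {π : Path G u′ v} → tgt e ≡ u′ → ty (toℕ i) ≤ 1 → lhs (toℕ i) ≡ A →
              ltr (toℕ i) ≡ toℕ a → key (toℕ i) ≡ b → label e ≡ a → WalkOf b π →
              ∃[ xs ] Walk A (toℕ (src e)) (toℕ v) xs × length xs ≡ suc (suc ∣ π ∣ₚ)
  left-walk i e refl ty≤ lhs≡ ltr≡ key≡ refl (xs , wk , len) =
    _ , Walk-at lhs≡ (inp-src e) refl
          (left (toℕ<n i) ty≤ (toℕ<n e) (trans (inp-lab e) (sym ltr≡))
            (Walk-at (sym key≡) (sym (inp-tgt e)) refl wk)) ,
    cong suc len

  Generates⇒Walk : ∀ {A w u v} → Generates A w → (π : Path G u v) → tr π ≡ w → WalkOf (toℕ A) π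
  Generates⇒Walk (eps i eq) π t with tr-[] π t
  ... | refl , len = let ty≡ , l = fields i eq in
    _ , Walk-at l refl refl (eps (toℕ<n i) ty≡ (toℕ<n _)) , cong suc (sym len)
  -- The rest of the path is empty, and its walk is `nil` for the extra nonterminal at the target of
  -- the edge.
  Generates⇒Walk (term i eq) (e ∷ π) t with ∷-injective t
  ... | l , t′ with tr-[] π t′
  ... | end , len = let ty≡ , lhs≡ , ltr≡ , key≡ = fields i eq in
    left-walk i e {π = π} refl (≤-trans (≤-reflexive ty≡) z≤n) lhs≡ ltr≡ key≡ l
      ([ toℕ (tgt e) ] , Walk-at refl refl (cong toℕ end) (nil (toℕ<n (tgt e))) , cong suc (sym len))
  Generates⇒Walk (left i eq g) (e ∷ π) t with ∷-injective t
  ... | l , t′ = let ty≡ , lhs≡ , ltr≡ , key≡ = fields i eq in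
    left-walk i e {π = π} refl (≤-reflexive ty≡) lhs≡ ltr≡ key≡ l (Generates⇒Walk g π t′)
  Generates⇒Walk (right i {w = w} eq g) π t with unsnoc π w t
  ... | e , π′ , refl , refl , t′ , len with Generates⇒Walk g π′ t′
  ... | xs , wk , len′ = let ty≡ , lhs≡ , ltr≡ , key≡ = fields i eq in
    _ , Walk-at lhs≡ refl (inp-tgt e)
          (right (toℕ<n i) ty≡ (toℕ<n e) (trans (inp-lab e) (sym ltr≡))
            (Walk-at (sym key≡) refl (sym (inp-src e)) wk)) ,
    trans (length-∷ʳ xs _) (cong suc (trans len′ (sym len)))

-- The encoded input

contents-++ˡ : ∀ xs {ys i} → i < length xs → contents (xs ++ ys) i ≡ contents xs i
contents-++ˡ (x ∷ xs) {i = zero}  _  = refl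
contents-++ˡ (x ∷ xs) {i = suc i} i< = contents-++ˡ xs (s≤s⁻¹ i<)

contents-++ʳ : ∀ xs {ys} i → contents (xs ++ ys) (length xs + i) ≡ contents ys i
contents-++ʳ []       i = refl
contents-++ʳ (x ∷ xs) i = contents-++ʳ xs i

contents-end : ∀ xs {i} → length xs ≤ i → contents xs i ≡ 0
contents-end []       _ = refl
contents-end (x ∷ xs) {suc i} (s≤s le) = contents-end xs le

contents-All : ∀ {P : ℕ → Set} {xs} → P 0 → All P xs → ∀ i → P (contents xs i)
contents-All p0 []       i       = p0
contents-All p0 (p ∷ ps) zero    = p
contents-All p0 (p ∷ ps) (suc i) = contents-All p0 ps i

module _ {w : ℕ} where

  length-blocks : ∀ {k} (f : Fin k → List ℕ) → (∀ j → length (f j) ≡ w) → length (concat (tabulate f)) ≡ k * w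
  length-blocks {zero}  f len = refl
  length-blocks {suc k} f len =
    trans (length-++ (f zero)) (cong₂ _+_ (len zero) (length-blocks (λ j → f (suc j)) (λ j → len (suc j))))

  contents-blocks : ∀ {k} (f : Fin k → List ℕ) → (∀ j → length (f j) ≡ w) → ∀ j {r} → r < w →
                    contents (concat (tabulate f)) (toℕ j * w + r) ≡ contents (f j) r
  contents-blocks f len zero    r< = contents-++ˡ (f zero) (subst (_ <_) (sym (len zero)) r<)
  contents-blocks f len (suc j) {r} r< =
    trans (cong (contents (concat (tabulate f)))
            (trans (+-assoc w (toℕ j * w) r) (cong (_+ (toℕ j * w + r)) (sym (len zero)))))
      (trans (contents-++ʳ (f zero) (toℕ j * w + r))
             (contents-blocks (λ j → f (suc j)) (λ j → len (suc j)) j r<))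

sizeE : Expr
sizeE = (lit 1 ⊞ reg 8) ⊠ reg 5 ⊠ reg 5

prelude : Cmd
prelude =
  5 ≔ load (lit 0) ﹔ 6 ≔ load (lit 1) ﹔ 7 ≔ load (lit 4) ﹔ 8 ≔ load (lit 3) ﹔ 9 ≔ load (lit 5) ﹔
  11 ≔ lit 6 ⊞ reg 6 ⊠ lit 3 ﹔ 0 ≔ reg 11 ⊞ reg 7 ⊠ lit 4 ﹔
  12 ≔ reg 0 ⊞ sizeE ﹔ 10 ≔ reg 12 ⊞ sizeE

-- If `n * p` is 0, the time allowed is a constant, while the body would still run through the
-- edges, vertices or productions. The construction is skipped, and the initial table is already
-- correct. Otherwise `1 ≤ n` also ensures that the `suc ν` list heads of the productions fit into
-- an array.
guarded : Prog
guarded = ite (var nR ⊗ var pR) buildBody (blk [])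

buildProgram queryProgram : Cmd
buildProgram = prelude ﹔ ⌊ guarded ⌋
queryProgram = ⌊ queryBody ⌋

-- Correctness of the two programs on the word RAM

module Correctness {σ : ℕ} (G : LabeledDigraph σ) (𝒢 : CFG σ) (talnf : TALNF 𝒢) where

  open LabeledDigraph G
  open CFG 𝒢

  word : List ℕ
  word = encode G 𝒢 talnf

  edgeBlock : Fin m → List ℕ
  edgeBlock e = toℕ (src e) ∷ toℕ (tgt e) ∷ toℕ (label e) ∷ []

  prodBlock : Fin p → List ℕ
  prodBlock i = encodeProduction (talnf i)

  prodBlock-length : ∀ i → length (prodBlock i) ≡ 4
  prodBlock-length i = go (talnf i)
    where
    go : ∀ {r} (t : TALNFProduction start r) → length (encodeProduction t) ≡ 4
    go (A→a A a)    = refl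
    go (A→aB A a B) = refl
    go (A→Ba A B a) = refl
    go S→ε          = refl

  -- `L` is the common length of the interleaved arrays. It suffices for the tables and the queue as
  -- well as for arrays indexed by edges or vertices.
  pb tb ob ib DL′ L : ℕ
  pb  = 6 + m * 3
  tb  = pb + p * 4
  DL′ = suc ν * n * n
  ob  = tb + DL′
  ib  = ob + DL′
  L   = DL′ + (m + n)

  inp ty lhs ltr rhs ou : ℕ → ℕ
  inp   = contents word
  ty i  = inp (pb + (i * 4 + 0))
  lhs i = inp (pb + (i * 4 + 1))
  ltr i = inp (pb + (i * 4 + 2))
  rhs i = inp (pb + (i * 4 + 3))
  ou i  = inp (ob + i)

  edgesLength : length (concat (tabulate edgeBlock)) ≡ m * 3
  edgesLength = length-blocks edgeBlock (λ _ → refl)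

  prodsLength : length (concat (tabulate prodBlock)) ≡ p * 4
  prodsLength = length-blocks prodBlock prodBlock-length

  wordLength : length word ≡ tb
  wordLength = trans (cong (6 +_) (trans (length-++ (concat (tabulate edgeBlock))) (cong₂ _+_ edgesLength prodsLength)))
                     (sym (+-assoc 6 (m * 3) (p * 4)))

  inp-edge : ∀ e {r} → r < 3 → inp (6 + toℕ e * 3 + r) ≡ contents (edgeBlock e) r
  inp-edge e {r} r< =
    trans (contents-++ˡ (concat (tabulate edgeBlock))
            (subst (toℕ e * 3 + r <_) (sym edgesLength) (pair-bound (toℕ<n e) r<)))
          (contents-blocks edgeBlock (λ _ → refl) e r<)

  inp-prod : ∀ i {r} → r < 4 → inp (pb + (toℕ i * 4 + r)) ≡ contents (prodBlock i) r
  inp-prod i {r} r< =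
    trans (cong (λ l → contents (concat (tabulate edgeBlock) ++ concat (tabulate prodBlock)) (l + (toℕ i * 4 + r)))
             (sym edgesLength))
      (trans (contents-++ʳ (concat (tabulate edgeBlock)) (toℕ i * 4 + r))
             (contents-blocks prodBlock prodBlock-length i r<))

  inp-zero : ∀ {i} → tb ≤ i → inp i ≡ 0
  inp-zero tb≤ = contents-end word (≤-trans (≤-reflexive wordLength) tb≤)

  open Language 𝒢
  open Paths G
  open Encoded G 𝒢 talnf inp ty lhs ltr rhs
    (λ e → inp-edge e (s≤s z≤n)) (λ e → inp-edge e (s≤s (s≤s z≤n))) (λ e → inp-edge e ≤-refl)
    (λ i → inp-prod i (s≤s z≤n) , inp-prod i (s≤s (s≤s z≤n)) , inp-prod i (s≤s (s≤s (s≤s z≤n))) , inp-prod i ≤-refl)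
  open Instance X
  open Tables

  ν>0 : 1 ≤ ν
  ν>0 = ≤-trans (s≤s z≤n) (toℕ<n start)

  module _ {g : Tables} (F : IndexFacts g) where
    open IndexFacts F

    entry : N → V → V → ℕ
    entry A u v = D g (τ (toℕ A) (toℕ u) (toℕ v))

    entry-lower : ∀ {A u v} (π : Path G u v) → Derives 𝒢 A (tr π) → entry A u v ≢ 0 × entry A u v ≤ suc ∣ π ∣ₚ
    entry-lower {A} π d with Generates⇒Walk (Derives⇒Generates talnf d) π refl
    ... | xs , wk , len with complete (toℕ<n A) wk
    ... | a , b = a , ≤-trans b (≤-reflexive len)

    record Shortest (A : N) (u v : V) : Set where
      field
        xs      : List ℕ
        chain   : Chain g (τ (toℕ A) (toℕ u) (toℕ v)) xs
        xs≤     : length xs ≤ DL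
        path    : Path G u v
        nodes≡  : map toℕ (nodes path) ≡ xs
        derives : Derives 𝒢 A (tr path)
        xs≡     : length xs ≡ suc ∣ path ∣ₚ
        minimal : ∀ (π : Path G u v) → Derives 𝒢 A (tr π) → ∣ path ∣ₚ ≤ ∣ π ∣ₚ

    shortest : ∀ {A u v} → entry A u v ≢ 0 → Shortest A u v
    shortest {A} {u} {v} d≢0 with sound (toℕ<n u) (toℕ<n v) d≢0
    ... | xs , ch , wk , len with Walk⇒Path wk {u} {v} refl refl
    ... | π , nd , d = record
      { xs = xs ; chain = ch ; xs≤ = len ; path = π ; nodes≡ = nd
      ; derives = Generates⇒Derives (derived d) ; xs≡ = len≡
      ; minimal = λ π′ d′ → s≤s⁻¹ (≤-trans (≤-reflexive (trans (sym len≡) (sym (Chain-D ch)))) (proj₂ (entry-lower π′ d′))) }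
      where
      len≡ : length xs ≡ suc ∣ π ∣ₚ
      len≡ = trans (cong length (sym nd)) (trans (length-map toℕ (nodes π)) (length-nodes π))

    isDist : ∀ A u v → ∃[ d ] IsDist G 𝒢 A u v d × entry A u v ≡ code d
    isDist A u v with entry A u v in eq
    ... | zero  = nothing , (λ π d → proj₁ (entry-lower π d) eq) , refl
    ... | suc k = just k , ((path , derives , suc-injective (trans (sym xs≡) (trans (sym (Chain-D chain)) eq))) ,
                            (λ π d → s≤s⁻¹ (≤-trans (≤-reflexive (sym eq)) (proj₂ (entry-lower π d))))) , refl
      where open Shortest (shortest {A} {u} {v} (λ z → contradiction (trans (sym eq) z) λ ()))

  module OnMachine (c M W B : ℕ) (m≤ : m ≤ c * n) (top≤M : ib + L * 11 ≤ M) (top<B : ib + L * 11 < B)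
                   (16≤B : 16 ≤ B) (B⁸≤W : B ^ 8 ≤ W) (DL+4≤B : 4 + DL ≤ B)
                   (n<B : n < B) (m<B : m < B) (p<B : p < B) (sν<B : suc ν < B) (σ<B : σ < B) where

    module Lay = Layout tb ib pb ob pb p DL L
    open Lay.Disjoint ≤-refl ≤-refl ≤-refl ≤-refl
    open Simulation M W B top≤M (<⇒≤ top<B) 16≤B B⁸≤W
    open Rep

    ν<B : ν < B
    ν<B = <-trans (n<1+n ν) sν<B

    <W : ∀ {x} → x < B → x < W
    <W x< = <-≤-trans x< B≤W

    0<B : 0 < B
    0<B = ≤-trans (s≤s z≤n) 16≤B

    <B : ∀ {N} → N < B → (i : Fin N) → toℕ i < B
    <B N< i = <-trans (toℕ<n i) N<

    word<B : All (_< B) word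
    word<B = n<B ∷ m<B ∷ σ<B ∷ ν<B ∷ p<B ∷ <B ν<B start ∷
      ++⁺ (concat⁺ (tabulate⁺ λ e → <B n<B (src e) ∷ <B n<B (tgt e) ∷ <B σ<B (label e) ∷ []))
          (concat⁺ (tabulate⁺ λ i → go (talnf i)))
      where
      go : ∀ {r} (t : TALNFProduction start r) → All (_< B) (encodeProduction t)
      go (A→a A a)    = 0<B ∷ <B ν<B A ∷ <B σ<B a ∷ 0<B ∷ []
      go (A→aB A a A′) = ≤-trans (s≤s (s≤s z≤n)) 16≤B ∷ <B ν<B A ∷ <B σ<B a ∷ <B ν<B A′ ∷ []
      go (A→Ba A A′ a) = ≤-trans (s≤s (s≤s (s≤s z≤n))) 16≤B ∷ <B ν<B A ∷ <B σ<B a ∷ <B ν<B A′ ∷ []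
      go S→ε          = ≤-trans (s≤s (s≤s (s≤s (s≤s z≤n)))) 16≤B ∷ <B ν<B start ∷ 0<B ∷ 0<B ∷ []

    inp<B : ∀ i → inp i < B
    inp<B = contents-All 0<B word<B

    cellArray : ℕ → ℕ → ℕ
    cellArray f i = inp (ib + (i * 11 + f))

    g₀ : Tables
    g₀ = tables (λ i → inp (tb + i)) (cellArray 5) (cellArray 6) (cellArray 7) (cellArray 8) (cellArray 9) (cellArray 10) 0

    Y : Placement
    Y = record { start = toℕ start ; tb = tb ; ib = ib ; pb = pb ; ob = ob ; L = L ; B = B ; ou = ou }

    open Execution X Y using (file; memory; frame₁₅; Bounds)
    open Semantics Lay.len B
    open Querying X Y using (indexed; store′; module Answering)

    start-state : St
    start-state = file 0 0 0 0 0 0 0 0 0 0 0 0 0 0 0 0 0 ,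
      memory (cellArray 0) (cellArray 1) (cellArray 2) (cellArray 3) (cellArray 4) rhs g₀

    ib<B : ib < B
    ib<B = ≤-<-trans (m≤m+n ib (L * 11)) top<B
    ob<B : ob < B
    ob<B = ≤-<-trans (m≤m+n ob DL) ib<B
    tb<B : tb < B
    tb<B = ≤-<-trans (m≤m+n tb DL) ob<B
    pb<B : pb < B
    pb<B = ≤-<-trans (m≤m+n pb (p * 4)) tb<B
    DL<B : DL < B
    DL<B = <-≤-trans (m<n+m DL {4} z<s) DL+4≤B

    ob+DL≤M : ob + DL ≤ M
    ob+DL≤M = ≤-trans (m≤m+n ib (L * 11)) top≤M
    tb≤M : tb ≤ M
    tb≤M = ≤-trans (m≤m+n tb DL) (≤-trans (m≤m+n ob DL) ob+DL≤M)
    6≤M : 6 ≤ M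
    6≤M = ≤-trans (m≤m+n 6 (m * 3)) (≤-trans (m≤m+n pb (p * 4)) tb≤M)

    after-prelude : State
    after-prelude =
      setReg 10 ib (setReg 12 ob (setReg 0 tb (setReg 11 pb (setReg 9 (toℕ start)
        (setReg 8 ν (setReg 7 p (setReg 6 m (setReg 5 n (initial word)))))))))

    Rep-prelude : Rep after-prelude start-state
    Rep-prelude = record
      -- The register file of `start-state` is by computation the tabulation of the machine's
      -- registers.
      { regs≡ = λ i → sym (lookup∘tabulate (λ j → regs after-prelude (toℕ j)) i)
      ; regs< = λ i → lookup⁺ all< i
      ; mem≡  = mem₀
      ; mem<  = λ r i i< → subst (_< B) (mem₀ r i i<) (inp<B (Lay.address r i))
      ; tb≡ = refl ; ib≡ = refl ; pb≡ = refl ; ob≡ = refl }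
      where
      all< : VecAll.All (_< B) (proj₁ start-state)
      all< = tb<B ∷ 0<B ∷ 0<B ∷ 0<B ∷ 0<B ∷ n<B ∷ m<B ∷ p<B ∷ ν<B ∷ <B ν<B start ∷ ib<B ∷ pb<B ∷ ob<B ∷
        0<B ∷ 0<B ∷ 0<B ∷ 0<B ∷ 0<B ∷ 0<B ∷ 0<B ∷ 0<B ∷ 0<B ∷ 0<B ∷ 0<B ∷ 0<B ∷ 0<B ∷ 0<B ∷ 0<B ∷ 0<B ∷ 0<B ∷ []
      mem₀ : ∀ r i → i < Lay.len r → inp (Lay.address r i) ≡ lookup (proj₂ start-state) (pos r) i
      mem₀ r i _ = sym (trans (cong (λ f → f i) (lookup-map (pos r) (λ q k → inp (Lay.address q k)) arrs))
                              (cong (λ q → inp (Lay.address q i)) (lookup-pos r)))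

    run-prelude : Σ[ time ∈ ℕ ] Runs M W prelude (initial word) after-prelude time × time ≤ tick
    run-prelude = _ ,
      seq (assign (((tt , <W 0<B) , cell< (s≤s z≤n)) , <W n<B))
      (seq (assign (((tt , <W 1<B) , cell< (s≤s (s≤s z≤n))) , <W m<B))
      (seq (assign (((tt , <W 4<B) , cell< (s≤s (s≤s (s≤s (s≤s (s≤s z≤n)))))) , <W p<B))
      (seq (assign (((tt , <W 3<B) , cell< (s≤s (s≤s (s≤s (s≤s z≤n))))) , <W ν<B))
      (seq (assign (((tt , <W 5<B) , cell< ≤-refl) , <W (<B ν<B start)))
      (seq (assign (((tt , <W 6<B) , (((tt , <W m<B) , (tt , <W 3<B)) , <W (≤-<-trans (m≤n+m (m * 3) 6) pb<B))) , <W pb<B))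
      (seq (assign (((tt , <W pb<B) , (((tt , <W p<B) , (tt , <W 4<B)) , <W (≤-<-trans (m≤n+m (p * 4) pb) tb<B))) , <W tb<B))
      (seq (assign (((tt , <W tb<B) , size-ok) , <W ob<B))
      (assign (((tt , <W ob<B) , size-ok) , <W ib<B))))))))) ,
      ≤tick 55 tt
      where
      open Machine M W using (seq; assign)
      cell< : ∀ {i} → suc i ≤ 6 → i < M
      cell< i< = ≤-trans i< 6≤M
      lit< : ∀ k → T (k <ᵇ 16) → k < B
      lit< k k< = <-≤-trans (<ᵇ⇒< k 16 k<) 16≤B
      1<B = lit< 1 tt
      3<B = lit< 3 tt
      4<B = lit< 4 tt
      5<B = lit< 5 tt
      6<B = lit< 6 tt
      row≤DL : ∀ k n → k * n ≤ k * n * n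
      row≤DL k zero    = ≤-trans (≤-reflexive (*-zeroʳ k)) z≤n
      row≤DL k (suc n) = m≤m*n (k * suc n) (suc n)
      size-ok : (((((((⊤ × 1 < W) × (⊤ × ν < W)) × suc ν < W) × (⊤ × n < W)) × suc ν * n < W) × (⊤ × n < W)) × DL < W)
      size-ok = ((((((tt , <W 1<B) , (tt , <W ν<B)) , <W sν<B) , (tt , <W n<B)) , <W (≤-<-trans (row≤DL (suc ν) n) DL<B)) ,
                 (tt , <W n<B)) , <W DL<B

    -- The lists, the input and the output may hold anything. A query writes only to the output and
    -- to unconstrained registers, so the same `index` and `facts` serve for the next query.
    record Indexed (x : State) : Set where
      field
        {s₁ t₁ d₁ pa} : ℕ
        temps      : Vec ℕ 17
        {inp′ ty′ lhs′ ltr′ px hd₀ hd₁ nx₀ nx₁ ph output} : ℕ → ℕ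
        index      : Tables
        rep        : Rep x (indexed s₁ t₁ d₁ pa temps , store′ inp′ ty′ lhs′ ltr′ px hd₀ hd₁ nx₀ nx₁ ph output index)
        facts      : IndexFacts index

    DL≤L : DL ≤ L
    DL≤L = m≤m+n DL (m + n)

    -- Without vertices there are no walks, and without productions only the walks `nil`, which
    -- `A < ν` excludes.
    facts₀ : n * p ≡ 0 → IndexFacts g₀
    facts₀ np≡0 = record
      { sound    = λ _ _ d≢0 → contradiction (inp-zero (m≤m+n tb _)) d≢0
      ; complete = λ A< wk → go A< wk (m*n≡0⇒m≡0∨n≡0 n np≡0) }
      where
      open Bounded endp< lhs≤ key≤ using (Walk-bounded)
      go : ∀ {A u v xs} → A < ν → Walk A u v xs → n ≡ 0 ⊎ p ≡ 0 → Covered g₀ A u v (length xs)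
      go A< wk (inj₁ n≡0) = contradiction (proj₁ (proj₂ (Walk-bounded wk))) λ u< → n≮0 (subst (_ <_) n≡0 u<)
      go A< (nil v<)             (inj₂ p≡0) = contradiction A< (n≮n ν)
      go A< (eps i< _ _)         (inj₂ p≡0) = contradiction (subst (_ <_) p≡0 i<) n≮0
      go A< (left i< _ _ _ _)    (inj₂ p≡0) = contradiction (subst (_ <_) p≡0 i<) n≮0
      go A< (right i< _ _ _ _)   (inj₂ p≡0) = contradiction (subst (_ <_) p≡0 i<) n≮0

    guardCost : ℕ
    guardCost = cost ⌊ var nR ⊗ var pR ⌋ₜ

    BuildRun : Set
    BuildRun = Σ[ x ∈ State ] Σ[ time ∈ ℕ ]
      Runs M W buildProgram (initial word) x time ×
      time ≤ (22 + 9 * c) * tick * (1 ⊔ p * (n * n)) × Indexed x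

    build-skipped : ∀ {tₚ} → Runs M W prelude (initial word) after-prelude tₚ → tₚ ≤ tick → n * p ≡ 0 → BuildRun
    build-skipped {tₚ} runₚ tₚ≤ np≡0 = finish (simulate {c = guarded} Rep-prelude tt (ite-false tt np≡0 (block tt)))
      where
      two-ticks : tick + tick ≤ (22 + 9 * c) * tick * (1 ⊔ p * (n * n))
      two-ticks = ≤-trans (≤-trans (≤-reflexive (cong (tick +_) (sym (+-identityʳ tick))))
          (*-monoˡ-≤ tick (m≤m+n 2 (20 + 9 * c))))
        (m≤m*n ((22 + 9 * c) * tick) (1 ⊔ p * (n * n)) ⦃ >-nonZero (m≤m⊔n 1 (p * (n * n))) ⦄)
      finish : (∃[ x ] Runs M W ⌊ guarded ⌋ after-prelude x (suc (guardCost + 1)) × Rep x start-state) → BuildRun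
      finish (x , run , R) =
        x , _ , Machine.seq runₚ run ,
        ≤-trans (≤-trans (+-middle 1 tₚ (suc (guardCost + 1)))
                   (+-mono-≤ (≤tick (1 + suc (guardCost + 1)) tt) tₚ≤)) two-ticks ,
        record { temps = Vec.replicate 17 0 ; index = g₀ ; rep = R ; facts = facts₀ np≡0 }

    module Nondegenerate {tₚ} (runₚ : Runs M W prelude (initial word) after-prelude tₚ) (tₚ≤ : tₚ ≤ tick)
                         (np≢0 : n * p ≢ 0) where
      1≤n : 1 ≤ n
      1≤n = n≢0⇒n>0 (λ n≡0 → np≢0 (cong (_* p) n≡0))
      1≤p : 1 ≤ p
      1≤p = n≢0⇒n>0 (λ p≡0 → np≢0 (trans (cong (n *_) p≡0) (*-zeroʳ n)))
      ν<L : ν < L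
      ν<L = ≤-trans (≤-trans (m≤m*n (suc ν) n ⦃ >-nonZero 1≤n ⦄) (m≤m*n (suc ν * n) n ⦃ >-nonZero 1≤n ⦄)) DL≤L
      tb≤cell : ∀ x f → tb ≤ ib + (x * 11 + f)
      tb≤cell x f = ≤-trans (m≤m+n tb DL) (≤-trans (m≤m+n ob DL) (m≤m+n ib _))

      bounds : Bounds
      bounds = record
        { DL+4≤B = DL+4≤B ; 16≤B = 16≤B ; n≤B = <⇒≤ n<B ; m<B = m<B ; p<B = p<B ; ν<B = ν<B
        ; DL≤L = DL≤L ; n≤L = ≤-trans (m≤n+m n m) (m≤n+m (m + n) DL)
        ; m≤L = ≤-trans (m≤m+n m n) (m≤n+m (m + n) DL) ; ν<L = ν<L
        ; endp< = endp< ; lhs≤ = lhs≤ ; key≤ = key≤ ; ty≤3 = ty≤3 ; 1≤n = 1≤n ; 1≤p = 1≤p }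

      open Building X Y bounds using (build-exec; BuildResult)

      Q : ℕ
      Q = p * (n * n)

      -- The constant grows from 20 to 22 because the prelude and the guard take at most a tick
      -- each.
      bound : ∀ {time} → time ≤ (20 + 9 * c) * Q * tick → suc (tₚ + suc (guardCost + time)) ≤ (22 + 9 * c) * tick * (1 ⊔ Q)
      bound {time} time≤ = begin
        suc (tₚ + suc (guardCost + time))         ≡⟨ cong suc (sym (+-assoc tₚ (suc guardCost) time)) ⟩
        suc (tₚ + suc guardCost) + time           ≤⟨ +-mono-≤ (≤-trans (+-middle 1 tₚ (suc guardCost)) (+-mono-≤ (≤tick (1 + suc guardCost) tt) tₚ≤)) time≤ ⟩
        (tick + tick) + (20 + 9 * c) * Q * tick   ≤⟨ +-mono-≤ (≤-trans (≤-reflexive (cong (tick +_) (sym (+-identityʳ tick))))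
                                                                (m≤m*n (2 * tick) (1 ⊔ Q) ⦃ >-nonZero (m≤m⊔n 1 Q) ⦄))
                                                       (≤-trans (≤-reflexive (trans (*-assoc (20 + 9 * c) Q tick)
                                                                   (trans (cong ((20 + 9 * c) *_) (*-comm Q tick)) (sym (*-assoc (20 + 9 * c) tick Q)))))
                                                          (*-monoʳ-≤ ((20 + 9 * c) * tick) (m≤n⊔m 1 Q))) ⟩
        2 * tick * (1 ⊔ Q) + (20 + 9 * c) * tick * (1 ⊔ Q)
          ≡⟨ trans (cong (_* (1 ⊔ Q)) (*-distribʳ-+ tick 2 (20 + 9 * c))) (*-distribʳ-+ (1 ⊔ Q) (2 * tick) ((20 + 9 * c) * tick)) ⟨
        (22 + 9 * c) * tick * (1 ⊔ Q) ∎
        where open ≤-Reasoning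

      finish : BuildResult c (cellArray 0) (cellArray 1) (cellArray 2) (cellArray 3) (cellArray 4) g₀ → BuildRun
      finish (g , h ∷ ts , arrays , time , run , time≤ , F) =
        let x , run′ , R = simulate {c = guarded} Rep-prelude tt (ite-true tt np≢0 run) in
        x , _ , Machine.seq runₚ run′ , bound time≤ ,
        record { temps = tail g ∷ tail g ∷ h ∷ ts ; index = g ; rep = R ; facts = F }

      build-run : BuildRun
      build-run = finish (build-exec c m≤
        (λ x → inp-zero (tb≤cell x 0)) (λ x → inp-zero (tb≤cell x 1)) (λ x → inp-zero (tb≤cell x 4))
        refl (λ k → inp-zero (m≤m+n tb k)))

    run-build : BuildRun
    run-build = let _ , runₚ , tₚ≤ = run-prelude in choose runₚ tₚ≤ (n * p ≟ 0)
      where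
      choose : ∀ {tₚ} → Runs M W prelude (initial word) after-prelude tₚ → tₚ ≤ tick → Dec (n * p ≡ 0) → BuildRun
      choose runₚ tₚ≤ (yes np≡0) = build-skipped runₚ tₚ≤ np≡0
      choose runₚ tₚ≤ (no np≢0)  = Nondegenerate.build-run runₚ tₚ≤ np≢0

    stores : ∀ x → Indexed x → StoresDistances G 𝒢 M x
    stores x I = subst (λ a → a + ν * (n * n) ≤ M) (sym tb′) space , table
      where
      open Indexed I
      tb′ : regs x tableReg ≡ tb
      tb′ = regs≡ rep tbR
      space : tb + ν * (n * n) ≤ M
      space = ≤-trans (+-monoʳ-≤ tb (≤-trans (≤-reflexive (sym (*-assoc ν n n)))
                        (*-monoˡ-≤ n (*-monoˡ-≤ n (n≤1+n ν)))))
                (≤-trans (m≤m+n ob DL) ob+DL≤M)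
      table : ∀ A u v → ∃[ d ] IsDist G 𝒢 A u v d ×
              mem x (regs x tableReg + ((toℕ A * n + toℕ u) * n + toℕ v)) ≡ code d
      table A u v with isDist facts A u v
      ... | d , is , eq = d , is ,
        trans (cong (λ a → mem x (a + τ (toℕ A) (toℕ u) (toℕ v))) tb′)
          (trans (mem≡ rep dist _ (τ< (<⇒≤ (toℕ<n A)) (toℕ<n u) (toℕ<n v))) eq)

    Holds-shift : ∀ {f h : ℕ → ℕ} b a xs → (∀ i → i < a + length xs → f (b + i) ≡ h i) →
                  Holds h a xs → Holds f (b + a) xs
    Holds-shift b a []       _  _        = tt
    Holds-shift {f} {h} b a (x ∷ xs) eq (e , hs) =
      trans (eq a (m<m+n a z<s)) e ,
      subst (λ z → Holds f z xs) (+-suc b a)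
        (Holds-shift b (suc a) xs (λ i i< → eq i (subst (i <_) (sym (+-suc a (length xs))) i<)) hs)

    module _ (x : State) (I : Indexed x) (s t : V) where
      open Indexed I using (temps; index; facts; inp′; ty′; lhs′; ltr′; px; hd₀; hd₁; nx₀; nx₁; ph; output; rep)
      open Answering DL+4≤B DL≤L {inp′} {ty′} {lhs′} {ltr′} {px} {hd₀} {hd₁} {nx₀} {nx₁} {ph}

      asked : Rep (ask G 𝒢 s t x) (indexed (toℕ s) (toℕ t) (Indexed.d₁ I) (Indexed.pa I) temps , arrays output index)
      asked = Rep-assign (Rep-assign rep tgtR tt (refl {x = toℕ t}) (<B n<B t)) srcR tt (refl {x = toℕ s}) (<B n<B s)

      AnswerRun : Set
      AnswerRun = ∃[ x′ ] ∃[ time ] Runs M W queryProgram (ask G 𝒢 s t x) x′ time × Indexed x′ ×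
                  Answers G 𝒢 M (λ ℓ → 4 * tick * (1 ⊔ ℓ)) s t x′ time

      answer-none : entry facts start s t ≡ 0 → AnswerRun
      answer-none d≡0 = finish (query-none {g = index} temps (τ< (<⇒≤ (toℕ<n start)) (toℕ<n s) (toℕ<n t)) d≡0)
        where
        finish : (Σ[ ts′ ∈ Vec ℕ 17 ] Σ[ time ∈ ℕ ]
                   Exec queryBody (indexed (toℕ s) (toℕ t) (Indexed.d₁ I) (Indexed.pa I) temps , arrays output index) time
                                  (indexed (toℕ s) (toℕ t) 0 ob ts′ , arrays output index) ×
                   time ≤ tick) → AnswerRun
        finish (ts′ , time , run , time≤) =
          let x′ , run′ , R = simulate {c = queryBody} asked tt run in
          x′ , time , run′ , record { temps = ts′ ; index = index ; rep = R ; facts = facts } ,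
          inj₂ ((λ π acc → proj₁ (entry-lower facts π acc) d≡0) , regs≡ R dstR ,
                ≤-trans time≤ (≤-trans (m≤n*m tick 4) (≤-reflexive (sym (*-identityʳ (4 * tick))))))

      answer-some : Shortest facts start s t → AnswerRun
      answer-some Sh = finish (query-some temps (Shortest.chain Sh) (Shortest.xs≤ Sh))
        where
        open Shortest Sh
        ℓ : ℕ
        ℓ = ∣ path ∣ₚ
        bound : ∀ {time} → time ≤ tick + length xs * tick → time ≤ 4 * tick * (1 ⊔ ℓ)
        bound {time} time≤ = begin
          time                               ≤⟨ time≤ ⟩
          tick + length xs * tick            ≡⟨ cong (λ l → tick + l * tick) xs≡ ⟩
          -- The witness has ℓ + 1 vertices at a tick each, besides one tick of overhead; the
          -- maximum with 1 makes room for this even if the path is empty.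
          (2 + ℓ) * tick                     ≤⟨ *-monoˡ-≤ tick (+-mono-≤ (*-monoʳ-≤ 2 (m≤m⊔n 1 ℓ)) (≤-trans (m≤n⊔m 1 ℓ) (m≤n*m (1 ⊔ ℓ) 2))) ⟩
          (2 * (1 ⊔ ℓ) + 2 * (1 ⊔ ℓ)) * tick ≡⟨ cong (_* tick) (*-distribʳ-+ (1 ⊔ ℓ) 2 2) ⟨
          4 * (1 ⊔ ℓ) * tick                 ≡⟨ trans (*-assoc 4 (1 ⊔ ℓ) tick) (trans (cong (4 *_) (*-comm (1 ⊔ ℓ) tick)) (sym (*-assoc 4 tick (1 ⊔ ℓ)))) ⟩
          4 * tick * (1 ⊔ ℓ)                 ∎
          where open ≤-Reasoning
        finish : (Σ[ ts′ ∈ Vec ℕ 17 ] Σ[ ou′ ∈ (ℕ → ℕ) ] Σ[ time ∈ ℕ ]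
                   Exec queryBody (indexed (toℕ s) (toℕ t) (Indexed.d₁ I) (Indexed.pa I) temps , arrays output index) time
                                  (indexed (toℕ s) (toℕ t) (length xs) ob ts′ , arrays ou′ index) ×
                   time ≤ tick + length xs * tick × Holds ou′ 0 xs) → AnswerRun
        finish (ts′ , ou′ , time , run , time≤ , holds) =
          let x′ , run′ , R = simulate {c = queryBody} asked tt run in
          x′ , time , run′ , record { temps = ts′ ; index = index ; rep = R ; facts = facts } ,
          inj₁ (path , (derives , minimal) , trans (regs≡ R dstR) xs≡ ,
                subst₂ (λ a ys → StoredAt M x′ a ys) (sym (regs≡ R pthR)) (sym nodes≡)
                  (≤-trans (+-monoʳ-≤ ob xs≤) ob+DL≤M ,
                   subst (λ a → Holds (mem x′) a xs) (+-identityʳ ob)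
                     (Holds-shift ob 0 xs (λ i i< → mem≡ R out i (<-≤-trans i< xs≤)) holds)) ,
                bound time≤)

      answers : AnswerRun
      answers = choose (entry facts start s t ≟ 0)
        where
        choose : Dec (entry facts start s t ≡ 0) → AnswerRun
        choose (yes d≡0) = answer-none d≡0
        choose (no d≢0)  = answer-some (shortest facts d≢0)

-- Chosen to dominate all three demands: 37 + 11 c cells of memory, (22 + 9 c) ticks for the
-- construction and 4 ticks for a query.
constant : ℕ → ℕ
constant c = (40 + 11 * c) * tick

1≤tick : 1 ≤ tick
1≤tick = ≤tick 1 tt

memory≤constant : ∀ c → 37 + 11 * c ≤ constant c
memory≤constant c = ≤-trans (+-monoˡ-≤ (11 * c) (m≤m+n 37 3))
  (m≤m*n (40 + 11 * c) tick ⦃ >-nonZero 1≤tick ⦄)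

build≤constant : ∀ c → (22 + 9 * c) * tick ≤ constant c
build≤constant c = *-monoˡ-≤ tick (+-mono-≤ (m≤m+n 22 18) (*-monoˡ-≤ c (m≤m+n 9 2)))

query≤constant : ∀ c → 4 * tick ≤ constant c
query≤constant c = *-monoˡ-≤ tick (≤-trans (m≤m+n 4 36) (m≤m+n 40 (11 * c)))

square : ∀ x n → x * n ^ 2 ≡ x * (n * n)
square x n = cong (λ k → x * (n * k)) (*-identityʳ n)

Answers-≤ : ∀ {σ} (G : LabeledDigraph σ) (𝒢 : CFG σ) {M} {b b′ : ℕ → ℕ} {s t x time} →
            (∀ ℓ → b ℓ ≤ b′ ℓ) → Answers G 𝒢 M b s t x time → Answers G 𝒢 M b′ s t x time
Answers-≤ G 𝒢 b≤ (inj₁ (π , sh , d , st , t≤)) = inj₁ (π , sh , d , st , ≤-trans t≤ (b≤ ∣ π ∣ₚ))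
Answers-≤ G 𝒢 b≤ (inj₂ (none , d , t≤))        = inj₂ (none , d , ≤-trans t≤ (b≤ 0))

theorem5p3 : Σ[ build ∈ Cmd ] Σ[ query ∈ Cmd ] Σ[ k ∈ ℕ ]
    ((c : ℕ) → Σ[ C ∈ ℕ ]
    (∀ {σ} (G : LabeledDigraph σ) (𝒢 : CFG σ) →
    Linear 𝒢 → (talnf : TALNF 𝒢) →
    ∣E∣ G ≤ c * ∣V∣ G →
    (M : ℕ) → M ≡ memoryBound G 𝒢 talnf C (∣N∣ 𝒢 * ∣V∣ G ^ 2) →
    Σ[ Index ∈ (State → Set) ]
    (∃[ x ] ∃[ time ]
    Runs M (wordBound G 𝒢 k) build (initial (encode G 𝒢 talnf)) x time ×
    time ≤ O[ C ] (∣P∣ 𝒢 * ∣V∣ G ^ 2) ×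
    Index x) ×
    IsLinDistIndex G 𝒢 M (wordBound G 𝒢 k) O[ C ] query Index))
theorem5p3 = buildProgram , queryProgram , wordExponent , λ c → constant c , correct c
  where
  correct : ∀ c {σ} (G : LabeledDigraph σ) (𝒢 : CFG σ) → Linear 𝒢 → (talnf : TALNF 𝒢) →
    ∣E∣ G ≤ c * ∣V∣ G → (M : ℕ) → M ≡ memoryBound G 𝒢 talnf (constant c) (∣N∣ 𝒢 * ∣V∣ G ^ 2) →
    Σ[ Index ∈ (State → Set) ]
    (∃[ x ] ∃[ time ]
    Runs M (wordBound G 𝒢 wordExponent) buildProgram (initial (encode G 𝒢 talnf)) x time ×
    time ≤ O[ constant c ] (∣P∣ 𝒢 * ∣V∣ G ^ 2) ×
    Index x) ×
    IsLinDistIndex G 𝒢 M (wordBound G 𝒢 wordExponent) O[ constant c ] queryProgram Index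
  correct c {σ} G 𝒢 _ talnf m≤ M refl =
    Indexed ,
    (let x , time , run , time≤ , I = run-build in
     x , time , run ,
     ≤-trans time≤ (≤-trans (*-monoˡ-≤ (1 ⊔ p * (n * n)) (build≤constant c))
       (≤-reflexive (cong O[ constant c ] (sym (square p n))))) , I) ,
    λ x I → stores x I , λ s t →
      let x′ , time , run , I′ , a = answers x I s t in
      x′ , time , run , I′ , Answers-≤ G 𝒢 {s = s} {t} {x′} {time} (λ ℓ → *-monoˡ-≤ (1 ⊔ ℓ) (query≤constant c)) a
    where
    open LabeledDigraph G
    open CFG 𝒢
    open Sizes n m σ ν p
    open Correctness G 𝒢 talnf using (tb; ob; ib; DL′; L; wordLength; ν>0; word; module OnMachine)
    top≤M : ib + L * 11 ≤ M
    top≤M = begin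
      ib + L * 11                                   ≡⟨ trans (+-assoc ob DL′ (L * 11)) (+-assoc tb DL′ _) ⟩
      tb + (DL′ + (DL′ + L * 11))                   ≤⟨ +-mono-≤ (≤-reflexive (sym wordLength)) (memory-bound c ν>0 m≤) ⟩
      length word + (37 + 11 * c) * (ν * (n * n))   ≤⟨ +-monoʳ-≤ (length word) (*-mono-≤ (memory≤constant c)
                                                         (≤-trans (≤-reflexive (sym (square ν n))) (m≤n⊔m 1 (ν * n ^ 2)))) ⟩
      M                                             ∎
      where open ≤-Reasoning
    open OnMachine c M (wordBound G 𝒢 wordExponent) (valueBound S) m≤ top≤M (top<B refl) 16≤B
      (valueBound^8≤ S) 4+size≤B (<B n≤S) (<B m≤S) (<B p≤S) sν<B (<B σ≤S)
      using (Indexed; run-build; stores; answers)
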